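{- The exponential generating function $F_1(x,y)$ of connected bipartite graphs with Betti number $1$ is expressed as $F_1 = f_1(W)$ with $f_1(w) = -\frac{1}{2}\big( \log(1-w) + w \big)$, i.e., \[ F_1(x,y) = -\frac{1}{2}\Big( \log(1-T_xT_y) + T_x T_y \Big). \]
   Context: For integers $r,s\ge 0$ and $k$, $N_{\rm bi}(r,s,k)$ is the number of connected bipartite simple graphs with labeled bipartition $V_1\sqcup V_2$, $|V_1|=r$, $|V_2|=s$, having exactly $r+s+k-1$ edges; equivalently, the number of connected spanning subgraphs of the complete bipartite graph $K_{r,s}$ with $r+s+k-1$ edges (so the Betti number is $k$). Conventions: if $rs=0$, then $N_{\rm bi}(r,s,k)=1$ if $k=0$ and $(r,s)\in\{(1,0),(0,1)\}$, and $0$ otherwise. It is known that $N_{\rm bi}(r,s,0)=r^{s-1}s^{r-1}$ for $r,s\ge1$. For $k\ge 0$ let $F_k(x,y) = \sum_{r,s=0}^{\infty} \frac{N_{\rm bi}(r,s,k)}{r!s!}x^r y^s$ (formal power series), and put $T:=F_0$. With the Euler operators $D_x=x\partial_x$, $D_y=y\partial_y$, put $T_x = D_xT$, $T_y=D_yT$, $W=T_xT_y$. (Subscripts $x,y$ denote application of $D_x,D_y$, not ordinary partial derivatives.) -}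

module Defs where

open import Data.Bool.Base using (Bool; true; false)
open import Data.Empty using (⊥)
open import Data.Fin.Base using (Fin; toℕ)
import Data.Fin.Properties as Fin
open import Data.Fin.Subset using (Subset; ∣_∣) renaming (_∈_ to _∈ₛ_)
open import Data.Fin.Subset.Properties using () renaming (_∈?_ to _∈ₛ?_)
open import Data.Integer.Base as ℤ using (ℤ; +_)
import Data.Integer.Properties as ℤ
open import Data.List.Base as List using (List; []; _∷_; _++_; allFin; cartesianProductWith; filter; length)
open import Data.List.Membership.Propositional using (_∈_)
open import Data.List.Membership.Propositional.Properties
  using (∈-allFin; ∈-map⁺; ∈-++⁺ˡ; ∈-++⁺ʳ; ∈-cartesianProductWith⁺)
import Data.List.Relation.Unary.All as All
open import Data.List.Relation.Unary.AllPairs using ([]; _∷_)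
open import Data.List.Relation.Unary.Any using (here; there)
open import Data.List.Relation.Unary.Unique.Propositional using (Unique)
open import Data.List.Relation.Unary.Unique.Propositional.Properties using (cartesianProductWith⁺)
open import Data.Nat.Base as ℕ using (ℕ; zero; suc; _∸_; _!)
open import Data.Nat.Properties using (_!*_!≢0)
open import Data.Product.Base using (_×_; _,_)
open import Data.Rational.Base as ℚ using (ℚ; 0ℚ; 1ℚ; -½)
open import Data.Rational.Properties using (+-0-commutativeMonoid)
open import Data.Sum.Base using (_⊎_; inj₁; inj₂)
import Data.Sum.Properties as Sum
open import Data.Vec.Base as Vec using (Vec; []; _∷_; lookup)
open import Data.Vec.Properties using (∷-injective)
open import Relation.Binary.Construct.Closure.ReflexiveTransitive using (Star; ε; _◅_; _◅◅_)
open import Relation.Binary.Core using (Rel)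
open import Relation.Binary.Definitions using (Decidable; DecidableEquality)
open import Relation.Binary.PropositionalEquality using (_≡_; refl)
open import Relation.Nullary.Decidable using (Dec; yes; no; map′; _×-dec_; _⊎-dec_)
import Level

open import Algebra.Properties.CommutativeMonoid.Sum +-0-commutativeMonoid using (sum⁺-syntax)

------------------------------------------------------------------------
-- Decidability of reachability in a finite graph

module Reachability
  {V : Set} (_≟_ : DecidableEquality V)
  {_~_ : Rel V Level.zero} (_~?_ : Decidable _~_)
  where

  -- Floyd–Warshall: Via ws u v says that v can be reached from u by a
  -- path all of whose intermediate vertices lie in ws.
  Via : List V → V → V → Set
  Via []       u v = u ≡ v ⊎ u ~ v
  Via (w ∷ ws) u v = Via ws u v ⊎ (Via ws u w × Via ws w v)

  via? : ∀ ws → Decidable (Via ws)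
  via? []       u v = (u ≟ v) ⊎-dec (u ~? v)
  via? (w ∷ ws) u v = via? ws u v ⊎-dec (via? ws u w ×-dec via? ws w v)

  via⇒star : ∀ ws {u v} → Via ws u v → Star _~_ u v
  via⇒star []       (inj₁ refl)    = ε
  via⇒star []       (inj₂ e)       = e ◅ ε
  via⇒star (w ∷ ws) (inj₁ p)       = via⇒star ws p
  via⇒star (w ∷ ws) (inj₂ (p , q)) = via⇒star ws p ◅◅ via⇒star ws q

  via-base : ∀ ws {u v} → u ≡ v ⊎ u ~ v → Via ws u v
  via-base []       p = p
  via-base (w ∷ ws) p = inj₁ (via-base ws p)

  via-trans : ∀ {ws u v w} → w ∈ ws → Via ws u w → Via ws w v → Via ws u v
  via-trans (here refl) (inj₁ p)       (inj₁ q)       = inj₂ (p , q)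
  via-trans (here refl) (inj₁ p)       (inj₂ (_ , q)) = inj₂ (p , q)
  via-trans (here refl) (inj₂ (p , _)) (inj₁ q)       = inj₂ (p , q)
  via-trans (here refl) (inj₂ (p , _)) (inj₂ (_ , q)) = inj₂ (p , q)
  via-trans (there w∈)  (inj₁ p)       (inj₁ q)       = inj₁ (via-trans w∈ p q)
  via-trans (there w∈)  (inj₁ p)       (inj₂ (q , r)) = inj₂ (via-trans w∈ p q , r)
  via-trans (there w∈)  (inj₂ (p , q)) (inj₁ r)       = inj₂ (p , via-trans w∈ q r)
  via-trans (there w∈)  (inj₂ (p , _)) (inj₂ (_ , q)) = inj₂ (p , q)

  star⇒via : ∀ {ws} → (∀ w → w ∈ ws) → ∀ {u v} → Star _~_ u v → Via ws u v
  star⇒via {ws} all∈ ε        = via-base ws (inj₁ refl)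
  star⇒via {ws} all∈ (e ◅ es) =
    via-trans (all∈ _) (via-base ws (inj₂ e)) (star⇒via all∈ es)

  star? : ∀ ws → (∀ w → w ∈ ws) → Decidable (Star _~_)
  star? ws all∈ u v = map′ (via⇒star ws) (star⇒via all∈) (via? ws u v)

------------------------------------------------------------------------
-- Bipartite graphs

-- A simple bipartite graph on Fin r ⊎ Fin s, i.e. a spanning subgraph of
-- K_{r,s}: entry i is the set of neighbours of the left vertex i.
Graph : ℕ → ℕ → Set
Graph r s = Vec (Subset s) r

Vertex : ℕ → ℕ → Set
Vertex r s = Fin r ⊎ Fin s

Adj : ∀ {r s} → Graph r s → Rel (Vertex r s) Level.zero
Adj G (inj₁ i) (inj₂ j) = j ∈ₛ lookup G i
Adj G (inj₂ j) (inj₁ i) = j ∈ₛ lookup G i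
Adj G (inj₁ _) (inj₁ _) = ⊥
Adj G (inj₂ _) (inj₂ _) = ⊥

#edges : ∀ {r s} → Graph r s → ℕ
#edges G = Vec.sum (Vec.map ∣_∣ G)

-- The null graph satisfies this vacuously; Nbi treats it separately.
Connected : ∀ {r s} → Graph r s → Set
Connected G = ∀ u v → Star (Adj G) u v

adj? : ∀ {r s} (G : Graph r s) → Decidable (Adj G)
adj? G (inj₁ i) (inj₂ j) = j ∈ₛ? lookup G i
adj? G (inj₂ j) (inj₁ i) = j ∈ₛ? lookup G i
adj? G (inj₁ _) (inj₁ _) = no λ ()
adj? G (inj₂ _) (inj₂ _) = no λ ()

vertices : ∀ r s → List (Vertex r s)
vertices r s = List.map inj₁ (allFin r) ++ List.map inj₂ (allFin s)

∈-vertices : ∀ {r s} (v : Vertex r s) → v ∈ vertices r s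
∈-vertices     (inj₁ i) = ∈-++⁺ˡ (∈-map⁺ inj₁ (∈-allFin i))
∈-vertices {r} (inj₂ j) = ∈-++⁺ʳ (List.map inj₁ (allFin r)) (∈-map⁺ inj₂ (∈-allFin j))

connected? : ∀ {r s} (G : Graph r s) → Dec (Connected G)
connected? {r} {s} G =
  map′ (λ c u v → All.lookup (All.lookup c (∈-vertices u)) (∈-vertices v))
       (λ c → All.tabulate λ {u} _ → All.tabulate λ {v} _ → c u v)
       (All.all? (λ u → All.all? (star? u) (vertices r s)) (vertices r s))
  where
  star? : Decidable (Star (Adj G))
  star? = Reachability.star? (Sum.≡-dec Fin._≟_ Fin._≟_) (adj? G) (vertices r s) ∈-vertices

allVecs : {A : Set} → List A → ∀ n → List (Vec A n)
allVecs xs zero    = [] ∷ []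
allVecs xs (suc n) = cartesianProductWith _∷_ xs (allVecs xs n)

allGraphs : ∀ r s → List (Graph r s)
allGraphs r s = allVecs (allVecs (true ∷ false ∷ []) s) r

-- allGraphs lists every graph exactly once, so lengths of its filtered
-- sublists are cardinalities.

∈-allVecs : ∀ {A : Set} {xs : List A} → (∀ x → x ∈ xs) → ∀ {n} (v : Vec A n) → v ∈ allVecs xs n
∈-allVecs all∈ []      = here refl
∈-allVecs all∈ (x ∷ v) = ∈-cartesianProductWith⁺ _∷_ (all∈ x) (∈-allVecs all∈ v)

allVecs-unique : ∀ {A : Set} {xs : List A} → Unique xs → ∀ n → Unique (allVecs xs n)
allVecs-unique xs! zero    = All.[] ∷ []
allVecs-unique xs! (suc n) = cartesianProductWith⁺ _∷_ ∷-injective xs! (allVecs-unique xs! n)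

∈-allGraphs : ∀ {r s} (G : Graph r s) → G ∈ allGraphs r s
∈-allGraphs = ∈-allVecs (∈-allVecs λ { true → here refl ; false → there (here refl) })

allGraphs-unique : ∀ r s → Unique (allGraphs r s)
allGraphs-unique r s =
  allVecs-unique (allVecs-unique (((λ ()) All.∷ All.[]) ∷ All.[] ∷ []) s) r

-- Betti number k means r + s + k - 1 edges; as k may be negative this
-- equation lives in ℤ.
Nbi : ℕ → ℕ → ℤ → ℕ
Nbi r@(suc _) s@(suc _) k =
  length (filter
    (λ G → connected? G ×-dec (+ #edges G ℤ.≟ + r ℤ.+ + s ℤ.+ k ℤ.- ℤ.1ℤ))
    (allGraphs r s))
Nbi 1 0 (+ 0) = 1
Nbi 0 1 (+ 0) = 1
Nbi _ _ _     = 0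

------------------------------------------------------------------------
-- Formal power series over ℚ

-- f n is the coefficient of wⁿ.
Series₁ : Set
Series₁ = ℕ → ℚ

-- f i j is the coefficient of xⁱ yʲ.
Series₂ : Set
Series₂ = ℕ → ℕ → ℚ

infix  4 _≈_
infixl 6 _⊕_
infixl 7 _⊛_ _∙_
infixr 8 _^_
infix  9 _⟨_⟩

_≈_ : Series₂ → Series₂ → Set
f ≈ g = ∀ i j → f i j ≡ g i j

_⊕_ : Series₂ → Series₂ → Series₂
(f ⊕ g) i j = f i j ℚ.+ g i j

_∙_ : ℚ → Series₂ → Series₂
(c ∙ f) i j = c ℚ.* f i j

_⊛_ : Series₂ → Series₂ → Series₂
(f ⊛ g) i j = ∑[ a ≤ i ] (∑[ b ≤ j ] (f (toℕ a) (toℕ b) ℚ.* g (i ∸ toℕ a) (j ∸ toℕ b)))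

one : Series₂
one 0 0 = 1ℚ
one _ _ = 0ℚ

_^_ : Series₂ → ℕ → Series₂
f ^ zero  = one
f ^ suc n = f ⊛ f ^ n

-- Substitution h(f) = Σₙ hₙ fⁿ, meaningful only when f has zero constant
-- term: then fⁿ has no terms of total degree below n, so the coefficient
-- of xⁱ yʲ only involves n ≤ i + j.
_⟨_⟩ : Series₁ → Series₂ → Series₂
(h ⟨ f ⟩) i j = ∑[ n ≤ i ℕ.+ j ] (h (toℕ n) ℚ.* (f ^ toℕ n) i j)

Dx : Series₂ → Series₂
Dx f i j = (+ i ℚ./ 1) ℚ.* f i j

Dy : Series₂ → Series₂
Dy f i j = (+ j ℚ./ 1) ℚ.* f i j

-- log(1 - w) = - Σ_{n ≥ 1} wⁿ / n
log[1-w] : Series₁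
log[1-w] zero      = 0ℚ
log[1-w] n@(suc _) = ℚ.- (+ 1 ℚ./ n)

w : Series₁
w 1 = 1ℚ
w _ = 0ℚ

log[1-_] : Series₂ → Series₂
log[1- f ] = log[1-w] ⟨ f ⟩

f₁ : Series₁
f₁ n = -½ ℚ.* (log[1-w] n ℚ.+ w n)

------------------------------------------------------------------------
-- The generating functions

F : ℕ → Series₂
F k r s = (+ Nbi r s (+ k)) ℚ./ (r ! ℕ.* s !)
  where instance _ = r !* s !≢0

T Tx Ty W : Series₂
T  = F 0
Tx = Dx T
Ty = Dy T
W  = Tx ⊛ Ty

{-# OPTIONS --safe #-}
module Submission where

-- Let C(x,y,q) be the exponential generating function of connected bipartite graphs,
-- with q marking edges, and G = Σ (1+q)^{rs} x^r y^s / (r! s!) that of all graphs.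
-- Splitting off the component of a root gives D_x G = G · D_x C and D_y G = G · D_y C,
-- and (1+q) D_q G = q D_x D_y G turns into (1+q) D_q C = q (D_x D_y C + D_x C · D_y C).
-- As q C(x,y,q) = Σ_k F_k(qx,qy) q^k, the two lowest orders in q read
--   T_x + T_y = T + T_x T_y,
--   D_x F₁ + D_y F₁ + T_x T_y = T_xy + T_x · D_y F₁ + D_x F₁ · T_y.
-- For the derivation L = (1 - T_y) D_x + (1 - T_x) D_y the first equation yields
-- L W = 2 W and a Riccati equation for T_xy, whose solution is T_xy = W / (1 - W).
-- The second one becomes L F₁ = T_xy - W = W² / (1 - W), which is also L (f₁(W)).
-- Both solutions are unique, because to lowest order L multiplies a homogeneous
-- component by its degree.

open import Algebra.Bundles using (CommutativeRing; RawRing)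
import Algebra.Properties.CommutativeMonoid.Sum
open import Algebra.Solver.Ring.AlmostCommutativeRing using (fromCommutativeRing; _-Raw-AlmostCommutative⟶_; -raw-almostCommutative⟶)
import Algebra.Solver.Ring as RingSolver
open import Data.Bool.Base using (Bool; true; false; if_then_else_)
import Data.Bool.Properties as Bool
open import Data.Empty using (⊥-elim)
open import Data.Fin.Base using (Fin; zero; suc; toℕ)
import Data.Fin.Properties as Fin
open import Data.Fin.Subset using (Subset; ∣_∣; ∁)
open import Data.Integer.Base as ℤ using ()
import Data.Integer.Properties as ℤ
import Data.Integer.Solver
open import Data.List.Base as List using (List; []; _∷_; _++_; allFin; cartesianProductWith; filter; length)
import Data.List.Properties as List
import Data.List.Relation.Unary.All as All
open import Data.Maybe.Base using (Maybe; just; nothing)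
open import Data.Nat.Base as ℕ using (ℕ; zero; suc; _!; _∸_; z≤n; s≤s)
import Data.Nat.Properties as ℕ
import Data.Nat.Solver
open import Data.Product.Base using (_×_; _,_; proj₁; proj₂; ∃)
open import Data.Rational.Base as ℚ using (ℚ; 0ℚ; 1ℚ; -½)
import Data.Rational.Properties as ℚ
open import Data.Rational.Unnormalised.Base using (mkℚᵘ; *≡*)
import Data.Rational.Unnormalised.Properties as ℚᵘ
open import Data.Sum.Base as Sum using (_⊎_; inj₁; inj₂)
import Data.Sum.Properties as Sum
open import Data.Vec.Base as Vec using (Vec; []; _∷_; lookup; zipWith; tabulate)
import Data.Vec.Properties as Vec
open import Function.Base using (_∘_; id)
open import Level using (0ℓ)
open import Relation.Binary.Construct.Closure.ReflexiveTransitive as Star using (Star; ε; _◅_; _◅◅_)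
open import Relation.Binary.Definitions using (Decidable; Symmetric)
open import Relation.Binary.PropositionalEquality as ≡ using (_≡_)
open import Relation.Nullary.Decidable using (Dec; yes; no; does; _×-dec_; dec-true; dec-false)
open import Relation.Nullary.Negation using (¬_)

open import Defs using (module Reachability; Graph; Vertex; Adj; #edges; Connected; adj?; vertices; ∈-vertices; connected?; allVecs; allGraphs; Nbi; F; T)


-- Between `G` and `C` no logarithm, exponential or inverse of a series is formed: `G` has constant
-- term 1, hence can be cancelled, and C = log G is used only through logarithmic derivatives.
-- Likewise 1 / (1 - W) enters only as the linear equation T_xy = W + W T_xy. The factor 1 + q in
-- front of D_q compensates the exponent lowered in D_q (1+q)^n = n q (1+q)^(n-1), and the number rs
-- of possible edges is then supplied by D_x D_y. Passing from edges to Betti numbers needs that a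
-- connected graph on n vertices has at least n - 1 edges. No spanning tree is built for this: the
-- bound follows from the differential equation for C by induction on the number of edges. In the
-- Riccati equation, the third derivatives of T combine to L T_xy; the remaining product T_xx T_yy
-- is eliminated through L T_x = T_x and L T_y = T_y. As W / (1 - W) is a known solution, T_xy (1 -
-- W) - W satisfies a homogeneous linear equation, to which the degree argument applies. The series
-- f₁(W) is compared with F₁ one truncation at a time, with an exact remainder, so no infinite sum
-- occurs.

-- Solving ring identities with integer coefficients

-- Equality in an abstract ring is undecidable, so coefficients taken from `R` itself would never
-- cancel. Integers act on every ring and have decidable equality, which lets `x - x` normalise to
-- zero.
module IntegerSolver (R : CommutativeRing 0ℓ 0ℓ) where
  open CommutativeRing R
  open import Algebra.Properties.Semiring.Mult semiring renaming (_×_ to _·_)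
  open import Relation.Binary.Reasoning.Setoid setoid
  private
    module S = RingSolver rawRing (fromCommutativeRing R)
      (-raw-almostCommutative⟶ (fromCommutativeRing R)) (λ _ _ → nothing)

    -- (m , n) stands for the integer m - n; reduction keeps one entry zero, so
    -- that equal coefficients are syntactically equal.
    reduce : ℕ × ℕ → ℕ × ℕ
    reduce (m , n) = (m ℕ.∸ n , n ℕ.∸ m)

    Coeff : RawRing 0ℓ 0ℓ
    Coeff = record
      { Carrier = ℕ × ℕ
      ; _≈_ = _≡_
      ; _+_ = λ { (a , b) (c , d) → reduce (a ℕ.+ c , b ℕ.+ d) }
      ; _*_ = λ { (a , b) (c , d) → reduce (a ℕ.* c ℕ.+ b ℕ.* d , a ℕ.* d ℕ.+ b ℕ.* c) }
      ; -_ = λ { (a , b) → (b , a) }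
      ; 0# = (0 , 0)
      ; 1# = (1 , 0)
      }

    ⟦_⟧ᶜ : ℕ × ℕ → Carrier
    ⟦ a , b ⟧ᶜ = a · 1# - b · 1#

    *-expand : ∀ a b c d → (a - b) * (c - d) ≈ (a * c + b * d) - (a * d + b * c)
    *-expand a b c d = begin
      (a - b) * (c - d)                            ≈⟨ distribʳ _ a (- b) ⟩
      a * (c - d) + - b * (c - d)                  ≈⟨ +-cong (distribˡ a c (- d)) (sym (-‿distribˡ-* b _)) ⟩
      (a * c + a * - d) - b * (c - d)              ≈⟨ +-cong (+-congˡ (sym (-‿distribʳ-* a d)))
                                                             (-‿cong (trans (distribˡ b c (- d)) (+-congˡ (sym (-‿distribʳ-* b d))))) ⟩
      (a * c - a * d) - (b * c - b * d)            ≈⟨ +-congˡ (trans (sym (⁻¹-∙-comm _ _)) (+-congˡ (⁻¹-involutive _))) ⟩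
      (a * c - a * d) + (- (b * c) + b * d)        ≈⟨ M.solve 4 (λ x y z t → (x M.⊕ y) M.⊕ (z M.⊕ t) M.⊜ (x M.⊕ t) M.⊕ (y M.⊕ z)) refl _ _ _ _ ⟩
      (a * c + b * d) + (- (a * d) - b * c)        ≈⟨ +-congˡ (⁻¹-∙-comm _ _) ⟩
      (a * c + b * d) - (a * d + b * c)            ∎
      where open import Algebra.Properties.Ring ring using (-‿distribˡ-*; -‿distribʳ-*)
            open import Algebra.Properties.AbelianGroup +-abelianGroup using (⁻¹-∙-comm)
            open import Algebra.Properties.Group +-group using (⁻¹-involutive)
            import Algebra.Solver.CommutativeMonoid +-commutativeMonoid as M

    ⟦⟧-cong : ∀ a b c d → a ℕ.+ d ≡ c ℕ.+ b → ⟦ a , b ⟧ᶜ ≈ ⟦ c , d ⟧ᶜ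
    ⟦⟧-cong a b c d eq = begin
      a · 1# - b · 1#                                 ≈⟨ +-congʳ (+-identityʳ _) ⟨
      a · 1# + 0# - b · 1#                            ≈⟨ +-congʳ (+-congˡ (-‿inverseʳ (d · 1#))) ⟨
      a · 1# + (d · 1# - d · 1#) - b · 1#             ≈⟨ S.solve 3 (λ a b d → (a S.:+ (d S.:- d)) S.:- b S.:= (a S.:+ d) S.:- (d S.:+ b)) refl _ _ _ ⟩
      (a · 1# + d · 1#) - (d · 1# + b · 1#)           ≈⟨ +-congʳ (trans (sym (×-homo-+ 1# a d)) (trans (×-congˡ eq) (×-homo-+ 1# c b))) ⟩
      (c · 1# + b · 1#) - (d · 1# + b · 1#)           ≈⟨ S.solve 3 (λ c b d → (c S.:+ b) S.:- (d S.:+ b) S.:= c S.:+ (b S.:- b) S.:- d) refl _ _ _ ⟩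
      c · 1# + (b · 1# - b · 1#) - d · 1#             ≈⟨ +-congʳ (+-congˡ (-‿inverseʳ (b · 1#))) ⟩
      c · 1# + 0# - d · 1#                            ≈⟨ +-congʳ (+-identityʳ _) ⟩
      c · 1# - d · 1#                                 ∎

    ∸-balanced : ∀ a b → (a ℕ.∸ b) ℕ.+ b ≡ a ℕ.+ (b ℕ.∸ a)
    ∸-balanced zero    zero    = ≡.refl
    ∸-balanced zero    (suc b) = ≡.refl
    ∸-balanced (suc a) zero    = ≡.refl
    ∸-balanced (suc a) (suc b) = ≡.trans (ℕ.+-suc (a ℕ.∸ b) b) (≡.cong suc (∸-balanced a b))

    ⟦reduce⟧ : ∀ a b → ⟦ reduce (a , b) ⟧ᶜ ≈ ⟦ a , b ⟧ᶜ
    ⟦reduce⟧ a b = ⟦⟧-cong (a ℕ.∸ b) (b ℕ.∸ a) a b (∸-balanced a b)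

    -- Agrees with ⟦_⟧ᶜ, but is 0# and 1# on the nose at the constants.
    ⟦_⟧ : ℕ × ℕ → Carrier
    ⟦ 0 , 0 ⟧ = 0#
    ⟦ 1 , 0 ⟧ = 1#
    ⟦ a , b ⟧ = ⟦ a , b ⟧ᶜ

    ⟦⟧≈⟦⟧ᶜ : ∀ x → ⟦ x ⟧ ≈ ⟦ x ⟧ᶜ
    ⟦⟧≈⟦⟧ᶜ (0           , 0)     = sym (-‿inverseʳ 0#)
    ⟦⟧≈⟦⟧ᶜ (1           , 0)     = sym (trans (+-congʳ (+-identityʳ 1#)) (trans (+-congˡ ε⁻¹≈ε) (+-identityʳ 1#)))
      where open import Algebra.Properties.Group +-group using (ε⁻¹≈ε)
    ⟦⟧≈⟦⟧ᶜ (0           , suc _) = refl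
    ⟦⟧≈⟦⟧ᶜ (1           , suc _) = refl
    ⟦⟧≈⟦⟧ᶜ (suc (suc _) , _)     = refl

    dec : (x y : ℕ × ℕ) → Maybe (⟦ x ⟧ ≈ ⟦ y ⟧)
    dec (a , b) (c , d) with a ℕ.+ d ℕ.≟ c ℕ.+ b
    ... | no  _  = nothing
    ... | yes eq = just (trans (⟦⟧≈⟦⟧ᶜ (a , b)) (trans (⟦⟧-cong a b c d eq) (sym (⟦⟧≈⟦⟧ᶜ (c , d)))))

    morphism : Coeff -Raw-AlmostCommutative⟶ fromCommutativeRing R
    morphism = record
      { ⟦_⟧ = ⟦_⟧
      ; +-homo = λ { x@(a , b) y@(c , d) → begin
          ⟦ reduce (a ℕ.+ c , b ℕ.+ d) ⟧    ≈⟨ ⟦⟧≈⟦⟧ᶜ (reduce (a ℕ.+ c , b ℕ.+ d)) ⟩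
          ⟦ reduce (a ℕ.+ c , b ℕ.+ d) ⟧ᶜ   ≈⟨ ⟦reduce⟧ (a ℕ.+ c) (b ℕ.+ d) ⟩
          ⟦ a ℕ.+ c , b ℕ.+ d ⟧ᶜ            ≈⟨ +-cong (×-homo-+ 1# a c) (-‿cong (×-homo-+ 1# b d)) ⟩
          (a · 1# + c · 1#) - (b · 1# + d · 1#)
            ≈⟨ S.solve 4 (λ a b c d → (a S.:+ c) S.:- (b S.:+ d) S.:= (a S.:- b) S.:+ (c S.:- d)) refl _ _ _ _ ⟩
          ⟦ x ⟧ᶜ + ⟦ y ⟧ᶜ                   ≈⟨ +-cong (⟦⟧≈⟦⟧ᶜ x) (⟦⟧≈⟦⟧ᶜ y) ⟨
          ⟦ x ⟧ + ⟦ y ⟧                     ∎ }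
      ; *-homo = λ { x@(a , b) y@(c , d) → begin
          ⟦ reduce (a ℕ.* c ℕ.+ b ℕ.* d , a ℕ.* d ℕ.+ b ℕ.* c) ⟧    ≈⟨ ⟦⟧≈⟦⟧ᶜ (reduce (a ℕ.* c ℕ.+ b ℕ.* d , a ℕ.* d ℕ.+ b ℕ.* c)) ⟩
          ⟦ reduce (a ℕ.* c ℕ.+ b ℕ.* d , a ℕ.* d ℕ.+ b ℕ.* c) ⟧ᶜ   ≈⟨ ⟦reduce⟧ (a ℕ.* c ℕ.+ b ℕ.* d) (a ℕ.* d ℕ.+ b ℕ.* c) ⟩
          ⟦ a ℕ.* c ℕ.+ b ℕ.* d , a ℕ.* d ℕ.+ b ℕ.* c ⟧ᶜ
            ≈⟨ +-cong (trans (×-homo-+ 1# (a ℕ.* c) (b ℕ.* d)) (+-cong (×1-homo-* a c) (×1-homo-* b d)))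
                      (-‿cong (trans (×-homo-+ 1# (a ℕ.* d) (b ℕ.* c)) (+-cong (×1-homo-* a d) (×1-homo-* b c)))) ⟩
          _                                 ≈⟨ *-expand _ _ _ _ ⟨
          ⟦ x ⟧ᶜ * ⟦ y ⟧ᶜ                   ≈⟨ *-cong (⟦⟧≈⟦⟧ᶜ x) (⟦⟧≈⟦⟧ᶜ y) ⟨
          ⟦ x ⟧ * ⟦ y ⟧                     ∎ }
      ; -‿homo = λ { x@(a , b) → begin
          ⟦ b , a ⟧           ≈⟨ ⟦⟧≈⟦⟧ᶜ (b , a) ⟩
          ⟦ b , a ⟧ᶜ          ≈⟨ ⁻¹-anti-homo-// _ _ ⟨
          - ⟦ x ⟧ᶜ            ≈⟨ -‿cong (⟦⟧≈⟦⟧ᶜ x) ⟨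
          - ⟦ x ⟧             ∎ }
      ; 0-homo = refl
      ; 1-homo = refl
      }
      where open import Algebra.Properties.Group +-group using (⁻¹-anti-homo-//)

  open RingSolver Coeff (fromCommutativeRing R) morphism dec public
    using (solve; _:+_; _:*_; _:-_; :-_; _:=_; con; Polynomial)

  #1 : ∀ {n} → Polynomial n
  #1 = con (1 , 0)

-- Derivations, logarithmic derivatives and the tree equation

module Derivations (R : CommutativeRing 0ℓ 0ℓ) where
  open CommutativeRing R
  open IntegerSolver R
  open import Relation.Binary.Reasoning.Setoid setoid

  record IsDerivation (D : Carrier → Carrier) : Set where
    field
      cong    : ∀ {x y} → x ≈ y → D x ≈ D y
      +-homo  : ∀ x y → D (x + y) ≈ D x + D y
      leibniz : ∀ x y → D (x * y) ≈ D x * y + x * D y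

    0#-homo : D 0# ≈ 0#
    0#-homo = begin
      D 0#                  ≈⟨ solve 1 (λ x → x := (x :+ x) :- x) refl _ ⟩
      D 0# + D 0# - D 0#    ≈⟨ +-congʳ (+-homo 0# 0#) ⟨
      D (0# + 0#) - D 0#    ≈⟨ +-congʳ (cong (+-identityʳ 0#)) ⟩
      D 0# - D 0#           ≈⟨ -‿inverseʳ _ ⟩
      0#                    ∎

    1#-homo : D 1# ≈ 0#
    1#-homo = begin
      D 1#                                ≈⟨ solve 1 (λ x → x := (x :* #1 :+ #1 :* x) :- x) refl _ ⟩
      (D 1# * 1# + 1# * D 1#) - D 1#      ≈⟨ +-congʳ (leibniz 1# 1#) ⟨
      D (1# * 1#) - D 1#                  ≈⟨ +-congʳ (cong (*-identityʳ 1#)) ⟩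
      D 1# - D 1#                         ≈⟨ -‿inverseʳ _ ⟩
      0#                                  ∎

    -‿homo : ∀ x → D (- x) ≈ - D x
    -‿homo x = begin
      D (- x)                  ≈⟨ solve 2 (λ a b → a := (a :+ b) :- b) refl _ _ ⟩
      D (- x) + D x - D x      ≈⟨ +-congʳ (+-homo (- x) x) ⟨
      D (- x + x) - D x        ≈⟨ +-congʳ (trans (cong (-‿inverseˡ x)) 0#-homo) ⟩
      0# - D x                 ≈⟨ +-identityˡ _ ⟩
      - D x                    ∎

    x-y-homo : ∀ x y → D (x - y) ≈ D x - D y
    x-y-homo x y = trans (+-homo x (- y)) (+-congˡ (-‿homo y))

  scale-isDerivation : ∀ a {D} → IsDerivation D → IsDerivation (λ x → a * D x)
  scale-isDerivation a dD = record
    { cong = λ eq → *-congˡ (D.cong eq)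
    ; +-homo = λ x y → trans (*-congˡ (D.+-homo x y)) (distribˡ a _ _)
    ; leibniz = λ x y → trans (*-congˡ (D.leibniz x y))
        (solve 5 (λ a x y x′ y′ → a :* (x′ :* y :+ x :* y′) := a :* x′ :* y :+ x :* (a :* y′)) refl a x y _ _)
    }
    where module D = IsDerivation dD

  -- Cancellation by `g` replaces division: only a factor `G` on both sides ever has to be removed.
  Regular : Carrier → Set
  Regular g = ∀ {z} → g * z ≈ 0# → z ≈ 0#

  -- Expand X (P g) = P (X g) and cancel g.
  log-derivation : ∀ {X P} → IsDerivation X → IsDerivation P → (∀ x → X (P x) ≈ P (X x)) →
    ∀ {g c z} → Regular g → X g ≈ g * X c → P g ≈ g * z → X (P c) ≈ X z
  log-derivation {X} {P} dX dP comm {g} {c} {z} reg Xg Pg = begin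
    X (P c)                    ≈⟨ comm c ⟩
    P (X c)                    ≈⟨ solve 2 (λ a b → a := (a :- b) :+ b) refl _ _ ⟩
    (P (X c) - X z) + X z      ≈⟨ +-congʳ (reg key) ⟩
    0# + X z                   ≈⟨ +-identityˡ _ ⟩
    X z                        ∎
    where
    module X = IsDerivation dX
    module P = IsDerivation dP
    lhs : X (P g) ≈ g * X c * z + g * X z
    lhs = trans (X.cong Pg) (trans (X.leibniz g z) (+-congʳ (*-congʳ Xg)))
    rhs : P (X g) ≈ g * z * X c + g * P (X c)
    rhs = trans (P.cong Xg) (trans (P.leibniz g (X c)) (+-congʳ (*-congʳ Pg)))
    key : g * (P (X c) - X z) ≈ 0#
    key = begin
      g * (P (X c) - X z)
        ≈⟨ solve 5 (λ g d z p x → g :* (p :- x) := (g :* z :* d :+ g :* p) :- (g :* d :* z :+ g :* x)) refl _ _ _ _ _ ⟩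
      (g * z * X c + g * P (X c)) - (g * X c * z + g * X z)  ≈⟨ +-cong rhs (-‿cong lhs) ⟨
      P (X g) - X (P g)                                      ≈⟨ +-congʳ (comm g) ⟨
      X (P g) - X (P g)                                      ≈⟨ -‿inverseʳ _ ⟩
      0#                                                     ∎

  module TreeEquation {X Y : Carrier → Carrier} (dX : IsDerivation X) (dY : IsDerivation Y)
    (comm : ∀ x → X (Y x) ≈ Y (X x)) (T : Carrier)
    (tree : X T + Y T ≈ T + X T * Y T) where
    private
      module X = IsDerivation dX
      module Y = IsDerivation dY
      p = X T
      q = Y T
      a = X p
      b = X q
      c = Y q

      Yp : Y p ≈ b
      Yp = sym (comm T)

    W : Carrier
    W = p * q

    u v : Carrier
    u = 1# - q
    v = 1# - p

    -- The linearisation of the tree equation: a derivation that commutes with `X` and `Y`, applied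
    -- to `tree`, says that `L` fixes the derivative of `T`. The same combination collects the terms
    -- of the unicyclic equation.
    L : Carrier → Carrier
    L x = u * X x + v * Y x

    Xtree : a + b ≈ p + (a * q + p * b)
    Xtree = begin
      X p + X q        ≈⟨ X.+-homo p q ⟨
      X (p + q)        ≈⟨ X.cong tree ⟩
      X (T + p * q)    ≈⟨ X.+-homo T _ ⟩
      p + X (p * q)    ≈⟨ +-congˡ (X.leibniz p q) ⟩
      p + (a * q + p * b) ∎

    Ytree : b + c ≈ q + (b * q + p * c)
    Ytree = begin
      b + Y q          ≈⟨ +-congʳ Yp ⟨
      Y p + Y q        ≈⟨ Y.+-homo p q ⟨
      Y (p + q)        ≈⟨ Y.cong tree ⟩
      Y (T + p * q)    ≈⟨ Y.+-homo T _ ⟩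
      q + Y (p * q)    ≈⟨ +-congˡ (trans (Y.leibniz p q) (+-congʳ (*-congʳ Yp))) ⟩
      q + (b * q + p * c) ∎

    -- This is L p = p with `Y p` already written as `b`; it is `Xtree` with the products moved to
    -- the left.
    Lp : u * a + v * b ≈ p
    Lp = begin
      u * a + v * b            ≈⟨ solve 4 (λ p q a b → (#1 :- q) :* a :+ (#1 :- p) :* b := (a :+ b) :- (a :* q :+ p :* b)) refl p q a b ⟩
      (a + b) - (a * q + p * b)  ≈⟨ +-congʳ Xtree ⟩
      p + (a * q + p * b) - (a * q + p * b) ≈⟨ solve 2 (λ p t → (p :+ t) :- t := p) refl _ _ ⟩
      p                        ∎

    Lq : u * b + v * c ≈ q
    Lq = begin
      u * b + v * c            ≈⟨ solve 4 (λ p q b c → (#1 :- q) :* b :+ (#1 :- p) :* c := (b :+ c) :- (b :* q :+ p :* c)) refl p q b c ⟩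
      (b + c) - (b * q + p * c)  ≈⟨ +-congʳ Ytree ⟩
      q + (b * q + p * c) - (b * q + p * c) ≈⟨ solve 2 (λ p t → (p :+ t) :- t := p) refl _ _ ⟩
      q                        ∎

    L-leibniz : ∀ x y → L (x * y) ≈ L x * y + x * L y
    L-leibniz x y = trans (+-cong (*-congˡ (X.leibniz x y)) (*-congˡ (Y.leibniz x y)))
      (solve 8 (λ u v x y x₁ y₁ x₂ y₂ → u :* (x₁ :* y :+ x :* y₁) :+ v :* (x₂ :* y :+ x :* y₂)
          := (u :* x₁ :+ v :* x₂) :* y :+ x :* (u :* y₁ :+ v :* y₂)) refl u v x y _ _ _ _)

    L-isDerivation : IsDerivation L
    L-isDerivation = record
      { cong = λ e → +-cong (*-congˡ (X.cong e)) (*-congˡ (Y.cong e))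
      ; +-homo = λ x y → trans (+-cong (*-congˡ (X.+-homo x y)) (*-congˡ (Y.+-homo x y)))
          (solve 6 (λ u v x x′ y y′ → u :* (x :+ x′) :+ v :* (y :+ y′) := (u :* x :+ v :* y) :+ (u :* x′ :+ v :* y′)) refl u v _ _ _ _)
      ; leibniz = L-leibniz
      }

    LW : L W ≈ W + W
    LW = trans (L-leibniz p q) (trans (+-cong (*-congʳ (trans (+-congˡ (*-congˡ Yp)) Lp)) (*-congˡ Lq)) refl)

    -- Applying `Y` to `Xtree` produces third derivatives of `T` linearly, and they add up to `L b`.
    -- What remains are products of second derivatives.
    Lb : L b ≈ b + (a * c + b * b)
    Lb = begin
      u * X b + v * Y b      ≈⟨ solve 4 (λ p q b₁ b₂ → (#1 :- q) :* b₁ :+ (#1 :- p) :* b₂ := (b₁ :+ b₂) :- (b₁ :* q :+ p :* b₂)) refl p q (X b) (Y b) ⟩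
      (X b + Y b) - (X b * q + p * Y b)                             ≈⟨ +-congʳ (+-congʳ Ya) ⟨
      (Y a + Y b) - (X b * q + p * Y b)                             ≈⟨ +-congʳ (Y.+-homo a b) ⟨
      Y (a + b) - (X b * q + p * Y b)                               ≈⟨ +-congʳ (trans (Y.cong Xtree) (Y.+-homo p _)) ⟩
      Y p + Y (a * q + p * b) - (X b * q + p * Y b)                 ≈⟨ +-congʳ (+-cong Yp (trans (Y.+-homo _ _) (+-cong (Y.leibniz a q) (Y.leibniz p b)))) ⟩
      b + ((Y a * q + a * c) + (Y p * b + p * Y b)) - (X b * q + p * Y b) ≈⟨ +-congʳ (+-congˡ (+-cong (+-congʳ (*-congʳ Ya)) (+-congʳ (*-congʳ Yp)))) ⟩
      b + ((X b * q + a * c) + (b * b + p * Y b)) - (X b * q + p * Y b)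
        ≈⟨ solve 5 (λ b s t z w → (b :+ ((s :+ t) :+ (z :+ w))) :- (s :+ w) := b :+ (t :+ z)) refl b _ _ _ _ ⟩
      b + (a * c + b * b)                                           ∎
      where
      Ya : Y a ≈ X b
      Ya = trans (sym (comm p)) (X.cong Yp)

    -- Its vanishing is T_xy = W / (1 - W) with the denominator cleared.
    δ : Carrier
    δ = b - (W + W * b)

    -- The cofactor of `δ` in the factorisation of (u v) L δ. Later only its constant term counts:
    -- for series it is 2 - 1 = 1.
    κ : Carrier
    κ = (u * v) * (1# + 1#) * (1# + b) - 1# + W

    -- The relations `Lp` and `Lq` express `u * a` and `v * c` by `p`, `q` and `b`; multiplying by
    -- `u * v` thus eliminates `a` and `c` without dividing.
    uvac : (u * v) * (a * c) ≈ (p - v * b) * (q - u * b)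
    uvac = begin
      (u * v) * (a * c)    ≈⟨ solve 5 (λ u v a b c → (u :* v) :* (a :* c) := ((u :* a :+ v :* b) :- v :* b) :* ((u :* b :+ v :* c) :- u :* b)) refl u v a b c ⟩
      ((u * a + v * b) - v * b) * ((u * b + v * c) - u * b)    ≈⟨ *-cong (+-congʳ Lp) (+-congʳ Lq) ⟩
      (p - v * b) * (q - u * b) ∎

    -- b satisfies a Riccati equation along L, and so does W / (1 - W); hence the factor δ.
    Lδ : (u * v) * L δ ≈ κ * δ
    Lδ = begin
      (u * v) * L (b - (W + W * b))     ≈⟨ *-congˡ (trans (L.x-y-homo b _) (+-congˡ (-‿cong (trans (L.+-homo _ _) (+-cong LW (trans (L-leibniz W b) (+-cong (*-congʳ LW) (*-congˡ Lb)))))))) ⟩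
      (u * v) * ((L b) - ((W + W) + ((W + W) * b + W * (b + (a * c + b * b)))))  ≈⟨ *-congˡ (+-congʳ Lb) ⟩
      (u * v) * ((b + (a * c + b * b)) - ((W + W) + ((W + W) * b + W * (b + (a * c + b * b)))))
        ≈⟨ solve 4 (λ t W b z → t :* ((b :+ (z :+ b :* b)) :- ((W :+ W) :+ ((W :+ W) :* b :+ W :* (b :+ (z :+ b :* b)))))
             := (t :* z :+ t :* (b :+ b :* b)) :* (#1 :- W) :- t :* (#1 :+ b) :* (W :+ W)) refl (u * v) W b (a * c) ⟩
      ((u * v) * (a * c) + (u * v) * (b + b * b)) * (1# - W) - (u * v) * (1# + b) * (W + W)  ≈⟨ +-congʳ (*-congʳ (+-congʳ uvac)) ⟩
      ((p - v * b) * (q - u * b) + (u * v) * (b + b * b)) * (1# - W) - (u * v) * (1# + b) * (W + W)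
        ≈⟨ solve 3 (λ p q b → let u = #1 :- q; v = #1 :- p; W = p :* q in
             ((p :- v :* b) :* (q :- u :* b) :+ (u :* v) :* (b :+ b :* b)) :* (#1 :- W) :- (u :* v) :* (#1 :+ b) :* (W :+ W)
             := ((u :* v) :* (#1 :+ #1) :* (#1 :+ b) :- #1 :+ W) :* (b :- (W :+ W :* b))) refl p q b ⟩
      κ * δ ∎
      where module L = IsDerivation L-isDerivation

-- Finite sums over lists and subsets

module Sums (R : CommutativeRing 0ℓ 0ℓ) where
  open CommutativeRing R
  open import Algebra.Properties.CommutativeSemigroup +-commutativeSemigroup using (interchange)

  private variable
    A B : Set

  Σ[_] : List A → (A → Carrier) → Carrier
  Σ[ [] ]     f = 0#
  Σ[ x ∷ xs ] f = f x + Σ[ xs ] f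

  Σ-cong : ∀ (xs : List A) {f g} → (∀ x → f x ≈ g x) → Σ[ xs ] f ≈ Σ[ xs ] g
  Σ-cong []       eq = refl
  Σ-cong (x ∷ xs) eq = +-cong (eq x) (Σ-cong xs eq)

  Σ-zero : ∀ (xs : List A) → Σ[ xs ] (λ _ → 0#) ≈ 0#
  Σ-zero []       = refl
  Σ-zero (x ∷ xs) = trans (+-identityˡ _) (Σ-zero xs)

  Σ-+ : ∀ (xs : List A) f g → Σ[ xs ] (λ x → f x + g x) ≈ Σ[ xs ] f + Σ[ xs ] g
  Σ-+ []       f g = sym (+-identityˡ 0#)
  Σ-+ (x ∷ xs) f g = trans (+-congˡ (Σ-+ xs f g)) (interchange _ _ _ _)

  Σ-swap : ∀ (xs : List A) (ys : List B) (f : A → B → Carrier) →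
    Σ[ xs ] (λ x → Σ[ ys ] (f x)) ≈ Σ[ ys ] (λ y → Σ[ xs ] (λ x → f x y))
  Σ-swap []       ys f = sym (Σ-zero ys)
  Σ-swap (x ∷ xs) ys f = trans (+-congˡ (Σ-swap xs ys f)) (sym (Σ-+ ys _ _))

  *-distribˡ-Σ : ∀ a (xs : List A) f → a * Σ[ xs ] f ≈ Σ[ xs ] (λ x → a * f x)
  *-distribˡ-Σ a []       f = zeroʳ a
  *-distribˡ-Σ a (x ∷ xs) f = trans (distribˡ a _ _) (+-congˡ (*-distribˡ-Σ a xs f))

  *-distribʳ-Σ : ∀ a (xs : List A) f → Σ[ xs ] f * a ≈ Σ[ xs ] (λ x → f x * a)
  *-distribʳ-Σ a []       f = zeroˡ a
  *-distribʳ-Σ a (x ∷ xs) f = trans (distribʳ a _ _) (+-congˡ (*-distribʳ-Σ a xs f))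

  Σ-++ : ∀ (xs ys : List A) f → Σ[ xs ++ ys ] f ≈ Σ[ xs ] f + Σ[ ys ] f
  Σ-++ []       ys f = sym (+-identityˡ _)
  Σ-++ (x ∷ xs) ys f = trans (+-congˡ (Σ-++ xs ys f)) (sym (+-assoc _ _ _))

  Σ-map : ∀ (h : B → A) xs f → Σ[ List.map h xs ] f ≈ Σ[ xs ] (f ∘ h)
  Σ-map h []       f = refl
  Σ-map h (x ∷ xs) f = +-congˡ (Σ-map h xs f)

  Σ-allVecs : ∀ (xs : List A) n (f : Vec A (suc n) → Carrier) →
    Σ[ allVecs xs (suc n) ] f ≈ Σ[ xs ] (λ x → Σ[ allVecs xs n ] (λ v → f (x ∷ v)))
  Σ-allVecs {A = A} xs n f = go xs
    where
    go : ∀ (ys : List A) → Σ[ cartesianProductWith _∷_ ys (allVecs xs n) ] f ≈ Σ[ ys ] (λ x → Σ[ allVecs xs n ] (λ v → f (x ∷ v)))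
    go []       = refl
    go (y ∷ ys) = trans (Σ-++ (List.map (y ∷_) (allVecs xs n)) _ f) (+-cong (Σ-map (y ∷_) (allVecs xs n) f) (go ys))

  subsets : ∀ n → List (Subset n)
  subsets = allVecs (true ∷ false ∷ [])

  Σ-subsets : ∀ n (f : Subset (suc n) → Carrier) →
    Σ[ subsets (suc n) ] f ≈ Σ[ subsets n ] (f ∘ (true ∷_)) + Σ[ subsets n ] (f ∘ (false ∷_))
  Σ-subsets n f = trans (Σ-allVecs (true ∷ false ∷ []) n f) (+-congˡ (+-identityʳ _))

-- Formal power series over a commutative ring

module PowerSeries (R : CommutativeRing 0ℓ 0ℓ) where
  private module R = CommutativeRing R
  open R
  open import Algebra.Properties.Semiring.Mult semiring renaming (_×_ to _·_)
  open import Algebra.Properties.CommutativeMonoid.Mult +-commutativeMonoid using (×-distrib-+)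
  open import Relation.Binary.Reasoning.Setoid setoid
  open IntegerSolver R using (solve; _:+_; _:*_; _:=_)

  Series : Set
  Series = ℕ → Carrier

  infixl 7 _⊗_
  -- The Cauchy product by recursion along the left factor, so that ring laws follow by induction on
  -- the index. Since the coefficient ring is arbitrary, iterating the construction gives several
  -- variables; `⊗-sum` connects it with the finite sums of the statement.
  _⊗_ : Series → Series → Series
  (f ⊗ g) zero    = f 0 * g 0
  (f ⊗ g) (suc n) = f 0 * g (suc n) + ((f ∘ suc) ⊗ g) n

  const : Carrier → Series
  const a zero    = a
  const a (suc _) = 0#

  private
    infix 4 _≋_
    _≋_ : Series → Series → Set
    f ≋ g = ∀ n → f n ≈ g n

    ⊗-cong : ∀ {f f′ g g′} → f ≋ f′ → g ≋ g′ → f ⊗ g ≋ f′ ⊗ g′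
    ⊗-cong p q zero    = *-cong (p 0) (q 0)
    ⊗-cong p q (suc n) = +-cong (*-cong (p 0) (q (suc n))) (⊗-cong (p ∘ suc) q n)

    ⊗-zeroˡ : ∀ g → (λ _ → 0#) ⊗ g ≋ λ _ → 0#
    ⊗-zeroˡ g zero    = zeroˡ _
    ⊗-zeroˡ g (suc n) = trans (+-cong (zeroˡ _) (⊗-zeroˡ g n)) (+-identityˡ 0#)

    ⊗-distribʳ : ∀ h f g → (λ n → f n + g n) ⊗ h ≋ λ n → (f ⊗ h) n + (g ⊗ h) n
    ⊗-distribʳ h f g zero    = distribʳ _ _ _
    ⊗-distribʳ h f g (suc n) = trans (+-cong (distribʳ _ _ _) (⊗-distribʳ h (f ∘ suc) (g ∘ suc) n))
      (solve 4 (λ a b c d → (a :+ b) :+ (c :+ d) := (a :+ c) :+ (b :+ d)) refl _ _ _ _)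

    ⊗-scaleˡ : ∀ a f g → (λ n → a * f n) ⊗ g ≋ λ n → a * (f ⊗ g) n
    ⊗-scaleˡ a f g zero    = *-assoc _ _ _
    ⊗-scaleˡ a f g (suc n) = trans (+-cong (*-assoc _ _ _) (⊗-scaleˡ a (f ∘ suc) g n)) (sym (distribˡ _ _ _))

    ⊗-assoc : ∀ f g h → (f ⊗ g) ⊗ h ≋ f ⊗ (g ⊗ h)
    ⊗-assoc f g h zero    = *-assoc _ _ _
    ⊗-assoc f g h (suc n) = begin
      f 0 * g 0 * h (suc n) + ((λ k → f 0 * g (suc k) + ((f ∘ suc) ⊗ g) k) ⊗ h) n
        ≈⟨ +-congˡ (trans (⊗-distribʳ h _ _ n) (+-cong (⊗-scaleˡ (f 0) (g ∘ suc) h n) (⊗-assoc (f ∘ suc) g h n))) ⟩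
      f 0 * g 0 * h (suc n) + (f 0 * ((g ∘ suc) ⊗ h) n + ((f ∘ suc) ⊗ (g ⊗ h)) n)
        ≈⟨ solve 5 (λ a b c d e → a :* b :* c :+ (a :* d :+ e) := a :* (b :* c :+ d) :+ e) refl _ _ _ _ _ ⟩
      f 0 * (g 0 * h (suc n) + ((g ∘ suc) ⊗ h) n) + ((f ∘ suc) ⊗ (g ⊗ h)) n ∎

  ⊗-sucʳ : ∀ f g n → (f ⊗ g) (suc n) ≈ f (suc n) * g 0 + (f ⊗ (g ∘ suc)) n
  ⊗-sucʳ f g zero    = +-comm _ _
  ⊗-sucʳ f g (suc n) = trans (+-congˡ (⊗-sucʳ (f ∘ suc) g n))
    (solve 3 (λ a b c → a :+ (b :+ c) := b :+ (a :+ c)) refl _ _ _)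

  private
    ⊗-comm : ∀ f g → f ⊗ g ≋ g ⊗ f
    ⊗-comm f g zero    = *-comm _ _
    ⊗-comm f g (suc n) = trans (+-cong (*-comm _ _) (⊗-comm (f ∘ suc) g n)) (sym (⊗-sucʳ g f n))

  const-⊗ : ∀ a f n → (const a ⊗ f) n ≈ a * f n
  const-⊗ a f zero    = refl
  const-⊗ a f (suc n) = trans (+-congˡ (⊗-zeroˡ f n)) (+-identityʳ _)

  seriesRing : CommutativeRing 0ℓ 0ℓ
  seriesRing = record
    { Carrier = Series
    ; _≈_ = _≋_
    ; _+_ = λ f g n → f n + g n
    ; _*_ = _⊗_
    ; -_ = λ f n → - f n
    ; 0# = λ _ → 0#
    ; 1# = const 1#
    ; isCommutativeRing = record
      { isRing = record
        { +-isAbelianGroup = record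
          { isGroup = record
            { isMonoid = record
              { isSemigroup = record
                { isMagma = record
                  { isEquivalence = record
                    { refl = λ _ → refl ; sym = λ p n → sym (p n) ; trans = λ p q n → trans (p n) (q n) }
                  ; ∙-cong = λ p q n → +-cong (p n) (q n) }
                ; assoc = λ f g h n → +-assoc _ _ _ }
              ; identity = (λ f n → +-identityˡ _) , (λ f n → +-identityʳ _) }
            ; inverse = (λ f n → -‿inverseˡ _) , (λ f n → -‿inverseʳ _)
            ; ⁻¹-cong = λ p n → -‿cong (p n) }
          ; comm = λ f g n → +-comm _ _ }
        ; *-cong = ⊗-cong
        ; *-assoc = ⊗-assoc
        ; *-identity = ⊗-identityˡ , λ f n → trans (⊗-comm f (const 1#) n) (⊗-identityˡ f n)
        ; distrib = (λ f g h n → trans (⊗-comm f _ n) (trans (⊗-distribʳ f g h n) (+-cong (⊗-comm g f n) (⊗-comm h f n))))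
                  , ⊗-distribʳ
        }
      ; *-comm = ⊗-comm
      }
    }
    where
    ⊗-identityˡ : ∀ f → const 1# ⊗ f ≋ f
    ⊗-identityˡ f n = trans (const-⊗ 1# f n) (*-identityˡ _)

  private module P = CommutativeRing seriesRing
  open import Algebra.Properties.Semiring.Mult P.semiring using () renaming (_×_ to _·ₚ_)

  ×-coefficient : ∀ k (f : Series) n → (k ·ₚ f) n ≡ k · f n
  ×-coefficient zero    f n = ≡.refl
  ×-coefficient (suc k) f n = ≡.cong (f n +_) (×-coefficient k f n)

  -- Meant for `Z` saying that some coefficient is zero: a coefficient of a product vanishes once
  -- all contributing products do.
  ⊗-closed : (Z : Carrier → Set) → (∀ {x y} → Z x → Z y → Z (x + y)) →
    ∀ f g n → (∀ a b → a ℕ.+ b ≡ n → Z (f a * g b)) → Z ((f ⊗ g) n)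
  ⊗-closed Z +-closed f g zero    z = z 0 0 ≡.refl
  ⊗-closed Z +-closed f g (suc n) z =
    +-closed (z 0 (suc n) ≡.refl) (⊗-closed Z +-closed (f ∘ suc) g n λ a b eq → z (suc a) b (≡.cong suc eq))

  shift : Series → Series
  shift f zero    = 0#
  shift f (suc n) = f n

  shift-⊗ : ∀ f g → shift f ⊗ g P.≈ shift (f ⊗ g)
  shift-⊗ f g zero    = zeroˡ _
  shift-⊗ f g (suc n) = trans (+-congʳ (zeroˡ _)) (+-identityˡ _)

  shift-cong : ∀ {f g} → f P.≈ g → shift f P.≈ shift g
  shift-cong eq zero    = refl
  shift-cong eq (suc n) = eq n

  open Derivations R using (IsDerivation; Regular)
  open Derivations seriesRing using () renaming (IsDerivation to IsDerivationₚ; Regular to Regularₚ)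

  euler : Series → Series
  euler f n = n · f n

  euler-isDerivation : IsDerivationₚ euler
  euler-isDerivation = record
    { cong = λ p n → ×-congʳ n (p n)
    ; +-homo = λ f g n → ×-distrib-+ _ _ n
    ; leibniz = leibniz
    }
    where
    leibniz : ∀ f g n → euler (f ⊗ g) n ≈ (euler f ⊗ g) n + (f ⊗ euler g) n
    leibniz f g zero    = sym (trans (+-cong (zeroˡ _) (zeroʳ _)) (+-identityˡ 0#))
    leibniz f g (suc n) = begin
      suc n · (f 0 * g (suc n) + ((f ∘ suc) ⊗ g) n)                 ≈⟨ ×-distrib-+ _ _ (suc n) ⟩
      suc n · (f 0 * g (suc n)) + suc n · ((f ∘ suc) ⊗ g) n
        ≈⟨ +-cong (sym (×-comm-* (suc n) _ _)) (+-congˡ (leibniz (f ∘ suc) g n)) ⟩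
      f 0 * (suc n · g (suc n)) + (((f ∘ suc) ⊗ g) n + ((euler (f ∘ suc) ⊗ g) n + ((f ∘ suc) ⊗ euler g) n))
        ≈⟨ solve 4 (λ a b c d → a :+ (b :+ (c :+ d)) := (b :+ c) :+ (a :+ d)) refl _ _ _ _ ⟩
      (((f ∘ suc) ⊗ g) n + (euler (f ∘ suc) ⊗ g) n) + (f 0 * (suc n · g (suc n)) + ((f ∘ suc) ⊗ euler g) n)
        ≈⟨ +-congʳ (⊗-distribʳ g (f ∘ suc) (euler (f ∘ suc)) n) ⟨
      ((euler f ∘ suc) ⊗ g) n + (f ⊗ euler g) (suc n)
        ≈⟨ +-congʳ (trans (+-congʳ (zeroˡ _)) (+-identityˡ _)) ⟨
      (euler f ⊗ g) (suc n) + (f ⊗ euler g) (suc n) ∎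

  lift : (Carrier → Carrier) → Series → Series
  lift d f n = d (f n)

  module _ {d} (dd : IsDerivation d) where
    open IsDerivation dd renaming (cong to d-cong)

    lift-isDerivation : IsDerivationₚ (lift d)
    lift-isDerivation = record
      { cong = λ p n → d-cong (p n)
      ; +-homo = λ f g n → +-homo _ _
      ; leibniz = lift-leibniz
      }
      where
      lift-leibniz : ∀ f g n → d ((f ⊗ g) n) ≈ (lift d f ⊗ g) n + (f ⊗ lift d g) n
      lift-leibniz f g zero    = leibniz _ _
      lift-leibniz f g (suc n) = trans (+-homo _ _) (trans (+-cong (leibniz _ _) (lift-leibniz (f ∘ suc) g n))
        (solve 4 (λ a b c d → (a :+ b) :+ (c :+ d) := (a :+ c) :+ (b :+ d)) refl _ _ _ _))

    ×-homo : ∀ n x → d (n · x) ≈ n · d x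
    ×-homo zero    x = 0#-homo
    ×-homo (suc n) x = trans (+-homo _ _) (+-congˡ (×-homo n x))

    euler-lift : ∀ f → euler (lift d f) P.≈ lift d (euler f)
    euler-lift f n = sym (×-homo n (f n))

  -- The constant coefficient of `z` vanishes by cancelling `g 0`; the tail of `z` then satisfies
  -- the same equation.
  regular : ∀ {g} → Regular (g 0) → Regularₚ g
  regular {g} reg {z} = go z
    where
    go : ∀ z → g ⊗ z P.≈ P.0# → z P.≈ P.0#
    go z eq zero    = reg (eq 0)
    go z eq (suc n) = go (z ∘ suc) (λ k → begin
      (g ⊗ (z ∘ suc)) k                     ≈⟨ +-identityˡ _ ⟨
      0# + (g ⊗ (z ∘ suc)) k                ≈⟨ +-congʳ (trans (*-congˡ (reg (eq 0))) (zeroʳ _)) ⟨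
      g (suc k) * z 0 + (g ⊗ (z ∘ suc)) k   ≈⟨ ⊗-sucʳ g z k ⟨
      (g ⊗ z) (suc k)                       ≈⟨ eq (suc k) ⟩
      0#                                    ∎) n

-- Exponential generating functions

module _ (R : CommutativeRing 0ℓ 0ℓ) where
  open CommutativeRing R
  open import Algebra.Properties.Semiring.Mult semiring renaming (_×_ to _·_)

  ×-zeroʳ : ∀ n → n · 0# ≈ 0#
  ×-zeroʳ zero    = refl
  ×-zeroʳ (suc n) = trans (+-identityˡ _) (×-zeroʳ n)

  -- `e n` plays the role of 1/n!. The abstraction allows the same product formula over ℚ[[q]] and,
  -- after `series-inverseFactorials`, over series in y with such coefficients; `×-cancel` replaces
  -- division by positive integers.
  record InverseFactorials : Set where
    field
      e        : ℕ → Carrier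
      e-zero   : e 0 ≈ 1#
      e-suc    : ∀ n → suc n · e (suc n) ≈ e n
      ×-cancel : ∀ n {x y} → suc n · x ≈ suc n · y → x ≈ y

module Exponential {R : CommutativeRing 0ℓ 0ℓ} (inverseFactorials : InverseFactorials R) where
  open InverseFactorials inverseFactorials
  open CommutativeRing R
  open PowerSeries R
  open Sums R
  open import Algebra.Properties.Semiring.Mult semiring renaming (_×_ to _·_)
  open import Relation.Binary.Reasoning.Setoid setoid
  private module P = CommutativeRing seriesRing

  series-inverseFactorials : InverseFactorials seriesRing
  series-inverseFactorials = record
    { e = λ n → const (e n)
    ; e-zero = λ { zero → e-zero ; (suc n) → refl }
    ; e-suc = λ { n zero → trans (reflexive (×-coefficient (suc n) _ 0)) (e-suc n)
                ; n (suc k) → trans (reflexive (×-coefficient (suc n) _ (suc k))) (×-zeroʳ R (suc n)) }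
    ; ×-cancel = λ n {f} {g} eq k → ×-cancel n (trans (reflexive (≡.sym (×-coefficient (suc n) f k)))
        (trans (eq k) (reflexive (×-coefficient (suc n) g k))))
    }

  egf : Series → Series
  egf f n = e n * f n

  -- By the Leibniz rule, differentiating either factor matches placing the first
  -- element of an (n+1)-set inside or outside the subset.
  egf-⊗ : ∀ f g n → (egf f ⊗ egf g) n ≈ e n * Σ[ subsets n ] (λ M → f ∣ M ∣ * g ∣ ∁ M ∣)
  egf-⊗ f g zero = begin
    (e 0 * f 0) * (e 0 * g 0)         ≈⟨ *-cong (*-congʳ e-zero) (*-congʳ e-zero) ⟩
    (1# * f 0) * (1# * g 0)           ≈⟨ *-cong (*-identityˡ _) (*-identityˡ _) ⟩
    f 0 * g 0                         ≈⟨ +-identityʳ _ ⟨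
    f 0 * g 0 + 0#                    ≈⟨ *-identityˡ _ ⟨
    1# * (f 0 * g 0 + 0#)             ≈⟨ *-congʳ e-zero ⟨
    e 0 * (f 0 * g 0 + 0#)            ∎
  egf-⊗ f g (suc n) = ×-cancel n (begin
    suc n · (egf f ⊗ egf g) (suc n)                     ≈⟨ leibniz (egf f) (egf g) (suc n) ⟩
    (euler (egf f) ⊗ egf g) (suc n) + (egf f ⊗ euler (egf g)) (suc n)
      ≈⟨ +-cong (P.*-congʳ {egf g} (euler-egf f) (suc n))
                (P.trans (P.*-congˡ {egf f} (euler-egf g)) (P.*-comm (egf f) (shift (egf (g ∘ suc)))) (suc n)) ⟩
    (shift (egf (f ∘ suc)) ⊗ egf g) (suc n) + (shift (egf (g ∘ suc)) ⊗ egf f) (suc n)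
      ≈⟨ +-cong (shift-⊗ _ _ (suc n)) (trans (shift-⊗ _ _ (suc n)) (P.*-comm (egf (g ∘ suc)) (egf f) n)) ⟩
    (egf (f ∘ suc) ⊗ egf g) n + (egf f ⊗ egf (g ∘ suc)) n      ≈⟨ +-cong (egf-⊗ (f ∘ suc) g n) (egf-⊗ f (g ∘ suc) n) ⟩
    e n * _ + e n * _                                   ≈⟨ distribˡ _ _ _ ⟨
    e n * (_ + _)                                       ≈⟨ *-cong (e-suc n) (Σ-subsets n _) ⟨
    (suc n · e (suc n)) * Σ[ subsets (suc n) ] (λ M → f ∣ M ∣ * g ∣ ∁ M ∣)   ≈⟨ ×-assoc-* (suc n) _ _ ⟩
    suc n · (e (suc n) * Σ[ subsets (suc n) ] (λ M → f ∣ M ∣ * g ∣ ∁ M ∣))   ∎)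
    where
    open Derivations.IsDerivation euler-isDerivation using (leibniz)
    euler-egf : ∀ f → euler (egf f) P.≈ shift (egf (f ∘ suc))
    euler-egf f zero    = refl
    euler-egf f (suc n) = trans (sym (×-assoc-* (suc n) (e (suc n)) (f (suc n)))) (*-congʳ (e-suc n))

-- Cutting a bipartite graph into blocks

module Graphs where
  open ≡ using (cong; cong₂)

  private variable
    A : Set
    n r s : ℕ

  merge : (M : Subset n) → Vec A ∣ M ∣ → Vec A ∣ ∁ M ∣ → Vec A n
  merge []          []       []       = []
  merge (true ∷ M)  (x ∷ xs) ys       = x ∷ merge M xs ys
  merge (false ∷ M) xs       (y ∷ ys) = y ∷ merge M xs ys

  embed : (M : Subset n) → Fin ∣ M ∣ → Fin n
  embed (true ∷ M)  zero    = zero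
  embed (true ∷ M)  (suc i) = suc (embed M i)
  embed (false ∷ M) i       = suc (embed M i)

  embed-injective : ∀ (M : Subset n) {i j} → embed M i ≡ embed M j → i ≡ j
  embed-injective (true ∷ M)  {zero}  {zero}  eq = ≡.refl
  embed-injective (true ∷ M)  {suc i} {suc j} eq = cong suc (embed-injective M (Fin.suc-injective eq))
  embed-injective (false ∷ M)                 eq = embed-injective M (Fin.suc-injective eq)

  lookup-embed : ∀ (M : Subset n) i → lookup M (embed M i) ≡ true
  lookup-embed (true ∷ M)  zero    = ≡.refl
  lookup-embed (true ∷ M)  (suc i) = lookup-embed M i
  lookup-embed (false ∷ M) i       = lookup-embed M i

  lookup-embed-∁ : ∀ (M : Subset n) i → lookup M (embed (∁ M) i) ≡ false
  lookup-embed-∁ (true ∷ M)  i       = lookup-embed-∁ M i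
  lookup-embed-∁ (false ∷ M) zero    = ≡.refl
  lookup-embed-∁ (false ∷ M) (suc i) = lookup-embed-∁ M i

  embed-surjective : ∀ (M : Subset n) i → lookup M i ≡ true → ∃ λ j → i ≡ embed M j
  embed-surjective (true ∷ M)  zero    eq = zero , ≡.refl
  embed-surjective (true ∷ M)  (suc i) eq with j , eq′ ← embed-surjective M i eq = suc j , cong suc eq′
  embed-surjective (false ∷ M) (suc i) eq with j , eq′ ← embed-surjective M i eq = j , cong suc eq′

  embed-∁-surjective : ∀ (M : Subset n) i → lookup M i ≡ false → ∃ λ j → i ≡ embed (∁ M) j
  embed-∁-surjective (false ∷ M) zero    eq = zero , ≡.refl
  embed-∁-surjective (true ∷ M)  (suc i) eq with j , eq′ ← embed-∁-surjective M i eq = j , cong suc eq′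
  embed-∁-surjective (false ∷ M) (suc i) eq with j , eq′ ← embed-∁-surjective M i eq = suc j , cong suc eq′

  lookup-merge : ∀ (M : Subset n) (u : Vec A _) v i → lookup (merge M u v) (embed M i) ≡ lookup u i
  lookup-merge (true ∷ M)  (x ∷ u) v       zero    = ≡.refl
  lookup-merge (true ∷ M)  (x ∷ u) v       (suc i) = lookup-merge M u v i
  lookup-merge (false ∷ M) u       (y ∷ v) i       = lookup-merge M u v i

  lookup-merge-∁ : ∀ (M : Subset n) (u : Vec A _) v i → lookup (merge M u v) (embed (∁ M) i) ≡ lookup v i
  lookup-merge-∁ (true ∷ M)  (x ∷ u) v       i       = lookup-merge-∁ M u v i
  lookup-merge-∁ (false ∷ M) u       (y ∷ v) zero    = ≡.refl
  lookup-merge-∁ (false ∷ M) u       (y ∷ v) (suc i) = lookup-merge-∁ M u v i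

  ∣merge∣ : ∀ (N : Subset n) p p′ → ∣ merge N p p′ ∣ ≡ ∣ p ∣ ℕ.+ ∣ p′ ∣
  ∣merge∣ []          []          []           = ≡.refl
  ∣merge∣ (true ∷ N)  (true ∷ p)  p′           = cong suc (∣merge∣ N p p′)
  ∣merge∣ (true ∷ N)  (false ∷ p) p′           = ∣merge∣ N p p′
  ∣merge∣ (false ∷ N) p           (true ∷ p′)  = ≡.trans (cong suc (∣merge∣ N p p′)) (≡.sym (ℕ.+-suc _ _))
  ∣merge∣ (false ∷ N) p           (false ∷ p′) = ∣merge∣ N p p′

  #edges-merge : ∀ (M : Subset n) (U : Graph _ s) V → #edges (merge M U V) ≡ #edges U ℕ.+ #edges V
  #edges-merge []          []      []      = ≡.refl
  #edges-merge (true ∷ M)  (p ∷ U) V       = ≡.trans (cong (∣ p ∣ ℕ.+_) (#edges-merge M U V)) (≡.sym (ℕ.+-assoc ∣ p ∣ _ _))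
  #edges-merge (false ∷ M) U       (p ∷ V) = ≡.trans (cong (∣ p ∣ ℕ.+_) (#edges-merge M U V))
    (Data.Nat.Solver.+-*-Solver.solve 3 (λ a b c → let open Data.Nat.Solver.+-*-Solver in a :+ (b :+ c) := b :+ (a :+ c)) ≡.refl ∣ p ∣ (#edges U) (#edges V))

  #edges-zipWith : ∀ (N : Subset s) {k} (U : Vec _ k) V → #edges (zipWith (merge N) U V) ≡ #edges U ℕ.+ #edges V
  #edges-zipWith N []      []       = ≡.refl
  #edges-zipWith N (p ∷ U) (p′ ∷ V) = ≡.trans (cong₂ ℕ._+_ (∣merge∣ N p p′) (#edges-zipWith N U V))
    (Data.Nat.Solver.+-*-Solver.solve 4 (λ a b c d → let open Data.Nat.Solver.+-*-Solver in (a :+ b) :+ (c :+ d) := (a :+ c) :+ (b :+ d)) ≡.refl (∣ p ∣) (∣ p′ ∣) (#edges U) (#edges V))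

  Edge : Graph r s → Fin r → Fin s → Set
  Edge G i j = lookup (lookup G i) j ≡ true

  Edgeless : Graph r s → Set
  Edgeless G = ∀ i j → ¬ Edge G i j

  edgeless⇒#edges≡0 : ∀ (G : Graph r s) → Edgeless G → #edges G ≡ 0
  edgeless⇒#edges≡0 []      e = ≡.refl
  edgeless⇒#edges≡0 (p ∷ G) e = cong₂ ℕ._+_ (go p (e zero)) (edgeless⇒#edges≡0 G (e ∘ suc))
    where
    go : ∀ {s} (p : Subset s) → (∀ j → ¬ lookup p j ≡ true) → ∣ p ∣ ≡ 0
    go []          e = ≡.refl
    go (true ∷ p)  e = ⊥-elim (e zero ≡.refl)
    go (false ∷ p) e = go p (e ∘ suc)

  #edges≡0⇒edgeless : ∀ (G : Graph r s) → #edges G ≡ 0 → Edgeless G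
  #edges≡0⇒edgeless (p ∷ G) eq zero    j = go p (ℕ.m+n≡0⇒m≡0 ∣ p ∣ eq) j
    where
    go : ∀ {s} (p : Subset s) → ∣ p ∣ ≡ 0 → ∀ j → ¬ lookup p j ≡ true
    go (false ∷ p) eq (suc j) = go p eq j
  #edges≡0⇒edgeless (p ∷ G) eq (suc i) j = #edges≡0⇒edgeless G (ℕ.m+n≡0⇒n≡0 ∣ p ∣ eq) i j

  adj-sym : ∀ (G : Graph r s) → Symmetric (Adj G)
  adj-sym G {inj₁ _} {inj₂ _} e = e
  adj-sym G {inj₂ _} {inj₁ _} e = e

  side : Subset r → Subset s → Vertex r s → Bool
  side M N (inj₁ i) = lookup M i
  side M N (inj₂ j) = lookup N j

  -- The biadjacency matrix cut along rows `M` and columns `N`: `G₁` lives on (M, N), `G₄` on the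
  -- complements, and `G₂`, `G₃` hold the edges between the two parts.
  module Block (M : Subset r) (N : Subset s)
    (G₁ : Graph ∣ M ∣ ∣ N ∣) (G₂ : Graph ∣ M ∣ ∣ ∁ N ∣) (G₃ : Graph ∣ ∁ M ∣ ∣ N ∣) (G₄ : Graph ∣ ∁ M ∣ ∣ ∁ N ∣) where

    block : Graph r s
    block = merge M (zipWith (merge N) G₁ G₂) (zipWith (merge N) G₃ G₄)

    #edges-block : #edges block ≡ (#edges G₁ ℕ.+ #edges G₂) ℕ.+ (#edges G₃ ℕ.+ #edges G₄)
    #edges-block = ≡.trans (#edges-merge M _ _) (cong₂ ℕ._+_ (#edges-zipWith N G₁ G₂) (#edges-zipWith N G₃ G₄))

    private
      ι : Vertex ∣ M ∣ ∣ N ∣ → Vertex r s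
      ι = Sum.map (embed M) (embed N)

      ι-injective : ∀ {x y} → ι x ≡ ι y → x ≡ y
      ι-injective {inj₁ _} {inj₁ _} eq = cong inj₁ (embed-injective M (Sum.inj₁-injective eq))
      ι-injective {inj₂ _} {inj₂ _} eq = cong inj₂ (embed-injective N (Sum.inj₂-injective eq))

      ι-surjective : ∀ v → side M N v ≡ true → ∃ λ x → v ≡ ι x
      ι-surjective (inj₁ i) eq with j , eq′ ← embed-surjective M i eq = inj₁ j , cong inj₁ eq′
      ι-surjective (inj₂ i) eq with j , eq′ ← embed-surjective N i eq = inj₂ j , cong inj₂ eq′

      side-ι : ∀ x → side M N (ι x) ≡ true
      side-ι (inj₁ i) = lookup-embed M i
      side-ι (inj₂ j) = lookup-embed N j

      entry : (G : Graph r s) → Fin r → Fin s → Bool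
      entry G i j = lookup (lookup G i) j

      entry₁ : ∀ i j → entry block (embed M i) (embed N j) ≡ lookup (lookup G₁ i) j
      entry₁ i j = ≡.trans (cong (λ p → lookup p (embed N j)) (≡.trans (lookup-merge M _ _ i) (Vec.lookup-zipWith (merge N) i G₁ G₂))) (lookup-merge N _ _ j)

      entry₂ : ∀ i j → entry block (embed M i) (embed (∁ N) j) ≡ lookup (lookup G₂ i) j
      entry₂ i j = ≡.trans (cong (λ p → lookup p (embed (∁ N) j)) (≡.trans (lookup-merge M _ _ i) (Vec.lookup-zipWith (merge N) i G₁ G₂))) (lookup-merge-∁ N _ _ j)

      entry₃ : ∀ i j → entry block (embed (∁ M) i) (embed N j) ≡ lookup (lookup G₃ i) j
      entry₃ i j = ≡.trans (cong (λ p → lookup p (embed N j)) (≡.trans (lookup-merge-∁ M (zipWith (merge N) G₁ G₂) _ i) (Vec.lookup-zipWith (merge N) i G₃ G₄))) (lookup-merge N _ _ j)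

      adj-ι⁺ : ∀ {x y} → Adj G₁ x y → Adj block (ι x) (ι y)
      adj-ι⁺ {inj₁ i} {inj₂ j} e = Vec.lookup⇒[]= _ _ (≡.trans (entry₁ i j) (Vec.[]=⇒lookup e))
      adj-ι⁺ {inj₂ j} {inj₁ i} e = Vec.lookup⇒[]= _ _ (≡.trans (entry₁ i j) (Vec.[]=⇒lookup e))

      adj-ι⁻ : ∀ {x y} → Adj block (ι x) (ι y) → Adj G₁ x y
      adj-ι⁻ {inj₁ i} {inj₂ j} e = Vec.lookup⇒[]= _ _ (≡.trans (≡.sym (entry₁ i j)) (Vec.[]=⇒lookup e))
      adj-ι⁻ {inj₂ j} {inj₁ i} e = Vec.lookup⇒[]= _ _ (≡.trans (≡.sym (entry₁ i j)) (Vec.[]=⇒lookup e))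

      Closed : Set
      Closed = ∀ x z → Adj block (ι x) z → side M N z ≡ true

      edgeless⇒closed : Edgeless G₂ → Edgeless G₃ → Closed
      edgeless⇒closed e₂ e₃ (inj₁ i) (inj₂ z) e with lookup N z in eq
      ... | true = ≡.refl
      ... | false with j , ≡.refl ← embed-∁-surjective N z eq = ⊥-elim (e₂ i j (≡.trans (≡.sym (entry₂ i j)) (Vec.[]=⇒lookup e)))
      edgeless⇒closed e₂ e₃ (inj₂ j) (inj₁ z) e with lookup M z in eq
      ... | true = ≡.refl
      ... | false with i , ≡.refl ← embed-∁-surjective M z eq = ⊥-elim (e₃ i j (≡.trans (≡.sym (entry₃ i j)) (Vec.[]=⇒lookup e)))

      closed⇒edgeless₂ : Closed → Edgeless G₂
      closed⇒edgeless₂ closed i j e with () ← ≡.trans (≡.sym (lookup-embed-∁ N j))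
        (closed (inj₁ i) (inj₂ (embed (∁ N) j)) (Vec.lookup⇒[]= _ _ (≡.trans (entry₂ i j) e)))

      closed⇒edgeless₃ : Closed → Edgeless G₃
      closed⇒edgeless₃ closed i j e with () ← ≡.trans (≡.sym (lookup-embed-∁ M i))
        (closed (inj₂ j) (inj₁ (embed (∁ M) i)) (Vec.lookup⇒[]= _ _ (≡.trans (entry₃ i j) e)))

      -- Without edges leaving the part, a walk that starts in it stays in it, edge by edge, and so
      -- is a walk of `G₁`.
      project : Closed → ∀ x {z} → Star (Adj block) (ι x) z → ∃ λ y → z ≡ ι y × Star (Adj G₁) x y
      project closed x ε = x , ≡.refl , ε
      project closed x (_◅_ {j = z} e es) with ι-surjective z (closed x z e)
      ... | y , ≡.refl with project closed y es
      ... | y′ , eq , es′ = y′ , eq , adj-ι⁻ {x} {y} e ◅ es′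

    IsComponent : Vertex r s → Set
    IsComponent u = ∀ v → (Star (Adj block) u v → side M N v ≡ true) × (side M N v ≡ true → Star (Adj block) u v)

    -- Two vertices of the part are joined by a walk through `u`, which `project` pulls back to
    -- `G₁`. A crossing edge would make a vertex outside the part reachable from `u`.
    component⇒ : ∀ {u} → IsComponent u → Connected G₁ × Edgeless G₂ × Edgeless G₃
    component⇒ {u} comp = connected , closed⇒edgeless₂ closed , closed⇒edgeless₃ closed
      where
      reach : ∀ x → Star (Adj block) u (ι x)
      reach x = proj₂ (comp (ι x)) (side-ι x)
      closed : Closed
      closed x z e = proj₁ (comp z) (reach x ◅◅ e ◅ ε)
      connected : Connected G₁
      connected x y with project closed x (Star.reverse (λ {a} {b} → adj-sym block {a} {b}) (reach x) ◅◅ reach y)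
      ... | y′ , eq , es with ≡.refl ← ι-injective {y} {y′} eq = es

    component⇐ : ∀ {u} → side M N u ≡ true → Connected G₁ × Edgeless G₂ × Edgeless G₃ → IsComponent u
    component⇐ {u} u∈ (connected , e₂ , e₃) v with u₀ , ≡.refl ← ι-surjective u u∈ = to , from
      where
      closed : Closed
      closed = edgeless⇒closed e₂ e₃
      to : Star (Adj block) (ι u₀) v → side M N v ≡ true
      to es with y , ≡.refl , _ ← project closed u₀ es = side-ι y
      from : side M N v ≡ true → Star (Adj block) (ι u₀) v
      from eq with y , ≡.refl ← ι-surjective v eq = Star.gmap ι (λ {a} {b} → adj-ι⁺ {a} {b}) (connected u₀ y)

-- Counting graphs by the component of a root

module GraphPolynomials where
  open ≡ using (cong)
  open Graphs

  private variable
    A : Set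
    n r s : ℕ

  star? : ∀ {r s} (G : Graph r s) → Decidable (Star (Adj G))
  star? {r} {s} G = Reachability.star? (Sum.≡-dec Fin._≟_ Fin._≟_) (adj? G) (vertices r s) ∈-vertices

  reachable : Graph r s → Vertex r s → Vertex r s → Bool
  reachable G u v = does (star? G u v)

  _≟ₛ_ : (M N : Subset n) → Dec (M ≡ N)
  _≟ₛ_ = Vec.≡-dec Bool._≟_

  -- Comparing the reachable set with (M, N) as bit vectors makes it evident that exactly one pair
  -- fits a given graph and root, so the indicators sum to one.
  component? : ∀ (G : Graph r s) u M N →
    Dec (tabulate (reachable G u ∘ inj₁) ≡ M × tabulate (reachable G u ∘ inj₂) ≡ N)
  component? G u M N = (tabulate (reachable G u ∘ inj₁) ≟ₛ M) ×-dec (tabulate (reachable G u ∘ inj₂) ≟ₛ N)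

  does⇒ : ∀ {P : Set} (p : Dec P) → does p ≡ true → P
  does⇒ (yes p) _ = p

  tabulate≡⇒ : ∀ {f : Fin n → Bool} {M} → tabulate f ≡ M → ∀ i → f i ≡ lookup M i
  tabulate≡⇒ {f = f} ≡.refl i = ≡.sym (Vec.lookup∘tabulate f i)

  ≗⇒tabulate≡ : ∀ {f : Fin n → Bool} {M} → (∀ i → f i ≡ lookup M i) → tabulate f ≡ M
  ≗⇒tabulate≡ {M = M} eq = ≡.trans (Vec.tabulate-cong eq) (Vec.tabulate∘lookup M)

  does≡ : ∀ {P : Set} (p : Dec P) {b} → (P → b ≡ true) → (b ≡ true → P) → does p ≡ b
  does≡ (yes p) {b}     f g = ≡.sym (f p)
  does≡ (no ¬p) {true}  f g = ⊥-elim (¬p (g ≡.refl))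
  does≡ (no ¬p) {false} f g = ≡.refl

  module GraphSums (R : CommutativeRing 0ℓ 0ℓ) where
    open CommutativeRing R
    open Sums R
    open IntegerSolver R using (solve; _:+_; _:*_; _:=_)
    open import Algebra.Properties.Semiring.Mult semiring using (×-congʳ; ×-assoc-*) renaming (_×_ to _·_)
    open import Algebra.Properties.Semiring.Exp semiring using (_^_; ^-homo-*; ^-congʳ)
    open import Relation.Binary.Reasoning.Setoid setoid

    ind : ∀ {P : Set} → Dec P → Carrier
    ind p = if does p then 1# else 0#

    ind-yes : ∀ {P : Set} (p : Dec P) → P → ind p ≈ 1#
    ind-yes p x rewrite dec-true p x = refl

    ind-no : ∀ {P : Set} (p : Dec P) → ¬ P → ind p ≈ 0#
    ind-no p ¬x rewrite dec-false p ¬x = refl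

    ind-cong : ∀ {P Q : Set} (p : Dec P) (q : Dec Q) → (P → Q) → (Q → P) → ind p ≈ ind q
    ind-cong (yes p) q f g = sym (ind-yes q (f p))
    ind-cong (no ¬p) q f g = sym (ind-no q (¬p ∘ g))

    ind-× : ∀ {P Q : Set} (p : Dec P) (q : Dec Q) → ind (p ×-dec q) ≈ ind p * ind q
    ind-× (yes _) q = sym (*-identityˡ _)
    ind-× (no _)  q = sym (zeroˡ _)

    Σ-ind-≟ : ∀ (X : Subset n) → Σ[ subsets n ] (λ M → ind (X ≟ₛ M)) ≈ 1#
    Σ-ind-≟ []          = +-identityʳ 1#
    Σ-ind-≟ {suc n} (true ∷ X) = begin
      _ ≈⟨ Σ-subsets n (λ M → ind ((true ∷ X) ≟ₛ M)) ⟩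
      _ ≈⟨ +-cong (Σ-cong (subsets n) (λ M → ind-cong ((true ∷ X) ≟ₛ (true ∷ M)) (X ≟ₛ M) Vec.∷-injectiveʳ (cong (true ∷_))))
                  (Σ-cong (subsets n) (λ M → ind-no ((true ∷ X) ≟ₛ (false ∷ M)) λ ())) ⟩
      _ ≈⟨ +-cong (Σ-ind-≟ X) (Σ-zero (subsets n)) ⟩
      1# + 0# ≈⟨ +-identityʳ 1# ⟩
      1# ∎
    Σ-ind-≟ {suc n} (false ∷ X) = begin
      _ ≈⟨ Σ-subsets n (λ M → ind ((false ∷ X) ≟ₛ M)) ⟩
      _ ≈⟨ +-cong (Σ-cong (subsets n) (λ M → ind-no ((false ∷ X) ≟ₛ (true ∷ M)) λ ()))
                  (Σ-cong (subsets n) (λ M → ind-cong ((false ∷ X) ≟ₛ (false ∷ M)) (X ≟ₛ M) Vec.∷-injectiveʳ (cong (false ∷_)))) ⟩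
      _ ≈⟨ +-cong (Σ-zero (subsets n)) (Σ-ind-≟ X) ⟩
      0# + 1# ≈⟨ +-identityˡ 1# ⟩
      1# ∎

    Σ-ind-lookup : ∀ (M : Subset n) → Σ[ allFin n ] (λ i → if lookup M i then 1# else 0#) ≈ ∣ M ∣ · 1#
    Σ-ind-lookup []      = refl
    Σ-ind-lookup {suc n} (b ∷ M) = begin
      hd b + Σ[ List.tabulate suc ] member
        ≈⟨ +-congˡ (reflexive (cong (λ xs → Σ[ xs ] member) (List.map-tabulate id suc))) ⟨
      hd b + Σ[ List.map suc (allFin n) ] member      ≈⟨ +-congˡ (Σ-map suc (allFin n) member) ⟩
      hd b + Σ[ allFin n ] (member ∘ suc)             ≈⟨ +-congˡ (Σ-ind-lookup M) ⟩
      hd b + ∣ M ∣ · 1#                               ≈⟨ head b ⟩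
      ∣ b ∷ M ∣ · 1#                                  ∎
      where
      hd : Bool → Carrier
      hd b = if b then 1# else 0#
      member : Fin (suc n) → Carrier
      member i = hd (lookup (b ∷ M) i)
      head : ∀ b → hd b + ∣ M ∣ · 1# ≈ ∣ b ∷ M ∣ · 1#
      head true  = refl
      head false = +-identityˡ _

    Σ-const : ∀ (xs : List A) a → Σ[ xs ] (λ _ → a) ≈ length xs · a
    Σ-const []       a = refl
    Σ-const (x ∷ xs) a = +-congˡ (Σ-const xs a)

    Σ-merge : ∀ (xs : List A) (M : Subset n) f →
      Σ[ allVecs xs n ] f ≈ Σ[ allVecs xs ∣ M ∣ ] (λ u → Σ[ allVecs xs ∣ ∁ M ∣ ] (λ v → f (merge M u v)))
    Σ-merge xs [] f = sym (+-identityʳ _)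
    Σ-merge xs (true ∷ M) f = begin
      _ ≈⟨ Σ-allVecs xs _ f ⟩
      _ ≈⟨ Σ-cong xs (λ x → Σ-merge xs M (f ∘ (x ∷_))) ⟩
      _ ≈⟨ Σ-allVecs xs ∣ M ∣ _ ⟨
      _ ∎
    Σ-merge xs (false ∷ M) f = begin
      _ ≈⟨ Σ-allVecs xs _ f ⟩
      _ ≈⟨ Σ-cong xs (λ x → Σ-merge xs M (f ∘ (x ∷_))) ⟩
      Σ[ xs ] (λ x → Σ[ allVecs xs ∣ M ∣ ] (λ u → Σ[ allVecs xs ∣ ∁ M ∣ ] (λ v → f (x ∷ merge M u v))))
        ≈⟨ Σ-swap xs (allVecs xs ∣ M ∣) _ ⟩
      _ ≈⟨ Σ-cong (allVecs xs ∣ M ∣) (λ u → Σ-allVecs xs ∣ ∁ M ∣ (λ v → f (merge (false ∷ M) u v))) ⟨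
      _ ∎

    Σ-columns : ∀ (N : Subset s) k (f : Graph k s → Carrier) →
      Σ[ allGraphs k s ] f ≈ Σ[ allGraphs k ∣ N ∣ ] (λ U → Σ[ allGraphs k ∣ ∁ N ∣ ] (λ V → f (zipWith (merge N) U V)))
    Σ-columns N zero    f = sym (+-identityʳ _)
    Σ-columns {s} N (suc k) f = begin
      _ ≈⟨ Σ-allVecs (subsets s) k f ⟩
      _ ≈⟨ Σ-cong (subsets s) (λ p → Σ-columns N k (f ∘ (p ∷_))) ⟩
      _ ≈⟨ Σ-merge _ N _ ⟩
      Σ[ P ] (λ p → Σ[ P′ ] (λ p′ → Σ[ Us ] (λ U → Σ[ Vs ] (λ V → f (merge N p p′ ∷ zipWith (merge N) U V)))))
        ≈⟨ Σ-cong P (λ p → Σ-swap P′ Us _) ⟩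
      Σ[ P ] (λ p → Σ[ Us ] (λ U → Σ[ P′ ] (λ p′ → Σ[ Vs ] (λ V → f (merge N p p′ ∷ zipWith (merge N) U V)))))
        ≈⟨ Σ-cong P (λ p → Σ-cong Us (λ U → Σ-allVecs P′ k (λ V → f (zipWith (merge N) (p ∷ U) V)))) ⟨
      _ ≈⟨ Σ-allVecs P k _ ⟨
      _ ∎
      where
      P = subsets ∣ N ∣
      P′ = subsets ∣ ∁ N ∣
      Us = allGraphs k ∣ N ∣
      Vs = allGraphs k ∣ ∁ N ∣

    -- Filling the four blocks independently produces every graph exactly once.
    Σ-block : ∀ (M : Subset r) (N : Subset s) f →
      Σ[ allGraphs r s ] f ≈
      Σ[ allGraphs ∣ M ∣ ∣ N ∣ ] (λ G₁ → Σ[ allGraphs ∣ M ∣ ∣ ∁ N ∣ ] (λ G₂ →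
        Σ[ allGraphs ∣ ∁ M ∣ ∣ N ∣ ] (λ G₃ → Σ[ allGraphs ∣ ∁ M ∣ ∣ ∁ N ∣ ] (λ G₄ → f (Block.block M N G₁ G₂ G₃ G₄)))))
    Σ-block {r} {s} M N f = begin
      _ ≈⟨ Σ-merge (subsets s) M f ⟩
      _ ≈⟨ Σ-columns N ∣ M ∣ _ ⟩
      _ ≈⟨ Σ-cong (allGraphs ∣ M ∣ ∣ N ∣) (λ G₁ → Σ-cong (allGraphs ∣ M ∣ ∣ ∁ N ∣) (λ G₂ → Σ-columns N ∣ ∁ M ∣ _)) ⟩
      _ ∎

    Σ-product : ∀ {B C D : Set} (as : List A) (bs : List B) (cs : List C) (ds : List D) f g h k →
      Σ[ as ] (λ a → Σ[ bs ] (λ b → Σ[ cs ] (λ c → Σ[ ds ] (λ d → (f a * g b) * (h c * k d))))) ≈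
      (Σ[ as ] f * Σ[ bs ] g) * (Σ[ cs ] h * Σ[ ds ] k)
    Σ-product as bs cs ds f g h k = begin
      _ ≈⟨ Σ-cong as (λ a → Σ-cong bs (λ b → trans (Σ-cong cs (λ c → sym (*-distribˡ-Σ (f a * g b) ds _))) (sym (*-distribˡ-Σ (f a * g b) cs _)))) ⟩
      _ ≈⟨ Σ-cong as (λ a → Σ-cong bs (λ b → *-congˡ (trans (Σ-cong cs (λ c → sym (*-distribˡ-Σ (h c) ds k))) (sym (*-distribʳ-Σ _ cs h))))) ⟩
      _ ≈⟨ Σ-cong as (λ a → *-distribʳ-Σ _ bs _) ⟨
      _ ≈⟨ *-distribʳ-Σ _ as _ ⟨
      _ ≈⟨ *-congʳ (trans (Σ-cong as (λ a → sym (*-distribˡ-Σ (f a) bs g))) (sym (*-distribʳ-Σ _ as f))) ⟩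
      _ ∎

    -- Each of the rs possible edges is independently present with weight t or absent with weight 1.
    Σ-^#edges : ∀ t r s → Σ[ allGraphs r s ] (λ G → t ^ #edges G) ≈ ((1# + t) ^ s) ^ r
    Σ-^#edges t r s = rows r
      where
      row : ∀ s → Σ[ subsets s ] (λ p → t ^ ∣ p ∣) ≈ (1# + t) ^ s
      row zero    = +-identityʳ 1#
      row (suc s) = begin
        _ ≈⟨ Σ-subsets s _ ⟩
        _ ≈⟨ +-congʳ (*-distribˡ-Σ t (subsets s) _) ⟨
        t * Σ[ subsets s ] (λ p → t ^ ∣ p ∣) + Σ[ subsets s ] (λ p → t ^ ∣ p ∣)  ≈⟨ +-cong (*-congˡ (row s)) (row s) ⟩
        t * (1# + t) ^ s + (1# + t) ^ s   ≈⟨ solve 3 (λ o t x → t :* x :+ x := (IntegerSolver.#1 R :+ t) :* x) refl 1# t _ ⟩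
        (1# + t) * (1# + t) ^ s ∎
      rows : ∀ r → Σ[ allGraphs r s ] (λ G → t ^ #edges G) ≈ ((1# + t) ^ s) ^ r
      rows zero    = +-identityʳ 1#
      rows (suc r) = begin
        _ ≈⟨ Σ-allVecs (subsets s) r _ ⟩
        _ ≈⟨ Σ-cong (subsets s) (λ p → trans (Σ-cong (allGraphs r s) (λ G → ^-homo-* t ∣ p ∣ (#edges G))) (sym (*-distribˡ-Σ _ (allGraphs r s) _))) ⟩
        _ ≈⟨ *-distribʳ-Σ _ (subsets s) _ ⟨
        _ ≈⟨ *-cong (row s) (rows r) ⟩
        _ ∎

    ind-#edges : ∀ t m → ind (m ℕ.≟ 0) * t ^ m ≈ 0# ^ m
    ind-#edges t zero    = *-identityˡ 1#
    ind-#edges t (suc m) = trans (zeroˡ _) (sym (zeroˡ _))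

    1+0^ : ∀ m → (1# + 0#) ^ m ≈ 1#
    1+0^ zero    = refl
    1+0^ (suc m) = trans (*-cong (+-identityʳ 1#) (1+0^ m)) (*-identityˡ 1#)

    -- The indicator of edgelessness turns the weight t into the weight 0.
    Σ-edgeless : ∀ t r s → Σ[ allGraphs r s ] (λ G → ind (#edges G ℕ.≟ 0) * t ^ #edges G) ≈ 1#
    Σ-edgeless t r s = begin
      _ ≈⟨ Σ-cong (allGraphs r s) (λ G → ind-#edges t (#edges G)) ⟩
      _ ≈⟨ Σ-^#edges 0# r s ⟩
      ((1# + 0#) ^ s) ^ r   ≈⟨ ^-congˡ r (1+0^ s) ⟩
      1# ^ r                ≈⟨ ^-congˡ r (+-identityʳ 1#) ⟨
      (1# + 0#) ^ r         ≈⟨ 1+0^ r ⟩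
      1#                    ∎
      where open import Algebra.Properties.Semiring.Exp semiring using (^-congˡ)

    module _ (q : Carrier) where

      graphSum connectedSum : ℕ → ℕ → Carrier
      graphSum     r s = Σ[ allGraphs r s ] (λ G → q ^ #edges G)
      connectedSum r s = Σ[ allGraphs r s ] (λ G → ind (connected? G) * q ^ #edges G)

      componentTerm : ∀ {r s} → Subset r → Subset s → Carrier
      componentTerm M N = connectedSum (∣ M ∣) (∣ N ∣) * graphSum (∣ ∁ M ∣) (∣ ∁ N ∣)

      private
        -- The factor `1#` belongs to the unconstrained block `G₄`: with one factor per block the
        -- sum over graphs splits into four sums.
        ind-block : ∀ (M : Subset r) (N : Subset s) {u} → side M N u ≡ true → ∀ G₁ G₂ G₃ G₄ →
          ind (component? (Block.block M N G₁ G₂ G₃ G₄) u M N) ≈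
          (ind (connected? G₁) * ind (#edges G₂ ℕ.≟ 0)) * (ind (#edges G₃ ℕ.≟ 0) * 1#)
        ind-block {r} {s} M N {u} u∈ G₁ G₂ G₃ G₄ = begin
          ind (component? block u M N)                  ≈⟨ ind-cong (component? block u M N) (connected? G₁ ×-dec (E₂ ×-dec E₃)) to from ⟩
          ind (connected? G₁ ×-dec (E₂ ×-dec E₃))       ≈⟨ ind-× (connected? G₁) (E₂ ×-dec E₃) ⟩
          ind (connected? G₁) * ind (E₂ ×-dec E₃)       ≈⟨ *-congˡ (trans (ind-× E₂ E₃) (*-congˡ (sym (*-identityʳ (ind E₃))))) ⟩
          ind (connected? G₁) * (ind E₂ * (ind E₃ * 1#)) ≈⟨ *-assoc _ _ _ ⟨
          (ind (connected? G₁) * ind E₂) * (ind E₃ * 1#) ∎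
          where
          E₂ = #edges G₂ ℕ.≟ 0
          E₃ = #edges G₃ ℕ.≟ 0
          open Block M N G₁ G₂ G₃ G₄
          to : tabulate (reachable block u ∘ inj₁) ≡ M × tabulate (reachable block u ∘ inj₂) ≡ N →
            Connected G₁ × #edges G₂ ≡ 0 × #edges G₃ ≡ 0
          to (eq₁ , eq₂) = let c , e₂ , e₃ = component⇒ {u} isComponent in c , edgeless⇒#edges≡0 G₂ e₂ , edgeless⇒#edges≡0 G₃ e₃
            where
            reach≡ : ∀ v → reachable block u v ≡ side M N v
            reach≡ (inj₁ i) = tabulate≡⇒ eq₁ i
            reach≡ (inj₂ j) = tabulate≡⇒ eq₂ j
            isComponent : IsComponent u
            isComponent v = (λ es → ≡.trans (≡.sym (reach≡ v)) (dec-true (star? block u v) es))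
                          , (λ v∈ → does⇒ (star? block u v) (≡.trans (reach≡ v) v∈))
          from : Connected G₁ × #edges G₂ ≡ 0 × #edges G₃ ≡ 0 →
            tabulate (reachable block u ∘ inj₁) ≡ M × tabulate (reachable block u ∘ inj₂) ≡ N
          from (c , z₂ , z₃) = ≗⇒tabulate≡ (reach≡ ∘ inj₁) , ≗⇒tabulate≡ (reach≡ ∘ inj₂)
            where
            isComponent = component⇐ u∈ (c , #edges≡0⇒edgeless G₂ z₂ , #edges≡0⇒edgeless G₃ z₃)
            reach≡ : ∀ v → reachable block u v ≡ side M N v
            reach≡ v = does≡ (star? block u v) (proj₁ (isComponent v)) (proj₂ (isComponent v))

        ^-block : ∀ (M : Subset r) (N : Subset s) G₁ G₂ G₃ G₄ → q ^ #edges (Block.block M N G₁ G₂ G₃ G₄) ≈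
          (q ^ #edges G₁ * q ^ #edges G₂) * (q ^ #edges G₃ * q ^ #edges G₄)
        ^-block M N G₁ G₂ G₃ G₄ = trans (^-congʳ q (Block.#edges-block M N G₁ G₂ G₃ G₄))
          (trans (^-homo-* q (#edges G₁ ℕ.+ #edges G₂) _) (*-cong (^-homo-* q (#edges G₁) _) (^-homo-* q (#edges G₃) _)))

        Σ-component : ∀ (M : Subset r) (N : Subset s) u →
          Σ[ allGraphs r s ] (λ G → ind (component? G u M N) * q ^ #edges G) ≈
          (if side M N u then 1# else 0#) * componentTerm M N
        Σ-component {r} {s} M N u with side M N u in eq
        ... | true = begin
          _ ≈⟨ Σ-block M N _ ⟩
          _ ≈⟨ Σ-cong (allGraphs ∣ M ∣ ∣ N ∣) (λ G₁ → Σ-cong (allGraphs ∣ M ∣ ∣ ∁ N ∣) (λ G₂ → Σ-cong (allGraphs ∣ ∁ M ∣ ∣ N ∣) (λ G₃ →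
                 Σ-cong (allGraphs ∣ ∁ M ∣ ∣ ∁ N ∣) (λ G₄ → trans (*-cong (ind-block M N eq G₁ G₂ G₃ G₄) (^-block M N G₁ G₂ G₃ G₄))
                   (solve 8 (λ a b c d a′ b′ c′ d′ → ((a :* b) :* (c :* d)) :* ((a′ :* b′) :* (c′ :* d′)) := ((a :* a′) :* (b :* b′)) :* ((c :* c′) :* (d :* d′)))
                     refl _ _ _ _ _ _ _ _))))) ⟩
          _ ≈⟨ Σ-product (allGraphs ∣ M ∣ ∣ N ∣) (allGraphs ∣ M ∣ ∣ ∁ N ∣) (allGraphs ∣ ∁ M ∣ ∣ N ∣) (allGraphs ∣ ∁ M ∣ ∣ ∁ N ∣) 
                 (λ G₁ → ind (connected? G₁) * q ^ #edges G₁) (λ G₂ → ind (#edges G₂ ℕ.≟ 0) * q ^ #edges G₂) (λ G₃ → ind (#edges G₃ ℕ.≟ 0) * q ^ #edges G₃) (λ G₄ → 1# * q ^ #edges G₄) ⟩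
          -- The crossing blocks must be empty, hence contribute 1 each; connected graphs on the
          -- part and arbitrary graphs on its complement remain.
          _ ≈⟨ *-cong (*-congˡ (Σ-edgeless q ∣ M ∣ ∣ ∁ N ∣)) (*-cong (Σ-edgeless q ∣ ∁ M ∣ ∣ N ∣) (Σ-cong (allGraphs ∣ ∁ M ∣ ∣ ∁ N ∣) (λ G₄ → *-identityˡ (q ^ #edges G₄)))) ⟩
          (connectedSum (∣ M ∣) (∣ N ∣) * 1#) * (1# * graphSum (∣ ∁ M ∣) (∣ ∁ N ∣))   ≈⟨ *-cong (*-identityʳ _) (*-identityˡ _) ⟩
          componentTerm M N                                                     ≈⟨ *-identityˡ _ ⟨
          1# * componentTerm M N ∎
        -- The root reaches itself by the empty walk, so no graph has a component of `u` that misses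
        -- `u`.
        ... | false = begin
          _ ≈⟨ Σ-cong (allGraphs r s) (λ G → trans (*-congʳ (ind-no (component? G u M N) (¬component G u eq))) (zeroˡ _)) ⟩
          _ ≈⟨ Σ-zero (allGraphs r s) ⟩
          0#                     ≈⟨ zeroˡ _ ⟨
          0# * componentTerm M N ∎
          where
          ¬component : ∀ (G : Graph r s) u → side M N u ≡ false →
            ¬ (tabulate (reachable G u ∘ inj₁) ≡ M × tabulate (reachable G u ∘ inj₂) ≡ N)
          ¬component G u@(inj₁ i) eq (eq₁ , _) with () ← ≡.trans (≡.sym (dec-true (star? G u u) ε)) (≡.trans (tabulate≡⇒ eq₁ i) eq)
          ¬component G u@(inj₂ j) eq (_ , eq₂) with () ← ≡.trans (≡.sym (dec-true (star? G u u) ε)) (≡.trans (tabulate≡⇒ eq₂ j) eq)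

      -- The constant 1 is inserted in front of each graph as the sum of the indicators of all
      -- candidate components, and the sums are exchanged.
      graphSum-root : ∀ r s u → graphSum r s ≈
        Σ[ subsets r ] (λ M → Σ[ subsets s ] (λ N → (if side M N u then 1# else 0#) * componentTerm M N))
      graphSum-root r s u = begin
        _ ≈⟨ Σ-cong (allGraphs r s) (λ G → trans (sym (*-identityˡ _)) (*-congʳ (sym (Σ-component? G)))) ⟩
        _ ≈⟨ Σ-cong (allGraphs r s) (λ G → trans (*-distribʳ-Σ _ (subsets r) _) (Σ-cong (subsets r) (λ M → *-distribʳ-Σ _ (subsets s) _))) ⟩
        Σ[ allGraphs r s ] (λ G → Σ[ subsets r ] (λ M → Σ[ subsets s ] (λ N → ind (component? G u M N) * q ^ #edges G)))
          ≈⟨ Σ-swap (allGraphs r s) (subsets r) _ ⟩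
        _ ≈⟨ Σ-cong (subsets r) (λ M → Σ-swap (allGraphs r s) (subsets s) _) ⟩
        _ ≈⟨ Σ-cong (subsets r) (λ M → Σ-cong (subsets s) (λ N → Σ-component M N u)) ⟩
        _ ∎
        where
        Σ-component? : ∀ G → Σ[ subsets r ] (λ M → Σ[ subsets s ] (λ N → ind (component? G u M N))) ≈ 1#
        Σ-component? G = begin
          _ ≈⟨ Σ-cong (subsets r) (λ M → trans (Σ-cong (subsets s) (λ N → ind-× (X ≟ₛ M) (Y ≟ₛ N))) (sym (*-distribˡ-Σ _ (subsets s) _))) ⟩
          _ ≈⟨ Σ-cong (subsets r) (λ M → trans (*-congˡ (Σ-ind-≟ Y)) (*-identityʳ _)) ⟩
          _ ≈⟨ Σ-ind-≟ X ⟩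
          1# ∎
          where
          X = tabulate (reachable G u ∘ inj₁)
          Y = tabulate (reachable G u ∘ inj₂)

      private
        -- Double counting of pairs of a graph and a root on one side: the condition that the root
        -- lies in (M, N) sums to the size of that side of the component. On coefficients this is
        -- D_x G = G D_x C, or its analogue for y.
        sum-over-roots : ∀ r s {k} (ι : Fin k → Vertex r s) (size : Subset r → Subset s → ℕ) →
          (∀ M N → Σ[ allFin k ] (λ i → if side M N (ι i) then 1# else 0#) ≈ size M N · 1#) →
          k · graphSum r s ≈ Σ[ subsets r ] (λ M → Σ[ subsets s ] (λ N → size M N · componentTerm M N))
        sum-over-roots r s {k} ι size hyp = begin
          k · graphSum r s ≈⟨ reflexive (cong (_· graphSum r s) (List.length-tabulate {n = k} id)) ⟨
          _ ≈⟨ Σ-const (allFin k) _ ⟨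
          _ ≈⟨ Σ-cong (allFin k) (λ i → graphSum-root r s (ι i)) ⟩
          _ ≈⟨ Σ-swap (allFin k) (subsets r) _ ⟩
          _ ≈⟨ Σ-cong (subsets r) (λ M → Σ-swap (allFin k) (subsets s) _) ⟩
          _ ≈⟨ Σ-cong (subsets r) (λ M → Σ-cong (subsets s) (λ N → trans (sym (*-distribʳ-Σ _ (allFin k) _))
                 (trans (*-congʳ (hyp M N)) (trans (×-assoc-* (size M N) 1# _) (×-congʳ (size M N) (*-identityˡ _)))))) ⟩
          _ ∎

      graphSum-left : ∀ r s → r · graphSum r s ≈ Σ[ subsets r ] (λ M → Σ[ subsets s ] (λ N → ∣ M ∣ · componentTerm M N))
      graphSum-left r s = sum-over-roots r s inj₁ (λ M N → ∣ M ∣) (λ M N → Σ-ind-lookup M)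

      graphSum-right : ∀ r s → s · graphSum r s ≈ Σ[ subsets r ] (λ M → Σ[ subsets s ] (λ N → ∣ N ∣ · componentTerm M N))
      graphSum-right r s = sum-over-roots r s inj₂ (λ M N → ∣ N ∣) (λ M N → Σ-ind-lookup N)

-- Rational coefficients and inverse factorials

module Rationals where
  open CommutativeRing ℚ.+-*-commutativeRing using (semiring; *-identityʳ; *-identityˡ)
  open import Algebra.Properties.Semiring.Mult semiring using (×-assoc-*; ×-comm-*; ×-assocˡ) renaming (_×_ to _·_)
  open import Data.Integer.Base using (+_)
  open ≡ using (refl; cong; sym; trans)
  open ≡.≡-Reasoning

  private
    +-/ : ∀ m n d → + (m ℕ.+ n) ℚ./ suc d ≡ + m ℚ./ suc d ℚ.+ + n ℚ./ suc d
    +-/ m n d = ℚ.toℚᵘ-injective (ℚᵘ.≃-trans (ℚ.toℚᵘ-fromℚᵘ (mkℚᵘ (+ (m ℕ.+ n)) d)) (ℚᵘ.≃-trans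
      (*≡* (solve 3 (λ m n d → (m :+ n) :* (d :* d) := (m :* d :+ n :* d) :* d) refl (+ m) (+ n) (+ suc d)))
      (ℚᵘ.≃-sym (ℚᵘ.≃-trans (ℚ.toℚᵘ-homo-+ (+ m ℚ./ suc d) (+ n ℚ./ suc d))
        (ℚᵘ.+-cong (ℚ.toℚᵘ-fromℚᵘ (mkℚᵘ (+ m) d)) (ℚ.toℚᵘ-fromℚᵘ (mkℚᵘ (+ n) d)))))))
      where open Data.Integer.Solver.+-*-Solver

  /≡× : ∀ n d .{{_ : ℕ.NonZero d}} → + n ℚ./ d ≡ n · (+ 1 ℚ./ d)
  /≡× zero    d       = ℚ.0/n≡0 d
  /≡× (suc n) (suc d) = trans (+-/ 1 n d) (cong (+ 1 ℚ./ suc d ℚ.+_) (/≡× n (suc d)))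

  ×-1/ : ∀ d .{{_ : ℕ.NonZero d}} → d · (+ 1 ℚ./ d) ≡ 1ℚ
  ×-1/ (suc d) = trans (sym (/≡× (suc d) (suc d))) (ℚ.fromℚᵘ-cong {mkℚᵘ (+ suc d) d} {mkℚᵘ (+ 1) 0} (*≡* (ℤ.*-comm (+ suc d) (+ 1))))

  /1-* : ∀ n x → + n ℚ./ 1 ℚ.* x ≡ n · x
  /1-* n x = trans (cong (ℚ._* x) (/≡× n 1)) (trans (×-assoc-* n 1ℚ x) (cong (n ·_) (*-identityˡ x)))

  1/-×-cancel : ∀ d .{{_ : ℕ.NonZero d}} x → + 1 ℚ./ d ℚ.* (d · x) ≡ x
  1/-×-cancel d x = begin
    + 1 ℚ./ d ℚ.* (d · x)     ≡⟨ ×-comm-* d (+ 1 ℚ./ d) x ⟩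
    d · (+ 1 ℚ./ d ℚ.* x)     ≡⟨ ×-assoc-* d (+ 1 ℚ./ d) x ⟨
    (d · (+ 1 ℚ./ d)) ℚ.* x   ≡⟨ cong (ℚ._* x) (×-1/ d) ⟩
    1ℚ ℚ.* x                  ≡⟨ *-identityˡ x ⟩
    x                         ∎

  ×-cancel : ∀ d .{{_ : ℕ.NonZero d}} {x y} → d · x ≡ d · y → x ≡ y
  ×-cancel d {x} {y} eq = trans (sym (1/-×-cancel d x)) (trans (cong (+ 1 ℚ./ d ℚ.*_) eq) (1/-×-cancel d y))

  1/_! : ℕ → ℚ
  1/ zero  ! = 1ℚ
  1/ suc n ! = + 1 ℚ./ suc n ℚ.* 1/ n !

  private
    suc-×-1/! : ∀ n → suc n · 1/ suc n ! ≡ 1/ n !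
    suc-×-1/! n = trans (sym (×-assoc-* (suc n) (+ 1 ℚ./ suc n) _)) (trans (cong (ℚ._* 1/ n !) (×-1/ (suc n))) (*-identityˡ _))

    !-×-1/! : ∀ n → (n !) · 1/ n ! ≡ 1ℚ
    !-×-1/! zero    = refl
    !-×-1/! (suc n) = begin
      (suc n ℕ.* n !) · 1/ suc n !     ≡⟨ cong (_· 1/ suc n !) (ℕ.*-comm (suc n) (n !)) ⟩
      (n ! ℕ.* suc n) · 1/ suc n !     ≡⟨ ×-assocˡ _ (n !) (suc n) ⟨
      (n !) · (suc n · 1/ suc n !)     ≡⟨ cong ((n !) ·_) (suc-×-1/! n) ⟩
      (n !) · 1/ n !                   ≡⟨ !-×-1/! n ⟩
      1ℚ                               ∎

  rationalFactorials : InverseFactorials ℚ.+-*-commutativeRing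
  rationalFactorials = record
    { e = 1/_! ; e-zero = refl ; e-suc = suc-×-1/! ; ×-cancel = λ n → ×-cancel (suc n) }

  -- Brings the coefficients of `F` into the nested form of `egf₂`.
  /!*! : ∀ n r s → let instance _ = r ℕ.!* s !≢0 in + n ℚ./ (r ! ℕ.* s !) ≡ 1/ r ! ℚ.* (1/ s ! ℚ.* (n · 1ℚ))
  /!*! n r s = begin
    + n ℚ./ (r ! ℕ.* s !)                ≡⟨ /≡× n (r ! ℕ.* s !) ⟩
    n · (+ 1 ℚ./ (r ! ℕ.* s !))          ≡⟨ cong (n ·_) (×-cancel (r ! ℕ.* s !) (trans (×-1/ (r ! ℕ.* s !)) (sym unit))) ⟩
    n · (1/ r ! ℚ.* 1/ s !)              ≡⟨ cong (n ·_) (cong (1/ r ! ℚ.*_) (*-identityʳ _)) ⟨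
    n · (1/ r ! ℚ.* (1/ s ! ℚ.* 1ℚ))     ≡⟨ ×-comm-* n (1/ r !) (1/ s ! ℚ.* 1ℚ) ⟨
    1/ r ! ℚ.* (n · (1/ s ! ℚ.* 1ℚ))     ≡⟨ cong (1/ r ! ℚ.*_) (×-comm-* n (1/ s !) 1ℚ) ⟨
    1/ r ! ℚ.* (1/ s ! ℚ.* (n · 1ℚ))     ∎
    where
    instance _ = r ℕ.!* s !≢0
    unit : (r ! ℕ.* s !) · (1/ r ! ℚ.* 1/ s !) ≡ 1ℚ
    unit = begin
      (r ! ℕ.* s !) · (1/ r ! ℚ.* 1/ s !)         ≡⟨ ×-assocˡ _ (r !) (s !) ⟨
      (r !) · ((s !) · (1/ r ! ℚ.* 1/ s !))       ≡⟨ cong ((r !) ·_) (×-comm-* (s !) (1/ r !) (1/ s !)) ⟨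
      (r !) · (1/ r ! ℚ.* ((s !) · 1/ s !))       ≡⟨ cong (λ z → (r !) · (1/ r ! ℚ.* z)) (!-×-1/! s) ⟩
      (r !) · (1/ r ! ℚ.* 1ℚ)                     ≡⟨ cong ((r !) ·_) (*-identityʳ _) ⟩
      (r !) · 1/ r !                              ≡⟨ !-×-1/! r ⟩
      1ℚ                                          ∎

-- Bivariate series as series in x over series in y

module Bivariate (R : CommutativeRing 0ℓ 0ℓ) where
  module P₁ = PowerSeries R
  module P₂ = PowerSeries P₁.seriesRing
  module R = CommutativeRing R
  module R₁ = CommutativeRing P₁.seriesRing
  module R₂ = CommutativeRing P₂.seriesRing
  open Derivations R using (IsDerivation)
  open Derivations P₂.seriesRing using () renaming (IsDerivation to IsDerivation₂)

  Series₂ : Set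
  Series₂ = ℕ → ℕ → R.Carrier

  X Y : Series₂ → Series₂
  X = P₂.euler
  Y = P₂.lift P₁.euler

  lift₂ : (R.Carrier → R.Carrier) → Series₂ → Series₂
  lift₂ d = P₂.lift (P₁.lift d)

  const₂ : R.Carrier → Series₂
  const₂ a = P₂.const (P₁.const a)

  open import Algebra.Properties.Semiring.Mult R.semiring using () renaming (_×_ to _·_)

  X-coefficient : ∀ f i j → X f i j ≡ i · f i j
  X-coefficient f i j = P₁.×-coefficient i (f i) j

  const₂-* : ∀ a f i j → (const₂ a R₂.* f) i j R.≈ a R.* f i j
  const₂-* a f i j = R.trans (P₂.const-⊗ (P₁.const a) f i j) (P₁.const-⊗ a (f i) j)

  X-isDerivation : IsDerivation₂ X
  X-isDerivation = P₂.euler-isDerivation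

  Y-isDerivation : IsDerivation₂ Y
  Y-isDerivation = P₂.lift-isDerivation P₁.euler-isDerivation

  XY-comm : ∀ f → X (Y f) R₂.≈ Y (X f)
  XY-comm = P₂.euler-lift P₁.euler-isDerivation

  module _ {d} (dd : IsDerivation d) where
    lift₂-isDerivation : IsDerivation₂ (lift₂ d)
    lift₂-isDerivation = P₂.lift-isDerivation (P₁.lift-isDerivation dd)

    X-lift₂ : ∀ f → X (lift₂ d f) R₂.≈ lift₂ d (X f)
    X-lift₂ = P₂.euler-lift (P₁.lift-isDerivation dd)

    Y-lift₂ : ∀ f → Y (lift₂ d f) R₂.≈ lift₂ d (Y f)
    Y-lift₂ f i = P₁.euler-lift dd (f i)

module BivariateExponential {R : CommutativeRing 0ℓ 0ℓ} (fi : InverseFactorials R) where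
  open Bivariate R
  open CommutativeRing R
  open InverseFactorials fi
  private
    module E₁ = Exponential fi
    module E₂ = Exponential E₁.series-inverseFactorials
    module Σ₁ = Sums P₁.seriesRing
  open Sums R
  open import Algebra.Properties.Semiring.Mult semiring using (×-comm-*) renaming (_×_ to _·_)
  open import Relation.Binary.Reasoning.Setoid setoid

  egf₂ : Series₂ → Series₂
  egf₂ f i j = e i * (e j * f i j)

  private
    egf₂≈ : ∀ f → E₂.egf (E₁.egf ∘ f) R₂.≈ egf₂ f
    egf₂≈ f i j = P₁.const-⊗ (e i) (E₁.egf (f i)) j

    Σ-coefficient : ∀ {A : Set} (xs : List A) f n → Σ₁.Σ[ xs ] f n ≡ Σ[ xs ] (λ x → f x n)
    Σ-coefficient []       f n = ≡.refl
    Σ-coefficient (x ∷ xs) f n = ≡.cong (f x n +_) (Σ-coefficient xs f n)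

  egf₂-* : ∀ f g i j → (egf₂ f R₂.* egf₂ g) i j ≈
    e i * (e j * Σ[ subsets i ] (λ M → Σ[ subsets j ] (λ N → f (∣ M ∣) (∣ N ∣) * g (∣ ∁ M ∣) (∣ ∁ N ∣))))
  egf₂-* f g i j = begin
    (egf₂ f R₂.* egf₂ g) i j                                 ≈⟨ R₂.*-cong (egf₂≈ f) (egf₂≈ g) i j ⟨
    (E₂.egf (E₁.egf ∘ f) R₂.* E₂.egf (E₁.egf ∘ g)) i j       ≈⟨ E₂.egf-⊗ (E₁.egf ∘ f) (E₁.egf ∘ g) i j ⟩
    (P₁.const (e i) R₁.* Σ₁.Σ[ subsets i ] _) j              ≈⟨ P₁.const-⊗ (e i) _ j ⟩
    e i * Σ₁.Σ[ subsets i ] _ j                              ≈⟨ *-congˡ (reflexive (Σ-coefficient (subsets i) _ j)) ⟩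
    e i * Σ[ subsets i ] _                                   ≈⟨ *-congˡ (Σ-cong (subsets i) (λ M → E₁.egf-⊗ (f ∣ M ∣) (g ∣ ∁ M ∣) j)) ⟩
    e i * Σ[ subsets i ] (λ M → e j * _)                     ≈⟨ *-congˡ (*-distribˡ-Σ (e j) (subsets i) _) ⟨
    _                                                        ∎

  X-egf₂ : ∀ f → X (egf₂ f) R₂.≈ egf₂ (λ i j → i · f i j)
  X-egf₂ f i j = trans (reflexive (X-coefficient (egf₂ f) i j)) (trans (sym (×-comm-* i (e i) _)) (*-congˡ (sym (×-comm-* i (e j) _))))

  Y-egf₂ : ∀ f → Y (egf₂ f) R₂.≈ egf₂ (λ i j → j · f i j)
  Y-egf₂ f i j = trans (sym (×-comm-* j (e i) _)) (*-congˡ (sym (×-comm-* j (e j) _)))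

-- The differential equation of connected graphs

module _ {R : CommutativeRing 0ℓ 0ℓ} (fi : InverseFactorials R) where
  open CommutativeRing R

  -- `P` stands for (1+q) D_q. Its value on `q` gives P((1+q)^n) = n q (1+q)^n, and nothing else
  -- about `P` is assumed beyond being a derivation.
  module ConnectedGraphs (q : Carrier)
    {P : Carrier → Carrier} (dP : Derivations.IsDerivation R P) (Pq : P q ≈ q * (1# + q)) where
    open Bivariate R
    open BivariateExponential fi
    open InverseFactorials fi
    open Sums R
    open GraphPolynomials.GraphSums R
    open import Algebra.Properties.Semiring.Mult semiring using (×-comm-*; ×-assoc-*; ×-congʳ; ×-assocˡ; ×-congˡ) renaming (_×_ to _·_)
    open import Algebra.Properties.Semiring.Exp semiring using (_^_; ^-assocʳ)
    open import Relation.Binary.Reasoning.Setoid setoid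
    private module dP = Derivations.IsDerivation dP

    -- The empty graph is connected, but does not count as a component.
    component : ℕ → ℕ → Carrier
    component zero zero    = 0#
    component zero (suc s) = connectedSum q 0 (suc s)
    component (suc r) s    = connectedSum q (suc r) s

    private
      -- The two sides could differ only for the null graph, where the multiplier is zero; so an
      -- Euler operator does not notice the convention.
      ×-component₁ : ∀ r s → r · component r s ≈ r · connectedSum q r s
      ×-component₁ zero    s = refl
      ×-component₁ (suc r) s = refl

      ×-component₂ : ∀ r s → s · component r s ≈ s · connectedSum q r s
      ×-component₂ zero    zero    = refl
      ×-component₂ zero    (suc s) = refl
      ×-component₂ (suc r) s       = refl

    C G : Series₂
    C = egf₂ component
    G = egf₂ (graphSum q)

    XG : X G R₂.≈ G R₂.* X C
    XG i j = begin
      X G i j                                          ≈⟨ X-egf₂ (graphSum q) i j ⟩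
      e i * (e j * (i · graphSum q i j))               ≈⟨ *-congˡ (*-congˡ (graphSum-left q i j)) ⟩
      _ ≈⟨ *-congˡ (*-congˡ (Σ-cong (subsets i) (λ M → Σ-cong (subsets j) (λ N →
             trans (sym (×-assoc-* (∣ M ∣) _ _)) (*-congʳ (sym (×-component₁ (∣ M ∣) (∣ N ∣)))))))) ⟩
      _                                                ≈⟨ egf₂-* (λ i j → i · component i j) (graphSum q) i j ⟨
      (egf₂ (λ i j → i · component i j) R₂.* G) i j    ≈⟨ R₂.*-congʳ {G} (X-egf₂ component) i j ⟨
      (X C R₂.* G) i j                                 ≈⟨ R₂.*-comm (X C) G i j ⟩
      (G R₂.* X C) i j                                 ∎

    YG : Y G R₂.≈ G R₂.* Y C
    YG i j = begin
      Y G i j                                          ≈⟨ Y-egf₂ (graphSum q) i j ⟩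
      e i * (e j * (j · graphSum q i j))               ≈⟨ *-congˡ (*-congˡ (graphSum-right q i j)) ⟩
      _ ≈⟨ *-congˡ (*-congˡ (Σ-cong (subsets i) (λ M → Σ-cong (subsets j) (λ N →
             trans (sym (×-assoc-* (∣ N ∣) _ _)) (*-congʳ (sym (×-component₂ (∣ M ∣) (∣ N ∣)))))))) ⟩
      _                                                ≈⟨ egf₂-* (λ i j → j · component i j) (graphSum q) i j ⟨
      (egf₂ (λ i j → j · component i j) R₂.* G) i j    ≈⟨ R₂.*-congʳ {G} (Y-egf₂ component) i j ⟨
      (Y C R₂.* G) i j                                 ≈⟨ R₂.*-comm (Y C) G i j ⟩
      (G R₂.* Y C) i j                                 ∎

    private
      -- In an abstract ring `e n` is not visibly a rational constant; it is killed because `suc n`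
      -- times it is the previous one and `suc n` can be cancelled.
      P-e : ∀ n → P (e n) ≈ 0#
      P-e zero    = trans (dP.cong e-zero) dP.1#-homo
      P-e (suc n) = ×-cancel n (begin
        suc n · P (e (suc n))   ≈⟨ P₁.×-homo dP (suc n) (e (suc n)) ⟨
        P (suc n · e (suc n))   ≈⟨ dP.cong (e-suc n) ⟩
        P (e n)                 ≈⟨ P-e n ⟩
        0#                      ≈⟨ ×-zeroʳ R (suc n) ⟨
        suc n · 0#              ∎)

      P-constant : ∀ {a} → P a ≈ 0# → ∀ x → P (a * x) ≈ a * P x
      P-constant Pa x = trans (dP.leibniz _ _) (trans (+-congʳ (trans (*-congʳ Pa) (zeroˡ _))) (+-identityˡ _))

      P-power : ∀ n → P ((1# + q) ^ n) ≈ n · (q * (1# + q) ^ n)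
      P-power zero    = dP.1#-homo
      P-power (suc n) = begin
        P ((1# + q) * (1# + q) ^ n)                                   ≈⟨ dP.leibniz _ _ ⟩
        P (1# + q) * (1# + q) ^ n + (1# + q) * P ((1# + q) ^ n)
          ≈⟨ +-cong (*-congʳ (trans (dP.+-homo _ _) (trans (+-cong dP.1#-homo Pq) (+-identityˡ _)))) (*-congˡ (P-power n)) ⟩
        q * (1# + q) * (1# + q) ^ n + (1# + q) * (n · (q * (1# + q) ^ n))
          ≈⟨ +-cong (*-assoc _ _ _) (×-comm-* n (1# + q) _) ⟩
        q * (1# + q) ^ suc n + n · ((1# + q) * (q * (1# + q) ^ n))
          ≈⟨ +-congˡ (×-congʳ n (trans (sym (*-assoc _ _ _)) (trans (*-congʳ (*-comm _ _)) (*-assoc _ _ _)))) ⟩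
        suc n · (q * (1# + q) ^ suc n)                                ∎

      P-graphSum : ∀ r s → P (graphSum q r s) ≈ r · (s · (q * graphSum q r s))
      P-graphSum r s = begin
        P (graphSum q r s)                        ≈⟨ dP.cong power ⟩
        P ((1# + q) ^ (s ℕ.* r))                  ≈⟨ P-power (s ℕ.* r) ⟩
        (s ℕ.* r) · (q * (1# + q) ^ (s ℕ.* r))    ≈⟨ ×-congʳ (s ℕ.* r) (*-congˡ power) ⟨
        (s ℕ.* r) · (q * graphSum q r s)          ≈⟨ ×-congˡ (ℕ.*-comm s r) ⟩
        (r ℕ.* s) · (q * graphSum q r s)          ≈⟨ ×-assocˡ _ r s ⟨
        r · (s · (q * graphSum q r s))            ∎
        where
        power : graphSum q r s ≈ (1# + q) ^ (s ℕ.* r)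
        power = trans (Σ-^#edges q r s) (^-assocʳ (1# + q) s r)

    -- The logarithmic derivative of `G` along `P`, read off from X Y G = G (X Y C + X C · Y C).
    z : Series₂
    z = const₂ q R₂.* (X (Y C) R₂.+ X C R₂.* Y C)

    private
      PG : lift₂ P G R₂.≈ G R₂.* z
      PG = R₂.trans step (R₂.trans (R₂.*-congˡ {const₂ q} XYG) rearrange)
        where
        -- The exponent rs of 1 + q, brought down by `P`, is what `X` and `Y` together multiply by.
        step : lift₂ P G R₂.≈ const₂ q R₂.* X (Y G)
        step i j = begin
          P (e i * (e j * graphSum q i j))                   ≈⟨ trans (P-constant (P-e i) _) (*-congˡ (P-constant (P-e j) _)) ⟩
          e i * (e j * P (graphSum q i j))                   ≈⟨ *-congˡ (*-congˡ (P-graphSum i j)) ⟩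
          e i * (e j * (i · (j · (q * graphSum q i j))))
            ≈⟨ *-congˡ (*-congˡ (×-congʳ i (trans (sym (×-comm-* j q _)) refl))) ⟩
          e i * (e j * (i · (q * (j · graphSum q i j))))     ≈⟨ *-congˡ (*-congˡ (×-comm-* i q _)) ⟨
          e i * (e j * (q * (i · (j · graphSum q i j))))     ≈⟨ pull-q (e i) (e j) _ ⟩
          q * (e i * (e j * (i · (j · graphSum q i j))))     ≈⟨ *-congˡ (trans (X-cong i j) (X-egf₂ (λ i j → j · graphSum q i j) i j)) ⟨
          q * X (Y G) i j                                    ≈⟨ const₂-* q (X (Y G)) i j ⟨
          (const₂ q R₂.* X (Y G)) i j                        ∎
          where
          open IntegerSolver R using (solve; _:*_; _:=_)
          pull-q : ∀ a b x → a * (b * (q * x)) ≈ q * (a * (b * x))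
          pull-q a b x = solve 4 (λ a b q x → a :* (b :* (q :* x)) := q :* (a :* (b :* x))) refl a b q x
          X-cong : X (Y G) R₂.≈ X (egf₂ (λ i j → j · graphSum q i j))
          X-cong = Derivations.IsDerivation.cong X-isDerivation (Y-egf₂ (graphSum q))
        XYG : X (Y G) R₂.≈ G R₂.* (X (Y C)) R₂.+ G R₂.* X C R₂.* Y C
        XYG = R₂.trans (X.cong YG) (R₂.trans (X.leibniz G (Y C)) (R₂.trans (R₂.+-congʳ (R₂.*-congʳ {Y C} XG)) (R₂.+-comm _ _)))
          where module X = Derivations.IsDerivation X-isDerivation
        rearrange : const₂ q R₂.* (G R₂.* (X (Y C)) R₂.+ G R₂.* X C R₂.* Y C) R₂.≈ G R₂.* z
        rearrange = solve 5 (λ q g a b c → q :* (g :* a :+ g :* b :* c) := g :* (q :* (a :+ b :* c))) (λ _ _ → refl) (const₂ q) G (X (Y C)) (X C) (Y C)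
          where open IntegerSolver P₂.seriesRing using (solve; _:*_; _:+_; _:=_)

      G-regular : Derivations.Regular P₂.seriesRing G
      G-regular {t} = P₂.regular {G} (λ {y} → P₁.regular {G 0} (λ {x} eq → begin
        x                  ≈⟨ *-identityˡ x ⟨
        1# * x             ≈⟨ *-congʳ G₀₀ ⟨
        G 0 0 * x          ≈⟨ eq ⟩
        0#                 ∎) {y}) {t}
        where
        G₀₀ : G 0 0 ≈ 1#
        G₀₀ = trans (*-cong e-zero (trans (*-cong e-zero (+-identityʳ 1#)) (*-identityˡ 1#))) (*-identityˡ 1#)

    -- Logarithmic differentiation yields the equation only after `X` or `Y` has been applied. A
    -- coefficient with i > 0 is recovered from the former by dividing by i, one with i = 0 and j >
    -- 0 from the latter; the constant terms are both zero.
    connected-equation : lift₂ P C R₂.≈ z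
    connected-equation zero zero = trans (trans (dP.cong C₀₀) dP.0#-homo) (sym (begin
      z 0 0                                                   ≈⟨ const₂-* q (X (Y C) R₂.+ X C R₂.* Y C) 0 0 ⟩
      q * (0# + 0# * Y C 0 0)                                 ≈⟨ *-congˡ (trans (+-identityˡ _) (zeroˡ _)) ⟩
      q * 0#                                                  ≈⟨ zeroʳ q ⟩
      0#                                                      ∎))
      where
      C₀₀ : C 0 0 ≈ 0#
      C₀₀ = trans (*-congˡ (zeroʳ _)) (zeroʳ _)
    connected-equation i@(suc i′) j = ×-cancel i′ (begin
      suc i′ · lift₂ P C i j        ≈⟨ reflexive (X-coefficient (lift₂ P C) i j) ⟨
      X (lift₂ P C) i j             ≈⟨ log-derivation X-isDerivation (lift₂-isDerivation dP) (X-lift₂ dP) {z = z} (λ {t} → G-regular {t}) XG PG i j ⟩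
      X z i j                       ≈⟨ reflexive (X-coefficient z i j) ⟩
      suc i′ · z i j                ∎)
      where open Derivations P₂.seriesRing using (log-derivation)
    connected-equation zero j@(suc j′) = ×-cancel j′
      (log-derivation Y-isDerivation (lift₂-isDerivation dP) (Y-lift₂ dP) {z = z} (λ {t} → G-regular {t}) YG PG 0 j)
      where open Derivations P₂.seriesRing using (log-derivation)

-- Comparing products of series over two rings

module Comparison (R R′ : CommutativeRing 0ℓ 0ℓ) where
  private
    module R = CommutativeRing R
    module R′ = CommutativeRing R′
    module P = PowerSeries R
    module P′ = PowerSeries R′

  -- The relation may depend on the target index `n`, so it is asked only of products whose indices
  -- add up to `n`.
  ⊗-related : (_∼_ : R.Carrier → R′.Carrier → Set) →
    (∀ {x y x′ y′} → x ∼ x′ → y ∼ y′ → (x R.+ y) ∼ (x′ R′.+ y′)) →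
    ∀ f g f′ g′ n → (∀ a b → a ℕ.+ b ≡ n → (f a R.* g b) ∼ (f′ a R′.* g′ b)) → (f P.⊗ g) n ∼ (f′ P′.⊗ g′) n
  ⊗-related _∼_ add f g f′ g′ zero    rel = rel 0 0 ≡.refl
  ⊗-related _∼_ add f g f′ g′ (suc n) rel = add (rel 0 (suc n) ≡.refl)
    (⊗-related _∼_ add (f ∘ suc) g (f′ ∘ suc) g′ n (λ a b eq → rel (suc a) b (≡.cong suc eq)))

  -- Modelled on the coefficients of q^0 and q^1, for which the second is a derivation along the
  -- first.
  ⊗-leibniz : (φ₀ φ₁ : R.Carrier → R′.Carrier) → (∀ x y → φ₁ (x R.+ y) R′.≈ φ₁ x R′.+ φ₁ y) →
    (∀ x y → φ₁ (x R.* y) R′.≈ φ₀ x R′.* φ₁ y R′.+ φ₁ x R′.* φ₀ y) →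
    ∀ f g n → φ₁ ((f P.⊗ g) n) R′.≈ ((φ₀ ∘ f) P′.⊗ (φ₁ ∘ g)) n R′.+ ((φ₁ ∘ f) P′.⊗ (φ₀ ∘ g)) n
  ⊗-leibniz φ₀ φ₁ +-homo leibniz f g zero    = leibniz _ _
  ⊗-leibniz φ₀ φ₁ +-homo leibniz f g (suc n) = R′.trans (+-homo _ _)
    (R′.trans (R′.+-cong (leibniz _ _) (⊗-leibniz φ₀ φ₁ +-homo leibniz (f ∘ suc) g n))
      (solve 4 (λ a b c d → (a :+ b) :+ (c :+ d) := (a :+ c) :+ (b :+ d)) R′.refl _ _ _ _))
    where open IntegerSolver R′ using (solve; _:+_; _:=_)

-- From the number of edges to the Betti number

module EdgeGrading where
  open import Data.Integer.Base using (+_)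
  open Graphs
  open GraphPolynomials

  Q : CommutativeRing 0ℓ 0ℓ
  Q = ℚ.+-*-commutativeRing

  module Pq = PowerSeries Q

  Rq : CommutativeRing 0ℓ 0ℓ
  Rq = Pq.seriesRing

  open CommutativeRing Rq hiding (zero)
  open import Algebra.Properties.Semiring.Mult (CommutativeRing.semiring Q) using () renaming (_×_ to _·_)
  open import Algebra.Properties.Semiring.Exp semiring using (_^_)

  q : Carrier
  q = Pq.shift 1#

  q-* : ∀ f → q * f ≈ Pq.shift f
  q-* f = trans (Pq.shift-⊗ 1# f) (Pq.shift-cong (*-identityˡ f))

  P : Carrier → Carrier
  P f = (1# + q) * Pq.euler f

  P-isDerivation : Derivations.IsDerivation Rq P
  P-isDerivation = Derivations.scale-isDerivation Rq (1# + q) Pq.euler-isDerivation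

  euler-q : Pq.euler q ≈ q
  euler-q zero          = ≡.refl
  euler-q (suc zero)    = ≡.refl
  euler-q (suc (suc n)) = ×-zeroʳ Q (suc (suc n))

  P-q : P q ≈ q * (1# + q)
  P-q = trans (*-congˡ {1# + q} euler-q) (*-comm (1# + q) q)

  open ConnectedGraphs (Exponential.series-inverseFactorials Rationals.rationalFactorials) q P-isDerivation P-q
  open GraphSums Rq using (connectedSum; ind)
  open Sums Rq using (Σ[_])
  open Bivariate Rq hiding (module R)

  count : ∀ r s → ℕ → ℕ
  count r s m = length (filter (λ G → connected? G ×-dec (#edges G ℕ.≟ m)) (allGraphs r s))

  ^-coefficient : ∀ n → (q ^ n) n ≡ 1ℚ
  ^-coefficient zero    = ≡.refl
  ^-coefficient (suc n) = ≡.trans (q-* (q ^ n) (suc n)) (^-coefficient n)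

  ^-coefficient-≢ : ∀ n m → ¬ n ≡ m → (q ^ n) m ≡ 0ℚ
  ^-coefficient-≢ zero    zero    n≢m = ⊥-elim (n≢m ≡.refl)
  ^-coefficient-≢ zero    (suc m) n≢m = ≡.refl
  ^-coefficient-≢ (suc n) zero    n≢m = q-* (q ^ n) 0
  ^-coefficient-≢ (suc n) (suc m) n≢m = ≡.trans (q-* (q ^ n) (suc m)) (^-coefficient-≢ n m (n≢m ∘ ≡.cong suc))

  connectedSum-coefficient : ∀ r s m → connectedSum q r s m ≡ count r s m · 1ℚ
  connectedSum-coefficient r s m = go (allGraphs r s)
    where
    P? : (G : Graph r s) → Dec (Connected G × #edges G ≡ m)
    P? G = connected? G ×-dec (#edges G ℕ.≟ m)
    term : Graph r s → Carrier
    term G = ind (connected? G) * q ^ #edges G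
    ind-*-zero : ∀ {A : Set} (p : Dec A) f → f m ≡ 0ℚ → (ind p * f) m ≡ 0ℚ
    ind-*-zero (yes _) f eq = ≡.trans (*-identityˡ f m) eq
    ind-*-zero (no _)  f eq = zeroˡ f m
    accepted : ∀ G → Connected G × #edges G ≡ m → term G m ≡ 1ℚ
    accepted G (c , ≡.refl) = ≡.trans (*-congʳ {q ^ m} (GraphSums.ind-yes Rq (connected? G) c) m)
      (≡.trans (*-identityˡ (q ^ m) m) (^-coefficient m))
    rejected : ∀ G → ¬ (Connected G × #edges G ≡ m) → term G m ≡ 0ℚ
    rejected G ¬p with #edges G ℕ.≟ m
    ... | no  n≢m = ind-*-zero (connected? G) (q ^ #edges G) (^-coefficient-≢ (#edges G) m n≢m)
    ... | yes n≡m = ≡.trans (*-congʳ {q ^ #edges G} (GraphSums.ind-no Rq (connected? G) (λ c → ¬p (c , n≡m))) m) (zeroˡ (q ^ #edges G) m)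
    go : ∀ Gs → Σ[ Gs ] term m ≡ length (filter P? Gs) · 1ℚ
    go []       = ≡.refl
    go (G ∷ Gs) = step (P? G)
      where
      open ≡.≡-Reasoning
      rest : ℚ
      rest = length (filter P? Gs) · 1ℚ
      step : Dec (Connected G × #edges G ≡ m) → term G m ℚ.+ Σ[ Gs ] term m ≡ length (filter P? (G ∷ Gs)) · 1ℚ
      step (yes p) = begin
        term G m ℚ.+ Σ[ Gs ] term m            ≡⟨ ≡.cong₂ ℚ._+_ {term G m} {1ℚ} {Σ[ Gs ] term m} {rest} (accepted G p) (go Gs) ⟩
        1ℚ ℚ.+ rest                            ≡⟨ ≡.cong (λ xs → length xs · 1ℚ) (List.filter-accept P? {G} {Gs} p) ⟨
        length (filter P? (G ∷ Gs)) · 1ℚ       ∎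
      step (no ¬p) = begin
        term G m ℚ.+ Σ[ Gs ] term m            ≡⟨ ≡.cong₂ ℚ._+_ {term G m} {0ℚ} {Σ[ Gs ] term m} {rest} (rejected G ¬p) (go Gs) ⟩
        0ℚ ℚ.+ rest                            ≡⟨ ℚ.+-identityˡ rest ⟩
        rest                                   ≡⟨ ≡.cong (λ xs → length xs · 1ℚ) (List.filter-reject P? {G} {Gs} ¬p) ⟨
        length (filter P? (G ∷ Gs)) · 1ℚ       ∎

  -- The case of zero edges, which starts the induction of `vanishes≤`, and also the reason why one
  -- empty side leaves only the single vertex.
  edgeless⇒disconnected : ∀ {r s} (G : Graph r s) → 2 ℕ.≤ r ℕ.+ s → #edges G ≡ 0 → ¬ Connected G
  edgeless⇒disconnected {r} {s} G 2≤ eq c = distinct r s 2≤ (λ u v → only-reflexive (c u v))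
    where
    no-edge : ∀ u v → ¬ Adj G u v
    no-edge (inj₁ i) (inj₂ j) e = #edges≡0⇒edgeless G eq i j (Vec.[]=⇒lookup e)
    no-edge (inj₂ j) (inj₁ i) e = #edges≡0⇒edgeless G eq i j (Vec.[]=⇒lookup e)
    only-reflexive : ∀ {u v} → Star (Adj G) u v → u ≡ v
    only-reflexive ε       = ≡.refl
    only-reflexive {u} (_◅_ {j = v} e _) = ⊥-elim (no-edge u v e)
    distinct : ∀ r s → 2 ℕ.≤ r ℕ.+ s → ¬ (∀ (u v : Fin r ⊎ Fin s) → u ≡ v)
    distinct zero          (suc (suc s)) _ same with () ← same (inj₂ zero) (inj₂ (suc zero))
    distinct (suc (suc r)) s             _ same with () ← same (inj₁ zero) (inj₁ (suc zero))
    distinct (suc r)       (suc s)       _ same with () ← same (inj₁ zero) (inj₂ zero)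
    distinct zero          (suc zero)    (s≤s ())
    distinct (suc zero)    zero          (s≤s ())

  count-edgeless : ∀ r s m → 2 ℕ.≤ r ℕ.+ s → (∀ (G : Graph r s) → #edges G ≡ m → #edges G ≡ 0) → count r s m ≡ 0
  count-edgeless r s m 2≤ none = ≡.cong length (List.filter-none (λ G → connected? G ×-dec (#edges G ℕ.≟ m)) {allGraphs r s} (All.tabulate
    (λ {G} _ (c , eq) → edgeless⇒disconnected G 2≤ (none G eq) c)))

  #edges-null : ∀ {r} (G : Graph r 0) → #edges G ≡ 0
  #edges-null []       = ≡.refl
  #edges-null ([] ∷ G) = #edges-null G

  -- The hypothesis says m = r + s + k - 1 without truncated subtraction. At (0, 0) it is the zero
  -- put into `component` that matches `Nbi`.
  component-Nbi : ∀ r s k m → suc m ≡ r ℕ.+ s ℕ.+ k → component r s m ≡ Nbi r s (+ k) · 1ℚ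
  component-Nbi zero zero k m eq = ≡.refl
  component-Nbi (suc zero) zero zero    .zero    ≡.refl = ≡.refl
  component-Nbi (suc zero) zero (suc k) .(suc k) ≡.refl = connectedSum-coefficient 1 0 (suc k)
  component-Nbi (suc (suc r)) zero k m eq = ≡.trans (connectedSum-coefficient (suc (suc r)) 0 m)
    (≡.cong (_· 1ℚ) (count-edgeless (suc (suc r)) 0 m (s≤s (s≤s z≤n)) (λ G _ → #edges-null G)))
  component-Nbi zero (suc zero) zero    .zero    ≡.refl = ≡.refl
  component-Nbi zero (suc zero) (suc k) .(suc k) ≡.refl = connectedSum-coefficient 0 1 (suc k)
  component-Nbi zero (suc (suc s)) k m eq = ≡.trans (connectedSum-coefficient 0 (suc (suc s)) m)
    (≡.cong (_· 1ℚ) (count-edgeless 0 (suc (suc s)) m (s≤s (s≤s z≤n)) (λ { [] _ → ≡.refl })))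
  component-Nbi r@(suc _) s@(suc _) k m eq = ≡.trans (connectedSum-coefficient r s m)
    (≡.cong (λ xs → length xs · 1ℚ) (List.filter-≐ _ _
      ((λ { (c , n≡m) → c , ≡.trans (≡.cong +_ n≡m) edges≡ }) , (λ { (c , eq′) → c , ℤ.+-injective (≡.trans eq′ (≡.sym edges≡)) })) (allGraphs r s)))
    where
    edges≡ : + m ≡ + r ℤ.+ + s ℤ.+ + k ℤ.- ℤ.1ℤ
    edges≡ = ≡.cong (λ n → + n ℤ.- ℤ.1ℤ) eq

  C-coefficient : ∀ i j m → C i j m ≡ Rationals.1/ i ! ℚ.* (Rationals.1/ j ! ℚ.* component i j m)
  C-coefficient i j m = ≡.trans (Pq.const-⊗ _ _ m) (≡.cong (Rationals.1/ i ! ℚ.*_) (Pq.const-⊗ _ (component i j) m))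

  -- The sum of F_k q^k over all k, with q now marking the Betti number.
  Φ : Series₂
  Φ i j k = F k i j

  C≡Φ : ∀ i j k m → suc m ≡ i ℕ.+ j ℕ.+ k → C i j m ≡ Φ i j k
  C≡Φ i j k m eq = ≡.trans (C-coefficient i j m) (≡.trans (≡.cong (λ x → Rationals.1/ i ! ℚ.* (Rationals.1/ j ! ℚ.* x)) (component-Nbi i j k m eq))
    (≡.sym (Rationals./!*! (Nbi i j (+ k)) i j)))

  P-coefficient : ∀ f m → P f (suc m) ≡ suc m · f (suc m) ℚ.+ m · f m
  P-coefficient f m = ≡.trans (distribʳ (Pq.euler f) 1# q (suc m))
    (≡.cong₂ ℚ._+_ (*-identityˡ (Pq.euler f) (suc m)) (q-* (Pq.euler f) (suc m)))

  connected-coefficient : ∀ i j m →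
    suc m · C i j (suc m) ℚ.+ m · C i j m ≡ i · (j · C i j m) ℚ.+ (X C R₂.* Y C) i j m
  connected-coefficient i j m = begin
    suc m · C i j (suc m) ℚ.+ m · C i j m          ≡⟨ P-coefficient (C i j) m ⟨
    P (C i j) (suc m)                              ≡⟨ connected-equation i j (suc m) ⟩
    z i j (suc m)                                  ≡⟨ const₂-* q (X (Y C) R₂.+ X C R₂.* Y C) i j (suc m) ⟩
    (q * (X (Y C) R₂.+ X C R₂.* Y C) i j) (suc m)  ≡⟨ q-* ((X (Y C) R₂.+ X C R₂.* Y C) i j) (suc m) ⟩
    X (Y C) i j m ℚ.+ (X C R₂.* Y C) i j m         ≡⟨ ≡.cong (ℚ._+ (X C R₂.* Y C) i j m) XYC ⟩
    i · (j · C i j m) ℚ.+ (X C R₂.* Y C) i j m     ∎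
    where
    open ≡.≡-Reasoning
    XYC : X (Y C) i j m ≡ i · (j · C i j m)
    XYC = ≡.trans (≡.cong (λ f → f m) (X-coefficient (Y C) i j))
      (≡.trans (Pq.×-coefficient i (Y C i j) m) (≡.cong (i ·_) (Pq.×-coefficient j (C i j) m)))

  +-zero : ∀ {x y} → x ≡ 0ℚ → y ≡ 0ℚ → x ℚ.+ y ≡ 0ℚ
  +-zero ≡.refl ≡.refl = ≡.refl

  module _ where
    private
      Vanishes : ℕ → Set
      Vanishes m = ∀ i j → suc m ℕ.< i ℕ.+ j → C i j m ≡ 0ℚ

      -- If neither factor were known to vanish, the vertex numbers would satisfy (a + b) + (a′ +
      -- b′) ≤ (k + 1) + (k′ + 1) = m + 2.
      product-vanishes : ∀ m → (∀ k → k ℕ.≤ m → Vanishes k) → ∀ i j → suc (suc m) ℕ.< i ℕ.+ j → (X C R₂.* Y C) i j m ≡ 0ℚ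
      product-vanishes m hyp i j lt =
        PowerSeries.⊗-closed Pq₁ (λ f → f j m ≡ 0ℚ) +-zero (X C) (Y C) i λ a a′ a+a′ →
        PowerSeries.⊗-closed Rq (λ f → f m ≡ 0ℚ) +-zero (X C a) (Y C a′) j λ b b′ b+b′ →
        Pq.⊗-closed (_≡ 0ℚ) +-zero (X C a b) (Y C a′ b′) m λ k k′ k+k′ → term a a′ b b′ k k′ a+a′ b+b′ k+k′
        where
        Pq₁ = PowerSeries.seriesRing Rq
        term : ∀ a a′ b b′ k k′ → a ℕ.+ a′ ≡ i → b ℕ.+ b′ ≡ j → k ℕ.+ k′ ≡ m → X C a b k ℚ.* Y C a′ b′ k′ ≡ 0ℚ
        term a a′ b b′ k k′ ≡.refl ≡.refl ≡.refl with suc k ℕ.<? a ℕ.+ b | suc k′ ℕ.<? a′ ℕ.+ b′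
        ... | yes lt₁ | _ = ≡.trans (≡.cong (ℚ._* _) (≡.trans (≡.trans (≡.cong (λ f → f k) (X-coefficient C a b)) (Pq.×-coefficient a (C a b) k))
          (≡.trans (≡.cong (a ·_) (hyp k (ℕ.m≤m+n k k′) a b lt₁)) (×-zeroʳ Q a)))) (ℚ.*-zeroˡ (Y C a′ b′ k′))
        ... | no _ | yes lt₂ = ≡.trans (≡.cong (X C a b k ℚ.*_) (≡.trans (Pq.×-coefficient b′ (C a′ b′) k′)
          (≡.trans (≡.cong (b′ ·_) (hyp k′ (ℕ.m≤n+m k′ k) a′ b′ lt₂)) (×-zeroʳ Q b′)))) (ℚ.*-zeroʳ (X C a b k))
        ... | no ge₁ | no ge₂ = ⊥-elim (ℕ.<⇒≱ lt (begin
          a ℕ.+ a′ ℕ.+ (b ℕ.+ b′)     ≡⟨ ℕ-interchange a a′ b b′ ⟩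
          (a ℕ.+ b) ℕ.+ (a′ ℕ.+ b′)   ≤⟨ ℕ.+-mono-≤ (ℕ.≮⇒≥ ge₁) (ℕ.≮⇒≥ ge₂) ⟩
          suc k ℕ.+ suc k′            ≡⟨ ≡.cong suc (ℕ.+-suc k k′) ⟩
          suc (suc (k ℕ.+ k′))        ∎))
          where
          open ℕ.≤-Reasoning
          open import Algebra.Properties.CommutativeSemigroup ℕ.+-commutativeSemigroup using () renaming (interchange to ℕ-interchange)

      -- With too few edges every term on the right of `connected-coefficient` vanishes by
      -- induction, so the coefficient with one more edge does too. The bound `m` turns strong
      -- induction on `k` into structural recursion.
      vanishes≤ : ∀ m k → k ℕ.≤ m → Vanishes k
      vanishes≤ m zero k≤m i j lt = ≡.trans (C-coefficient i j 0)
        (≡.trans (≡.cong (λ x → Rationals.1/ i ! ℚ.* (Rationals.1/ j ! ℚ.* x)) (component-zero i j lt))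
        (≡.trans (≡.cong (Rationals.1/ i ! ℚ.*_) (ℚ.*-zeroʳ (Rationals.1/ j !))) (ℚ.*-zeroʳ (Rationals.1/ i !))))
        where
        component-zero : ∀ i j → 1 ℕ.< i ℕ.+ j → component i j 0 ≡ 0ℚ
        component-zero zero    (suc j) lt = ≡.trans (connectedSum-coefficient 0 (suc j) 0) (≡.cong (_· 1ℚ) (count-edgeless 0 (suc j) 0 lt (λ G eq → eq)))
        component-zero (suc i) j       lt = ≡.trans (connectedSum-coefficient (suc i) j 0) (≡.cong (_· 1ℚ) (count-edgeless (suc i) j 0 lt (λ G eq → eq)))
      vanishes≤ (suc m) (suc k) (s≤s k≤m) i j lt = Rationals.×-cancel (suc k) (begin
        suc k · C i j (suc k)                                     ≡⟨ ℚ.+-identityʳ _ ⟨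
        suc k · C i j (suc k) ℚ.+ 0ℚ                              ≡⟨ ≡.cong (suc k · C i j (suc k) ℚ.+_) (times-zero k) ⟨
        suc k · C i j (suc k) ℚ.+ k · C i j k                     ≡⟨ connected-coefficient i j k ⟩
        i · (j · C i j k) ℚ.+ (X C R₂.* Y C) i j k
          ≡⟨ +-zero (≡.trans (≡.cong (i ·_) (times-zero j)) (×-zeroʳ Q i))
                      (product-vanishes k (λ k′ k′≤k → vanishes≤ m k′ (ℕ.≤-trans k′≤k k≤m)) i j lt) ⟩
        0ℚ                                                        ≡⟨ ×-zeroʳ Q (suc k) ⟨
        suc k · 0ℚ                                                ∎)
        where
        open ≡.≡-Reasoning
        times-zero : ∀ n → n · C i j k ≡ 0ℚ
        times-zero n = ≡.trans (≡.cong (n ·_) (vanishes≤ m k k≤m i j (ℕ.<-trans (ℕ.n<1+n _) lt))) (×-zeroʳ Q n)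

    C-vanishes : ∀ m i j → suc m ℕ.< i ℕ.+ j → C i j m ≡ 0ℚ
    C-vanishes m = vanishes≤ m m ℕ.≤-refl

  q^-factor : ∀ n f g → (∀ m → m ℕ.< n → f m ≡ 0ℚ) → (∀ k → f (n ℕ.+ k) ≡ g k) → f ≈ q ^ n * g
  q^-factor zero    f g van eq = trans eq (sym (*-identityˡ g))
  q^-factor (suc n) f g van eq = trans shifted (trans (sym (q-* (q ^ n * g))) (sym (*-assoc q (q ^ n) g)))
    where
    shifted : f ≈ Pq.shift (q ^ n * g)
    shifted zero    = van 0 (s≤s z≤n)
    shifted (suc m) = q^-factor n (f ∘ suc) g (λ m lt → van (suc m) (s≤s lt)) eq m

  -- q·C(x,y,q) = Φ(qx,qy,q), since a connected graph on i + j vertices with Betti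
  -- number k has i + j + k - 1 edges.
  qC : ∀ i j → q * C i j ≈ q ^ (i ℕ.+ j) * Φ i j
  qC i j = q^-factor (i ℕ.+ j) (q * C i j) (Φ i j)
    (λ { zero lt → q-* (C i j) 0 ; (suc m) lt → ≡.trans (q-* (C i j) (suc m)) (C-vanishes m i j lt) })
    (λ k → shift-C k (i ℕ.+ j ℕ.+ k) ≡.refl)
    where
    shift-C : ∀ k m → m ≡ i ℕ.+ j ℕ.+ k → (q * C i j) m ≡ Φ i j k
    shift-C k (suc m) eq = ≡.trans (q-* (C i j) (suc m)) (C≡Φ i j k m eq)
    -- Here all of `i`, `j`, `k` are zero, and both sides are zero because the null graph is not
    -- counted.
    shift-C k zero    eq with ≡.refl ← ℕ.m+n≡0⇒m≡0 i (ℕ.m+n≡0⇒m≡0 (i ℕ.+ j) (≡.sym eq)) | ≡.refl ← ℕ.m+n≡0⇒n≡0 i (ℕ.m+n≡0⇒m≡0 (i ℕ.+ j) (≡.sym eq)) | ≡.refl ← eq = q-* (C 0 0) 0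

-- The equations for Betti numbers zero and one

module BettiNumbers where
  open EdgeGrading

  module S = Bivariate Q

  private
    module A = Bivariate Rq
    module CG = ConnectedGraphs (Exponential.series-inverseFactorials Rationals.rationalFactorials) q P-isDerivation P-q

  open CommutativeRing Rq hiding (zero)
  open import Algebra.Properties.Semiring.Mult (CommutativeRing.semiring Q) using (×-homo-+) renaming (_×_ to _·_)
  open import Algebra.Properties.Semiring.Mult semiring using (×-comm-*; ×-assoc-*; ×-congʳ) renaming (_×_ to _·₁_)
  open import Algebra.Properties.Semiring.Exp semiring using (_^_; ^-homo-*; ^-congʳ)
  open import Relation.Binary.Reasoning.Setoid setoid
  open IntegerSolver Rq using (solve; _:+_; _:*_; _:-_; _:=_; #1)

  -- Each of the two factors uses one q to become a series in Φ, and the exponents a + b and a′ + b′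
  -- add up to i + j.
  scaled-product : ∀ i j → q * (q * (A.X CG.C A.R₂.* A.Y CG.C) i j) ≈ q ^ (i ℕ.+ j) * (A.X Φ A.R₂.* A.Y Φ) i j
  scaled-product i j =
    Comparison.⊗-related Pq₁ Pq₁ (λ f g → f j ∼ g j) add (A.X CG.C) (A.Y CG.C) (A.X Φ) (A.Y Φ) i λ a a′ a+a′ →
    Comparison.⊗-related Rq Rq _∼_ add (A.X CG.C a) (A.Y CG.C a′) (A.X Φ a) (A.Y Φ a′) j λ b b′ b+b′ →
    term a a′ b b′ a+a′ b+b′
    where
    Pq₁ = PowerSeries.seriesRing Rq
    _∼_ : Carrier → Carrier → Set
    x ∼ y = q * (q * x) ≈ q ^ (i ℕ.+ j) * y
    add : ∀ {x y x′ y′} → x ∼ x′ → y ∼ y′ → (x + y) ∼ (x′ + y′)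
    add {x} {y} {x′} {y′} p p′ = trans (solve 3 (λ q x y → q :* (q :* (x :+ y)) := q :* (q :* x) :+ q :* (q :* y)) refl q x y)
      (trans (+-cong p p′) (sym (distribˡ (q ^ (i ℕ.+ j)) x′ y′)))
    XC : ∀ a b → q * A.X CG.C a b ≈ q ^ (a ℕ.+ b) * A.X Φ a b
    XC a b = begin
      q * A.X CG.C a b              ≈⟨ *-congˡ {q} (reflexive (A.X-coefficient CG.C a b)) ⟩
      q * (a ·₁ CG.C a b)           ≈⟨ ×-comm-* a q (CG.C a b) ⟩
      a ·₁ (q * CG.C a b)           ≈⟨ ×-congʳ a (qC a b) ⟩
      a ·₁ (q ^ (a ℕ.+ b) * Φ a b)  ≈⟨ ×-comm-* a (q ^ (a ℕ.+ b)) (Φ a b) ⟨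
      q ^ (a ℕ.+ b) * (a ·₁ Φ a b)  ≈⟨ *-congˡ {q ^ (a ℕ.+ b)} (reflexive (A.X-coefficient Φ a b)) ⟨
      q ^ (a ℕ.+ b) * A.X Φ a b     ∎
    YC : ∀ a b → q * A.Y CG.C a b ≈ q ^ (a ℕ.+ b) * A.Y Φ a b
    YC a b = begin
      q * (b ·₁ CG.C a b)           ≈⟨ ×-comm-* b q (CG.C a b) ⟩
      b ·₁ (q * CG.C a b)           ≈⟨ ×-congʳ b (qC a b) ⟩
      b ·₁ (q ^ (a ℕ.+ b) * Φ a b)  ≈⟨ ×-comm-* b (q ^ (a ℕ.+ b)) (Φ a b) ⟨
      q ^ (a ℕ.+ b) * (b ·₁ Φ a b)  ∎
    open import Algebra.Properties.CommutativeSemigroup ℕ.+-commutativeSemigroup using (interchange)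
    term : ∀ a a′ b b′ → a ℕ.+ a′ ≡ i → b ℕ.+ b′ ≡ j → (A.X CG.C a b * A.Y CG.C a′ b′) ∼ (A.X Φ a b * A.Y Φ a′ b′)
    term a a′ b b′ ≡.refl ≡.refl = begin
      q * (q * (x * y))                     ≈⟨ solve 3 (λ q x y → q :* (q :* (x :* y)) := (q :* x) :* (q :* y)) refl q x y ⟩
      (q * x) * (q * y)                     ≈⟨ *-cong {q * x} (XC a b) (YC a′ b′) ⟩
      (s * x′) * (t * y′)                   ≈⟨ solve 4 (λ s x t y → (s :* x) :* (t :* y) := (s :* t) :* (x :* y)) refl s x′ t y′ ⟩
      (s * t) * (x′ * y′)                   ≈⟨ *-congʳ {x′ * y′} (trans (sym (^-homo-* q (a ℕ.+ b) (a′ ℕ.+ b′))) (^-congʳ q (interchange a b a′ b′))) ⟩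
      q ^ (i ℕ.+ j) * (x′ * y′)             ∎
      where
      x = A.X CG.C a b
      y = A.Y CG.C a′ b′
      x′ = A.X Φ a b
      y′ = A.Y Φ a′ b′
      s = q ^ (a ℕ.+ b)
      t = q ^ (a′ ℕ.+ b′)

  q^-cancel : ∀ n {x y} → q ^ n * x ≈ q ^ n * y → x ≈ y
  q^-cancel zero    {x} {y} eq = trans (sym (*-identityˡ x)) (trans eq (*-identityˡ y))
  q^-cancel (suc n) {x} {y} eq = q^-cancel n (λ m → ≡.trans (≡.sym (assoc x m)) (≡.trans (eq (suc m)) (assoc y m)))
    where
    assoc : ∀ x m → (q ^ suc n * x) (suc m) ≡ (q ^ n * x) m
    assoc x m = ≡.trans (*-assoc q (q ^ n) x (suc m)) (q-* (q ^ n * x) (suc m))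

  euler-q^ : ∀ n → Pq.euler (q ^ n) ≈ n ·₁ (q ^ n)
  euler-q^ zero    = Derivations.IsDerivation.1#-homo Pq.euler-isDerivation
  euler-q^ (suc n) = begin
    Pq.euler (q * q ^ n)                      ≈⟨ Derivations.IsDerivation.leibniz Pq.euler-isDerivation q (q ^ n) ⟩
    Pq.euler q * q ^ n + q * Pq.euler (q ^ n) ≈⟨ +-cong (*-congʳ {q ^ n} euler-q) (*-congˡ {q} (euler-q^ n)) ⟩
    q * q ^ n + q * (n ·₁ (q ^ n))            ≈⟨ +-congˡ {q ^ suc n} (×-comm-* n q (q ^ n)) ⟩
    suc n ·₁ (q ^ suc n)                      ∎

  module _ (i j : ℕ) where
    private
      n = i ℕ.+ j
      c = CG.C i j
      φ = Φ i j
      qⁿ = q ^ n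
      D = Pq.euler
      ψ = n ·₁ φ + D φ

      open Derivations.IsDerivation Pq.euler-isDerivation using (leibniz) renaming (cong to D-cong)

      -- Since `ψ - φ` multiplies the coefficient of q^k by n + k - 1, the number of edges, it takes
      -- over the role of D_q after regrading. The term `- φ` comes from differentiating the extra
      -- factor q.
      qDc : q * D c ≈ qⁿ * (ψ - φ)
      qDc = begin
        q * D c                                 ≈⟨ solve 3 (λ q d c → q :* d := (q :* c :+ q :* d) :- q :* c) refl q (D c) c ⟩
        q * c + q * D c - q * c                 ≈⟨ +-congʳ { - (q * c)} (+-congʳ {q * D c} (*-congʳ {c} euler-q)) ⟨
        D q * c + q * D c - q * c               ≈⟨ +-congʳ { - (q * c)} (leibniz q c) ⟨
        D (q * c) - q * c                       ≈⟨ +-cong (D-cong (qC i j)) (-‿cong (qC i j)) ⟩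
        D (qⁿ * φ) - qⁿ * φ                     ≈⟨ +-congʳ { - (qⁿ * φ)} (trans (leibniz qⁿ φ) (+-congʳ {qⁿ * D φ} (trans (*-congʳ {φ} (euler-q^ n))
                                                     (trans (×-assoc-* n qⁿ φ) (sym (×-comm-* n qⁿ φ)))))) ⟩
        qⁿ * (n ·₁ φ) + qⁿ * D φ - qⁿ * φ       ≈⟨ solve 4 (λ q n d f → q :* n :+ q :* d :- q :* f := q :* ((n :+ d) :- f)) refl qⁿ (n ·₁ φ) (D φ) φ ⟩
        qⁿ * (ψ - φ)                            ∎

      qXYC : q * (i ·₁ (j ·₁ c)) ≈ qⁿ * (i ·₁ (j ·₁ φ))
      qXYC = begin
        q * (i ·₁ (j ·₁ c))      ≈⟨ ×-comm-* i q (j ·₁ c) ⟩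
        i ·₁ (q * (j ·₁ c))      ≈⟨ ×-congʳ i (×-comm-* j q c) ⟩
        i ·₁ (j ·₁ (q * c))      ≈⟨ ×-congʳ i (×-congʳ j (qC i j)) ⟩
        i ·₁ (j ·₁ (qⁿ * φ))     ≈⟨ ×-congʳ i (×-comm-* j qⁿ φ) ⟨
        i ·₁ (qⁿ * (j ·₁ φ))     ≈⟨ ×-comm-* i qⁿ (j ·₁ φ) ⟨
        qⁿ * (i ·₁ (j ·₁ φ))     ∎

    -- The differential equation of C multiplied by q: every term then carries q^n, which cancels.
    -- Its coefficients at q^0 and q^1 are the two equations wanted.
    Φ-equation : (ψ - φ) + q * (ψ - φ) ≈ q * (i ·₁ (j ·₁ φ)) + (A.X Φ A.R₂.* A.Y Φ) i j
    Φ-equation = q^-cancel n (begin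
      qⁿ * ((ψ - φ) + q * (ψ - φ))          ≈⟨ solve 3 (λ t q x → t :* (x :+ q :* x) := (#1 :+ q) :* (t :* x)) refl qⁿ q (ψ - φ) ⟩
      (1# + q) * (qⁿ * (ψ - φ))             ≈⟨ *-congˡ {1# + q} qDc ⟨
      (1# + q) * (q * D c)                  ≈⟨ solve 3 (λ q o d → o :* (q :* d) := q :* (o :* d)) refl q (1# + q) (D c) ⟩
      q * P c                               ≈⟨ *-congˡ {q} (trans (CG.connected-equation i j) (A.const₂-* q (A.X (A.Y CG.C) A.R₂.+ A.X CG.C A.R₂.* A.Y CG.C) i j)) ⟩
      q * (q * (A.X (A.Y CG.C) i j + Π))    ≈⟨ solve 3 (λ q x p → q :* (q :* (x :+ p)) := q :* (q :* x) :+ q :* (q :* p)) refl q (A.X (A.Y CG.C) i j) Π ⟩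
      q * (q * A.X (A.Y CG.C) i j) + q * (q * Π)
        ≈⟨ +-cong (*-congˡ {q} (trans (*-congˡ {q} (reflexive (A.X-coefficient (A.Y CG.C) i j))) qXYC)) (scaled-product i j) ⟩
      q * (qⁿ * (i ·₁ (j ·₁ φ))) + qⁿ * Π′  ≈⟨ solve 4 (λ q t x p → q :* (t :* x) :+ t :* p := t :* (q :* x :+ p)) refl q qⁿ (i ·₁ (j ·₁ φ)) Π′ ⟩
      qⁿ * (q * (i ·₁ (j ·₁ φ)) + Π′)       ∎)
      where
      Π = (A.X CG.C A.R₂.* A.Y CG.C) i j
      Π′ = (A.X Φ A.R₂.* A.Y Φ) i j

  module _ where
    private
      Rq₁ = PowerSeries.seriesRing Rq
      Q₁ = PowerSeries.seriesRing Q

      coefficient : ℕ → A.Series₂ → S.Series₂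
      coefficient k f i j = f i j k

      X-coefficientᵏ : ∀ k f i j → A.X f i j k ≡ S.X (coefficient k f) i j
      X-coefficientᵏ k f i j = ≡.trans (≡.cong (λ g → g k) (A.X-coefficient f i j))
        (≡.trans (Pq.×-coefficient i (f i j) k) (≡.sym (S.X-coefficient (coefficient k f) i j)))

      Y-coefficientᵏ : ∀ k f i j → A.Y f i j k ≡ S.Y (coefficient k f) i j
      Y-coefficientᵏ k f i j = Pq.×-coefficient j (f i j) k

    product-coefficient₀ : ∀ f g → coefficient 0 (f A.R₂.* g) S.R₂.≈ coefficient 0 f S.R₂.* coefficient 0 g
    product-coefficient₀ f g i j =
      Comparison.⊗-related Rq₁ Q₁ (λ x y → x j 0 ≡ y j) (≡.cong₂ ℚ._+_) f g (λ a b → f a b 0) (λ a b → g a b 0) i λ a a′ _ →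
      Comparison.⊗-related Rq Q (λ x y → x 0 ≡ y) (≡.cong₂ ℚ._+_) (f a) (g a′) (λ b → f a b 0) (λ b → g a′ b 0) j λ _ _ _ → ≡.refl

    product-coefficient₁ : ∀ f g → coefficient 1 (f A.R₂.* g) S.R₂.≈
      (coefficient 0 f S.R₂.* coefficient 1 g) S.R₂.+ (coefficient 1 f S.R₂.* coefficient 0 g)
    product-coefficient₁ f g = Comparison.⊗-leibniz Rq₁ Q₁ (λ x j → x j 0) (λ x j → x j 1) (λ _ _ _ → ≡.refl)
      (λ x y → Comparison.⊗-leibniz Rq Q (λ x → x 0) (λ x → x 1) (λ _ _ → ≡.refl) (λ _ _ → ≡.refl) x y) f g

    coefficient-XΦ : ∀ k → coefficient k (A.X Φ) S.R₂.≈ S.X (F k)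
    coefficient-XΦ k = X-coefficientᵏ k Φ

    coefficient-YΦ : ∀ k → coefficient k (A.Y Φ) S.R₂.≈ S.Y (F k)
    coefficient-YΦ k = Y-coefficientᵏ k Φ

  module _ (i j : ℕ) where
    private
      n = i ℕ.+ j
      ψ : Carrier
      ψ = n ·₁ Φ i j + Pq.euler (Φ i j)
      u = ψ - Φ i j
      Π = (A.X Φ A.R₂.* A.Y Φ) i j
      E : ℕ → ℚ
      E k = S.X (F k) i j ℚ.+ S.Y (F k) i j

      open IntegerSolver Q using () renaming (solve to solveℚ; _:+_ to _:+ℚ_; _:-_ to _:-ℚ_; _:=_ to _:=ℚ_)

      nF : ∀ k → (n ·₁ Φ i j) k ≡ E k
      nF k = ≡.trans (Pq.×-coefficient n (Φ i j) k) (≡.trans (×-homo-+ (F k i j) i j)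
        (≡.cong (ℚ._+ j · F k i j) (≡.sym (S.X-coefficient (F k) i j))))

      u₀ : u 0 ≡ E 0 ℚ.- F 0 i j
      u₀ = ≡.cong (ℚ._- F 0 i j) (≡.trans (ℚ.+-identityʳ _) (nF 0))

      -- At Betti number 1 there are as many edges as vertices, so the Euler term in q cancels the
      -- subtracted `Φ`.
      u₁ : u 1 ≡ E 1
      u₁ = ≡.trans (≡.cong (λ x → (x ℚ.+ (F 1 i j ℚ.+ 0ℚ)) ℚ.- F 1 i j) (nF 1))
        (≡.trans (≡.cong (λ x → (E 1 ℚ.+ x) ℚ.- F 1 i j) (ℚ.+-identityʳ (F 1 i j)))
          (solveℚ 2 (λ a b → (a :+ℚ b) :-ℚ b :=ℚ a) ≡.refl (E 1) (F 1 i j)))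

      Π₀ : Π 0 ≡ (S.X T S.R₂.* S.Y T) i j
      Π₀ = ≡.trans (product-coefficient₀ (A.X Φ) (A.Y Φ) i j) (S.R₂.*-cong (coefficient-XΦ 0) (coefficient-YΦ 0) i j)

      Π₁ : Π 1 ≡ (S.X T S.R₂.* S.Y (F 1)) i j ℚ.+ (S.X (F 1) S.R₂.* S.Y T) i j
      Π₁ = ≡.trans (product-coefficient₁ (A.X Φ) (A.Y Φ) i j)
        (≡.cong₂ ℚ._+_ (S.R₂.*-cong (coefficient-XΦ 0) (coefficient-YΦ 1) i j) (S.R₂.*-cong (coefficient-XΦ 1) (coefficient-YΦ 0) i j))

      XYΦ : (i ·₁ (j ·₁ Φ i j)) 0 ≡ S.X (S.Y T) i j
      XYΦ = ≡.trans (Pq.×-coefficient i (j ·₁ Φ i j) 0) (≡.trans (≡.cong (i ·_) (Pq.×-coefficient j (Φ i j) 0)) (≡.sym (S.X-coefficient (S.Y T) i j)))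

    tree-coefficient : E 0 ℚ.- F 0 i j ≡ (S.X T S.R₂.* S.Y T) i j
    tree-coefficient = ≡.trans (≡.sym u₀) (≡.trans (≡.sym (≡.trans (≡.cong (u 0 ℚ.+_) (q-* u 0)) (ℚ.+-identityʳ (u 0))))
      (≡.trans (Φ-equation i j 0) (≡.trans (≡.cong (ℚ._+ Π 0) (q-* (i ·₁ (j ·₁ Φ i j)) 0)) (≡.trans (ℚ.+-identityˡ (Π 0)) Π₀))))

    unicyclic-coefficient : E 1 ℚ.+ (E 0 ℚ.- F 0 i j) ≡
      S.X (S.Y T) i j ℚ.+ ((S.X T S.R₂.* S.Y (F 1)) i j ℚ.+ (S.X (F 1) S.R₂.* S.Y T) i j)
    unicyclic-coefficient = ≡.trans (≡.sym (≡.cong₂ ℚ._+_ u₁ (≡.trans (q-* u 1) u₀))) (≡.trans (Φ-equation i j 1)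
      (≡.cong₂ ℚ._+_ (≡.trans (q-* (i ·₁ (j ·₁ Φ i j)) 1) XYΦ) Π₁))

  private
    module Solver = IntegerSolver S.P₂.seriesRing
    module S₂ = CommutativeRing S.P₂.seriesRing

  tree-equation : S.X T S₂.+ S.Y T S₂.≈ T S₂.+ S.X T S₂.* S.Y T
  tree-equation = S₂.trans (Solver.solve 3 (λ x y t → x Solver.:+ y Solver.:= t Solver.:+ ((x Solver.:+ y) Solver.:- t)) (λ _ _ → ≡.refl) (S.X T) (S.Y T) T)
    (S₂.+-congˡ {T} tree-coefficient)

  -- The factor 1 + q contributes the lowest-order term T_x + T_y - T here as well; by the tree
  -- equation it is T_x T_y.
  unicyclic-equation : (S.X (F 1) S₂.+ S.Y (F 1)) S₂.+ S.X T S₂.* S.Y T S₂.≈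
    S.X (S.Y T) S₂.+ (S.X T S₂.* S.Y (F 1) S₂.+ S.X (F 1) S₂.* S.Y T)
  unicyclic-equation = S₂.trans (S₂.+-congˡ {S.X (F 1) S₂.+ S.Y (F 1)} (S₂.sym tree-coefficient)) unicyclic-coefficient

-- Range sums and finite convolution sums

module RangeSums (R : CommutativeRing 0ℓ 0ℓ) where
  open CommutativeRing R
  open import Algebra.Properties.CommutativeMonoid.Sum +-commutativeMonoid using (sum; sum-cong-≋)
  open IntegerSolver R using (solve; _:+_; _:*_; _:=_)

  rangeSum : (ℕ → Carrier) → ℕ → ℕ → Carrier
  rangeSum f s zero    = 0#
  rangeSum f s (suc n) = f s + rangeSum f (suc s) n

  rangeSum-cong : ∀ {f g} → (∀ n → f n ≈ g n) → ∀ s n → rangeSum f s n ≈ rangeSum g s n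
  rangeSum-cong eq s zero    = refl
  rangeSum-cong eq s (suc n) = +-cong (eq s) (rangeSum-cong eq (suc s) n)

  sum≈rangeSum : ∀ f s n → sum {n} (λ k → f (s ℕ.+ toℕ k)) ≈ rangeSum f s n
  sum≈rangeSum f s zero    = refl
  sum≈rangeSum f s (suc n) = +-cong (reflexive (≡.cong f (ℕ.+-identityʳ s)))
    (trans (sum-cong-≋ {n} (λ k → reflexive (≡.cong f (ℕ.+-suc s (toℕ k))))) (sum≈rangeSum f (suc s) n))

  rangeSum-linear : ∀ a (f g h : ℕ → Carrier) s n → rangeSum (λ k → a * (f k + g k) * h k) s n ≈
    a * (rangeSum (λ k → f k * h k) s n + rangeSum (λ k → g k * h k) s n)
  rangeSum-linear a f g h s zero    = sym (trans (*-congˡ (+-identityˡ 0#)) (zeroʳ a))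
  rangeSum-linear a f g h s (suc n) = trans (+-congˡ (rangeSum-linear a f g h (suc s) n))
    (solve 6 (λ a f g h x y → a :* (f :+ g) :* h :+ a :* (x :+ y) := a :* ((f :* h :+ x) :+ (g :* h :+ y))) refl a (f s) (g s) (h s) _ _)

  rangeSum-zero : ∀ f s → (∀ k → f (s ℕ.+ k) ≈ 0#) → ∀ n → rangeSum f s n ≈ 0#
  rangeSum-zero f s eq zero    = refl
  rangeSum-zero f s eq (suc n) = trans (+-cong (trans (reflexive (≡.cong f (≡.sym (ℕ.+-identityʳ s)))) (eq 0))
    (rangeSum-zero f (suc s) (λ k → trans (reflexive (≡.cong f (≡.sym (ℕ.+-suc s k)))) (eq (suc k))) n)) (+-identityˡ 0#)

module SeriesSums (R R′ : CommutativeRing 0ℓ 0ℓ) where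
  private
    module R = CommutativeRing R
    module R′ = CommutativeRing R′
  open PowerSeries R using (_⊗_)
  open import Algebra.Properties.CommutativeMonoid.Sum R′.+-commutativeMonoid using (sum⁺-syntax)

  -- The additive map `φ` serves both variables: it extracts the coefficient of y^j for the outer
  -- product and is the identity for the inner one.
  ⊗-sum : (φ : R.Carrier → R′.Carrier) → (∀ x y → φ (x R.+ y) R′.≈ φ x R′.+ φ y) → ∀ f g n →
    φ ((f ⊗ g) n) R′.≈ ∑[ a ≤ n ] φ (f (toℕ a) R.* g (n ∸ toℕ a))
  ⊗-sum φ +-homo f g zero    = R′.sym (R′.+-identityʳ _)
  ⊗-sum φ +-homo f g (suc n) = R′.trans (+-homo _ _) (R′.+-congˡ (⊗-sum φ +-homo (f ∘ suc) g n))

module BivariateSums (R : CommutativeRing 0ℓ 0ℓ) where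
  open Bivariate R
  open import Algebra.Properties.CommutativeMonoid.Sum R.+-commutativeMonoid using (sum; sum⁺-syntax; sum-cong-≋)
  private
    module Σ₀ = RangeSums R
    module Σ₂ = RangeSums P₂.seriesRing

  *-sum : ∀ f g i j → (f R₂.* g) i j R.≈ ∑[ a ≤ i ] (∑[ b ≤ j ] (f (toℕ a) (toℕ b) R.* g (i ∸ toℕ a) (j ∸ toℕ b)))
  *-sum f g i j = R.trans (SeriesSums.⊗-sum P₁.seriesRing R (λ x → x j) (λ _ _ → R.refl) f g i)
    (sum-cong-≋ {suc i} (λ a → SeriesSums.⊗-sum R R (λ x → x) (λ _ _ → R.refl) (f (toℕ a)) (g (i ∸ toℕ a)) j))

  rangeSum-coefficient : ∀ f s n i j → Σ₂.rangeSum f s n i j ≡ Σ₀.rangeSum (λ k → f k i j) s n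
  rangeSum-coefficient f s zero    i j = ≡.refl
  rangeSum-coefficient f s (suc n) i j = ≡.cong (f s i j R.+_) (rangeSum-coefficient f (suc s) n i j)

-- The logarithmic series along L

module _ (R : CommutativeRing 0ℓ 0ℓ) where
  open CommutativeRing R
  open import Algebra.Properties.Semiring.Mult semiring using (×-comm-*; ×-congʳ) renaming (_×_ to _·_)

  -- For n ≥ 2, `c n` is the constant 1/(2n), the coefficient of w^n in f₁; `c-double` states this
  -- in the form in which it meets L W^n = 2n W^n. The element `b` is W / (1 - W).
  module LogarithmicSeries  {L : Carrier → Carrier} (dL : Derivations.IsDerivation R L) {W : Carrier} (LW : L W ≈ W + W)
    (c : ℕ → Carrier) (Lc : ∀ n → L (c n) ≈ 0#) (c-zero : c 0 ≈ 0#) (c-one : c 1 ≈ 0#)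
    (c-double : ∀ k x → c (suc (suc k)) * (suc (suc k) · (x + x)) ≈ x)
    {b : Carrier} (b-equation : b ≈ W + W * b) where
    open RangeSums R
    open import Algebra.Properties.Semiring.Exp semiring using (_^_)
    open IntegerSolver R using (solve; _:+_; _:*_; _:-_; _:=_)
    open import Relation.Binary.Reasoning.Setoid setoid
    private module L = Derivations.IsDerivation dL

    term : ℕ → Carrier
    term n = c n * W ^ n

    private
      L-power : ∀ n → L (W ^ n) ≈ n · (W ^ n + W ^ n)
      L-power zero    = L.1#-homo
      L-power (suc n) = begin
        L (W * W ^ n)                                 ≈⟨ L.leibniz W (W ^ n) ⟩
        L W * W ^ n + W * L (W ^ n)                   ≈⟨ +-cong (*-congʳ LW) (*-congˡ (L-power n)) ⟩
        (W + W) * W ^ n + W * (n · (W ^ n + W ^ n))   ≈⟨ +-cong (distribʳ _ W W) (×-comm-* n W _) ⟩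
        (W ^ suc n + W ^ suc n) + n · (W * (W ^ n + W ^ n)) ≈⟨ +-congˡ (×-congʳ n (distribˡ W _ _)) ⟩
        suc n · (W ^ suc n + W ^ suc n)               ∎

      L-term : ∀ k → L (term (suc (suc k))) ≈ W ^ suc (suc k)
      L-term k = begin
        L (c n * W ^ n)                    ≈⟨ L.leibniz (c n) (W ^ n) ⟩
        L (c n) * W ^ n + c n * L (W ^ n)  ≈⟨ +-cong (trans (*-congʳ (Lc n)) (zeroˡ _)) (*-congˡ (L-power n)) ⟩
        0# + c n * (n · (W ^ n + W ^ n))   ≈⟨ trans (+-identityˡ _) (c-double k (W ^ n)) ⟩
        W ^ n                              ∎
        where n = suc (suc k)

      L-rangeSum : ∀ s n → L (rangeSum term (suc (suc s)) n) ≈ rangeSum (W ^_) (suc (suc s)) n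
      L-rangeSum s zero    = L.0#-homo
      L-rangeSum s (suc n) = trans (L.+-homo _ _) (+-cong (L-term s) (L-rangeSum (suc s) n))

      -- Unfolding `b-equation` n times gives the geometric sum with its exact remainder.
      geometric : ∀ s n → W ^ s * b ≈ rangeSum (W ^_) (suc s) n + W ^ (s ℕ.+ n) * b
      geometric s zero    = trans (*-congʳ (reflexive (≡.cong (W ^_) (≡.sym (ℕ.+-identityʳ s))))) (sym (+-identityˡ _))
      geometric s (suc n) = begin
        W ^ s * b                                                      ≈⟨ *-congˡ b-equation ⟩
        W ^ s * (W + W * b)                                            ≈⟨ solve 3 (λ p w b → p :* (w :+ w :* b) := w :* p :+ (w :* p) :* b) refl (W ^ s) W b ⟩
        W ^ suc s + W ^ suc s * b                                      ≈⟨ +-congˡ (geometric (suc s) n) ⟩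
        W ^ suc s + (rangeSum (W ^_) (suc (suc s)) n + W ^ (suc s ℕ.+ n) * b)   ≈⟨ +-assoc _ _ _ ⟨
        rangeSum (W ^_) (suc s) (suc n) + W ^ (suc s ℕ.+ n) * b        ≈⟨ +-congˡ (*-congʳ (reflexive (≡.cong (W ^_) (≡.sym (ℕ.+-suc s n))))) ⟩
        rangeSum (W ^_) (suc s) (suc n) + W ^ (s ℕ.+ suc n) * b        ∎

    -- The exponents run up to k + 1, which is where substitution stops for coefficients of total
    -- degree k + 1.
    partialSum : ℕ → Carrier
    partialSum k = rangeSum term 0 (suc (suc k))

    partialSum≈ : ∀ k → partialSum k ≈ rangeSum term 2 k
    partialSum≈ k = trans (+-cong (vanish 0 c-zero) (trans (+-congʳ (vanish 1 c-one)) (+-identityˡ _))) (+-identityˡ _)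
      where
      vanish : ∀ n → c n ≈ 0# → term n ≈ 0#
      vanish n eq = trans (*-congʳ eq) (zeroˡ _)

    -- On the partial sum `L` gives W^2 + ... + W^(k+1), which is W b up to the geometric remainder;
    -- the powers cancel.
    L-remainder : ∀ {f} k → L f ≈ W * b → L (f - partialSum k) ≈ W ^ suc k * b
    L-remainder {f} k Lf = begin
      L (f - partialSum k)                          ≈⟨ L.x-y-homo f (partialSum k) ⟩
      L f - L (partialSum k)                        ≈⟨ +-cong (trans Lf (trans (*-congʳ (sym (*-identityʳ W))) (geometric 1 k)))
                                                              (-‿cong (trans (L.cong (partialSum≈ k)) (L-rangeSum 0 k))) ⟩
      rangeSum (W ^_) 2 k + W ^ suc k * b - rangeSum (W ^_) 2 k   ≈⟨ solve 2 (λ s r → (s :+ r) :- s := r) refl _ _ ⟩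
      W ^ suc k * b                                 ∎

-- Uniqueness by order of vanishing

module OrderFiltration where
  open import Defs
  open EdgeGrading using (Q; +-zero)
  open BettiNumbers using (tree-equation; module S)

  Sᴿ : CommutativeRing 0ℓ 0ℓ
  Sᴿ = S.P₂.seriesRing

  module S₂ = CommutativeRing Sᴿ

  open import Algebra.Properties.Semiring.Mult (CommutativeRing.semiring Q) using (×-homo-+; ×-comm-*; ×-congʳ) renaming (_×_ to _·_)

  Ord : ℕ → Series₂ → Set
  Ord n f = ∀ i j → i ℕ.+ j ℕ.< n → f i j ≡ 0ℚ

  Ord-weaken : ∀ {m n f} → m ℕ.≤ n → Ord n f → Ord m f
  Ord-weaken m≤n o i j lt = o i j (ℕ.≤-trans lt m≤n)

  Ord-+ : ∀ {n f g} → Ord n f → Ord n g → Ord n (f S₂.+ g)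
  Ord-+ o p i j lt = +-zero (o i j lt) (p i j lt)

  Ord-neg : ∀ {n f} → Ord n f → Ord n (S₂.- f)
  Ord-neg o i j lt = ≡.cong ℚ.-_ (o i j lt)

  Ord-X : ∀ {n f} → Ord n f → Ord n (S.X f)
  Ord-X {f = f} o i j lt = ≡.trans (S.X-coefficient f i j) (≡.trans (≡.cong (i ·_) (o i j lt)) (×-zeroʳ Q i))

  Ord-Y : ∀ {n f} → Ord n f → Ord n (S.Y f)
  Ord-Y o i j lt = ≡.trans (≡.cong (j ·_) (o i j lt)) (×-zeroʳ Q j)

  Ord-* : ∀ {m n f g} → Ord m f → Ord n g → Ord (m ℕ.+ n) (f S₂.* g)
  Ord-* {m} {n} {f} {g} o p i j lt =
    S.P₂.⊗-closed (λ x → x j ≡ 0ℚ) +-zero f g i λ a a′ a+a′ →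
    S.P₁.⊗-closed (_≡ 0ℚ) +-zero (f a) (g a′) j λ b b′ b+b′ → term a a′ b b′ a+a′ b+b′
    where
    term : ∀ a a′ b b′ → a ℕ.+ a′ ≡ i → b ℕ.+ b′ ≡ j → f a b ℚ.* g a′ b′ ≡ 0ℚ
    term a a′ b b′ ≡.refl ≡.refl with a ℕ.+ b ℕ.<? m | a′ ℕ.+ b′ ℕ.<? n
    ... | yes lt₁ | _       = ≡.trans (≡.cong (ℚ._* g a′ b′) (o a b lt₁)) (ℚ.*-zeroˡ (g a′ b′))
    ... | no _    | yes lt₂ = ≡.trans (≡.cong (f a b ℚ.*_) (p a′ b′ lt₂)) (ℚ.*-zeroʳ (f a b))
    ... | no ge₁  | no ge₂  = ⊥-elim (ℕ.<⇒≱ lt (≡.subst (m ℕ.+ n ℕ.≤_) (interchange a b a′ b′) (ℕ.+-mono-≤ (ℕ.≮⇒≥ ge₁) (ℕ.≮⇒≥ ge₂))))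
      where open import Algebra.Properties.CommutativeSemigroup ℕ.+-commutativeSemigroup using (interchange)

  Ord-one : ∀ {f} → f 0 0 ≡ 0ℚ → Ord 1 f
  Ord-one eq zero zero (s≤s z≤n) = eq

  open IntegerSolver Sᴿ using (solve; _:+_; _:*_; _:-_; _:=_; #1)

  -- To leading order h₁X + h₂Y multiplies a homogeneous component by its degree, which exceeds d.
  first-order-unique : ∀ {h₁ h₂ κ f g} d N → h₁ 0 0 ≡ 1ℚ → h₂ 0 0 ≡ 1ℚ → κ 0 0 ≡ d · 1ℚ → Ord (suc d) f →
    h₁ S₂.* S.X f S₂.+ h₂ S₂.* S.Y f S₂.≈ κ S₂.* f S₂.+ g → Ord N g → Ord N f
  first-order-unique {h₁} {h₂} {κ} {f} {g} d N h₁≡1 h₂≡1 κ≡d of eq og = go N ℕ.≤-refl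
    where
    d₁ : Series₂
    d₁ = S.const₂ (d · 1ℚ)

    error : Series₂
    error = (κ S₂.- d₁) S₂.* f S₂.+ (g S₂.- ((h₁ S₂.- S₂.1#) S₂.* S.X f S₂.+ (h₂ S₂.- S₂.1#) S₂.* S.Y f))

    leading : S.X f S₂.+ S.Y f S₂.≈ d₁ S₂.* f S₂.+ error
    leading = S₂.trans
      (solve 4 (λ h₁ h₂ x y → x :+ y := (h₁ :* x :+ h₂ :* y) :- ((h₁ :- #1) :* x :+ (h₂ :- #1) :* y)) (λ _ _ → ≡.refl) h₁ h₂ (S.X f) (S.Y f))
      (S₂.trans (S₂.+-congʳ {S₂.- ((h₁ S₂.- S₂.1#) S₂.* S.X f S₂.+ (h₂ S₂.- S₂.1#) S₂.* S.Y f)} eq)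
      (solve 5 (λ k d f g r → (k :* f :+ g) :- r := d :* f :+ ((k :- d) :* f :+ (g :- r))) (λ _ _ → ≡.refl) κ d₁ f g
        ((h₁ S₂.- S₂.1#) S₂.* S.X f S₂.+ (h₂ S₂.- S₂.1#) S₂.* S.Y f)))

    -- The differences `κ - d₁`, `h₁ - 1` and `h₂ - 1` have no constant term, so each product gains
    -- one order over `f`; `g` has order `N` by hypothesis.
    error-order : ∀ n → suc n ℕ.≤ N → Ord n f → Ord (suc n) error
    error-order n n<N o = Ord-+ {suc n} {(κ S₂.- d₁) S₂.* f}
      (Ord-* {1} {n} {κ S₂.- d₁} {f} (Ord-one (cancel κ≡d)) o)
      (Ord-+ {suc n} {g} (Ord-weaken {f = g} n<N og)
        (Ord-neg {f = (h₁ S₂.- S₂.1#) S₂.* S.X f S₂.+ (h₂ S₂.- S₂.1#) S₂.* S.Y f}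
          (Ord-+ {suc n} {(h₁ S₂.- S₂.1#) S₂.* S.X f}
            (Ord-* {1} {n} {h₁ S₂.- S₂.1#} {S.X f} (Ord-one (cancel h₁≡1)) (Ord-X {f = f} o))
            (Ord-* {1} {n} {h₂ S₂.- S₂.1#} {S.Y f} (Ord-one (cancel h₂≡1)) (Ord-Y {f = f} o)))))
      where
      cancel : ∀ {x y} → x ≡ y → x ℚ.- y ≡ 0ℚ
      cancel {x} ≡.refl = ℚ.+-inverseʳ x

    degree : ∀ n → suc n ℕ.≤ N → Ord n f → ∀ i j → i ℕ.+ j ≡ n → n · f i j ≡ d · f i j
    degree n n<N o i j ≡.refl = begin
      (i ℕ.+ j) · f i j                ≡⟨ ×-homo-+ (f i j) i j ⟩
      i · f i j ℚ.+ j · f i j          ≡⟨ ≡.cong (ℚ._+ j · f i j) (S.X-coefficient f i j) ⟨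
      S.X f i j ℚ.+ S.Y f i j          ≡⟨ leading i j ⟩
      (d₁ S₂.* f) i j ℚ.+ error i j    ≡⟨ ≡.cong₂ ℚ._+_ (S.const₂-* (d · 1ℚ) f i j) (error-order n n<N o i j ℕ.≤-refl) ⟩
      d · 1ℚ ℚ.* f i j ℚ.+ 0ℚ          ≡⟨ ℚ.+-identityʳ (d · 1ℚ ℚ.* f i j) ⟩
      d · 1ℚ ℚ.* f i j                 ≡⟨ ≡.trans (×-assoc-* d 1ℚ (f i j)) (≡.cong (d ·_) (ℚ.*-identityˡ (f i j))) ⟩
      d · f i j                        ∎
      where
      open ≡.≡-Reasoning
      open import Algebra.Properties.Semiring.Mult (CommutativeRing.semiring Q) using (×-assoc-*)

    excess : ∀ n x → d ℕ.< n → n · x ≡ d · x → x ≡ 0ℚ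
    excess n x d<n eq with ℕ.m≤n⇒∃[o]m+o≡n d<n
    ... | k , ≡.refl = Rationals.×-cancel (suc k) (≡.trans (begin
        suc k · x                              ≡⟨ solveℚ 2 (λ a b → a :=ℚ (b :+ℚ a) :-ℚ b) ≡.refl (suc k · x) (d · x) ⟩
        (d · x ℚ.+ suc k · x) ℚ.- d · x        ≡⟨ ≡.cong (ℚ._- d · x) (×-homo-+ x d (suc k)) ⟨
        (d ℕ.+ suc k) · x ℚ.- d · x            ≡⟨ ≡.cong (λ m → m · x ℚ.- d · x) (ℕ.+-suc d k) ⟩
        (suc d ℕ.+ k) · x ℚ.- d · x            ≡⟨ ≡.cong (ℚ._- d · x) eq ⟩
        d · x ℚ.- d · x                        ≡⟨ ℚ.+-inverseʳ (d · x) ⟩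
        0ℚ                                     ∎) (≡.sym (×-zeroʳ Q (suc k))))
      where
      open ≡.≡-Reasoning
      open IntegerSolver Q using () renaming (solve to solveℚ; _:+_ to _:+ℚ_; _:-_ to _:-ℚ_; _:=_ to _:=ℚ_)

    go : ∀ n → n ℕ.≤ N → Ord n f
    go (suc n) n<N i j lt with i ℕ.+ j ℕ.<? suc d
    ... | yes small = of i j small
    ... | no large with ℕ.m≤n⇒m<n∨m≡n (ℕ.s≤s⁻¹ lt)
    ...   | inj₁ lt′ = go n (ℕ.<⇒≤ n<N) i j lt′
    ...   | inj₂ eq′ = excess n (f i j) (≡.subst (d ℕ.<_) eq′ (ℕ.≮⇒≥ large)) (degree n n<N (go n (ℕ.<⇒≤ n<N)) i j eq′)

  module TE = Derivations.TreeEquation Sᴿ {S.X} {S.Y} S.X-isDerivation S.Y-isDerivation S.XY-comm T tree-equation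
  open TE using (u; v) renaming (W to Wᴿ)

  b : Series₂
  b = S.X (S.Y T)

  Ord-zero : ∀ {f} → (∀ n → Ord n f) → f S₂.≈ S₂.0#
  Ord-zero o i j = o (suc (i ℕ.+ j)) i j ℕ.≤-refl

  -- The constant term of `κ` is 1, so the equation says nothing about the homogeneous part of
  -- degree 1; the coefficients of degree below 2 are therefore computed in `init`.
  δ≈0 : TE.δ S₂.≈ S₂.0#
  δ≈0 = Ord-zero {TE.δ} λ N → first-order-unique {(u S₂.* v) S₂.* u} {(u S₂.* v) S₂.* v} {TE.κ} {TE.δ} {S₂.0#} 1 N ≡.refl ≡.refl ≡.refl init
    (S₂.trans (solve 5 (λ t u v x y → (t :* u) :* x :+ (t :* v) :* y := t :* (u :* x :+ v :* y)) (λ _ _ → ≡.refl) (u S₂.* v) u v (S.X TE.δ) (S.Y TE.δ))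
      (S₂.trans TE.Lδ (S₂.sym (S₂.+-identityʳ (TE.κ S₂.* TE.δ)))))
    (λ _ _ _ → ≡.refl)
    where
    init : Ord 2 TE.δ
    init zero       zero       _ = ≡.refl
    init zero       (suc zero) _ = ≡.refl
    init (suc zero) zero       _ = ≡.refl
    init (suc zero) (suc _) (s≤s (s≤s ()))
    init zero (suc (suc _)) (s≤s (s≤s ()))
    init (suc (suc _)) _ (s≤s (s≤s ()))

  b-equation : b S₂.≈ Wᴿ S₂.+ Wᴿ S₂.* b
  b-equation = S₂.trans (solve 2 (λ b w → b := w :+ (b :- w)) (λ _ _ → ≡.refl) b (Wᴿ S₂.+ Wᴿ S₂.* b))
    (S₂.trans (S₂.+-congˡ {Wᴿ S₂.+ Wᴿ S₂.* b} δ≈0) (S₂.+-identityʳ (Wᴿ S₂.+ Wᴿ S₂.* b)))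

-- The closed form of F₁

module UnicyclicSeries where
  open import Data.Integer.Base using (+_)
  open import Defs
  open EdgeGrading using (Q)
  open BettiNumbers using (tree-equation; unicyclic-equation; module S)
  open OrderFiltration

  open TE using (L; u; v; LW; L-isDerivation) renaming (W to Wᴿ)

  open RangeSums Q
  open import Algebra.Properties.Semiring.Mult (CommutativeRing.semiring Q) using () renaming (_×_ to _·_)
  open import Algebra.Properties.Semiring.Mult S₂.semiring using () renaming (_×_ to _·ₛ_)
  open import Algebra.Properties.Semiring.Exp S₂.semiring using () renaming (_^_ to _^ᴿ_)

  ⊛≈* : ∀ f g → f ⊛ g ≈ f S₂.* g
  ⊛≈* f g i j = ≡.sym (BivariateSums.*-sum Q f g i j)

  Tx≈ : Tx ≈ S.X T
  Tx≈ i j = ≡.trans (Rationals./1-* i (T i j)) (≡.sym (S.X-coefficient T i j))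

  Ty≈ : Ty ≈ S.Y T
  Ty≈ i j = Rationals./1-* j (T i j)

  W≈ : W ≈ Wᴿ
  W≈ i j = ≡.trans (⊛≈* Tx Ty i j) (S₂.*-cong {Tx} {S.X T} {Ty} {S.Y T} Tx≈ Ty≈ i j)

  one≈ : one ≈ S₂.1#
  one≈ zero    zero    = ≡.refl
  one≈ zero    (suc j) = ≡.refl
  one≈ (suc i) j       = ≡.refl

  ^≈ : ∀ n → W ^ n ≈ Wᴿ ^ᴿ n
  ^≈ zero    = one≈
  ^≈ (suc n) i j = ≡.trans (⊛≈* W (W ^ n) i j) (S₂.*-cong {W} {Wᴿ} {W ^ n} {Wᴿ ^ᴿ n} W≈ (^≈ n) i j)

  ⟨⟩≡rangeSum : ∀ (h : Series₁) f i j → (h ⟨ f ⟩) i j ≡ rangeSum (λ n → h n ℚ.* (f ^ n) i j) 0 (suc (i ℕ.+ j))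
  ⟨⟩≡rangeSum h f i j = sum≈rangeSum (λ n → h n ℚ.* (f ^ n) i j) 0 (suc (i ℕ.+ j))

  L-constant : ∀ c → L (S.const₂ c) S₂.≈ S₂.0#
  L-constant c = S₂.trans (S₂.+-cong {u S₂.* S.X (S.const₂ c)} (S₂.*-congˡ {u} X-constant) (S₂.*-congˡ {v} Y-constant))
    (S₂.trans (S₂.+-cong {u S₂.* S₂.0#} (S₂.zeroʳ u) (S₂.zeroʳ v)) (S₂.+-identityˡ S₂.0#))
    where
    X-constant : S.X (S.const₂ c) S₂.≈ S₂.0#
    X-constant zero    j = ≡.refl
    X-constant (suc i) j = ≡.trans (S.X-coefficient (S.const₂ c) (suc i) j) (×-zeroʳ Q (suc i))
    Y-constant : S.Y (S.const₂ c) S₂.≈ S₂.0#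
    Y-constant zero    zero    = ≡.refl
    Y-constant zero    (suc j) = ×-zeroʳ Q (suc j)
    Y-constant (suc i) j       = ×-zeroʳ Q j

  f₁-double : ∀ k x → f₁ (suc (suc k)) ℚ.* (suc (suc k) · (x ℚ.+ x)) ≡ x
  f₁-double k x = begin
    -½ ℚ.* (ℚ.- r ℚ.+ 0ℚ) ℚ.* (n · (x ℚ.+ x))   ≡⟨ solveℚ 3 (λ h r y → h :*ℚ ((:-ℚ r) :+ℚ #0) :*ℚ y :=ℚ (:-ℚ h) :*ℚ (r :*ℚ y)) ≡.refl -½ r (n · (x ℚ.+ x)) ⟩
    (ℚ.- -½) ℚ.* (r ℚ.* (n · (x ℚ.+ x)))         ≡⟨ ≡.cong ((ℚ.- -½) ℚ.*_) (Rationals.1/-×-cancel n (x ℚ.+ x)) ⟩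
    (ℚ.- -½) ℚ.* (x ℚ.+ x)                       ≡⟨ solveℚ 2 (λ h x → h :*ℚ (x :+ℚ x) :=ℚ (h :+ℚ h) :*ℚ x) ≡.refl (ℚ.- -½) x ⟩
    1ℚ ℚ.* x                                     ≡⟨ ℚ.*-identityˡ x ⟩
    x                                            ∎
    where
    open ≡.≡-Reasoning
    open IntegerSolver Q using (con) renaming (solve to solveℚ; _:+_ to _:+ℚ_; _:*_ to _:*ℚ_; :-_ to :-ℚ_; _:=_ to _:=ℚ_)
    n = suc (suc k)
    r = + 1 ℚ./ n
    #0 : ∀ {n} → IntegerSolver.Polynomial Q n
    #0 = con (0 , 0)

  double : ∀ k f → S.const₂ (f₁ (suc (suc k))) S₂.* (suc (suc k) ·ₛ (f S₂.+ f)) S₂.≈ f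
  double k f i j = begin
    (S.const₂ (f₁ n) S₂.* (n ·ₛ (f S₂.+ f))) i j   ≡⟨ S.const₂-* (f₁ n) (n ·ₛ (f S₂.+ f)) i j ⟩
    f₁ n ℚ.* (n ·ₛ (f S₂.+ f)) i j                 ≡⟨ ≡.cong (λ g → f₁ n ℚ.* g j) (S.P₂.×-coefficient n (f S₂.+ f) i) ⟩
    _                                              ≡⟨ ≡.cong (f₁ n ℚ.*_) (S.P₁.×-coefficient n ((f S₂.+ f) i) j) ⟩
    f₁ n ℚ.* (n · (f i j ℚ.+ f i j))               ≡⟨ f₁-double k (f i j) ⟩
    f i j                                          ∎
    where
    open ≡.≡-Reasoning
    n = suc (suc k)

  constant-zero : ∀ {a} → a ≡ 0ℚ → S.const₂ a S₂.≈ S₂.0#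
  constant-zero eq zero    zero    = eq
  constant-zero eq zero    (suc j) = ≡.refl
  constant-zero eq (suc i) j       = ≡.refl

  module LS = LogarithmicSeries Sᴿ L-isDerivation LW (S.const₂ ∘ f₁) (L-constant ∘ f₁)
    (constant-zero ≡.refl) (constant-zero ≡.refl) double {b} b-equation

  f₁⟨W⟩≡ : ∀ i j → (f₁ ⟨ W ⟩) i j ≡ RangeSums.rangeSum Sᴿ LS.term 0 (suc (i ℕ.+ j)) i j
  f₁⟨W⟩≡ i j = begin
    (f₁ ⟨ W ⟩) i j                                                        ≡⟨ ⟨⟩≡rangeSum f₁ W i j ⟩
    rangeSum (λ n → f₁ n ℚ.* (W ^ n) i j) 0 (suc (i ℕ.+ j))               ≡⟨ rangeSum-cong term≡ 0 (suc (i ℕ.+ j)) ⟩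
    rangeSum (λ n → LS.term n i j) 0 (suc (i ℕ.+ j))                      ≡⟨ BivariateSums.rangeSum-coefficient Q LS.term 0 (suc (i ℕ.+ j)) i j ⟨
    RangeSums.rangeSum Sᴿ LS.term 0 (suc (i ℕ.+ j)) i j                   ∎
    where
    open ≡.≡-Reasoning
    term≡ : ∀ n → f₁ n ℚ.* (W ^ n) i j ≡ LS.term n i j
    term≡ n = ≡.trans (≡.cong (f₁ n ℚ.*_) (^≈ n i j)) (≡.sym (S.const₂-* (f₁ n) (Wᴿ ^ᴿ n) i j))

  module _ (R : CommutativeRing 0ℓ 0ℓ) where
    open CommutativeRing R renaming (_≈_ to _≋_)
    open IntegerSolver R using (solve; _:+_; _:*_; _:-_; _:=_; #1)
    open import Relation.Binary.Reasoning.Setoid setoid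

    -- Moving the mixed products to the left turns the unicyclic equation into L F₁ = T_xy - W, and
    -- `b-eq` rewrites the right-hand side as W T_xy.
    transport-unicyclic : ∀ {p q b x y} → x + y + p * q ≋ b + (p * y + x * q) → b ≋ p * q + (p * q) * b →
      (1# - q) * x + (1# - p) * y ≋ (p * q) * b
    transport-unicyclic {p} {q} {b} {x} {y} unicyclic b-eq = begin
      (1# - q) * x + (1# - p) * y                              ≈⟨ solve 4 (λ p q x y → (#1 :- q) :* x :+ (#1 :- p) :* y := ((x :+ y) :+ p :* q) :- (p :* y :+ x :* q) :- p :* q) refl p q x y ⟩
      (x + y + p * q) - (p * y + x * q) - p * q                ≈⟨ +-congʳ (+-congʳ (trans unicyclic (+-congʳ b-eq))) ⟩
      (p * q + (p * q) * b + (p * y + x * q)) - (p * y + x * q) - p * q ≈⟨ solve 3 (λ w b r → (((w :+ w :* b) :+ r) :- r) :- w := w :* b) refl (p * q) b (p * y + x * q) ⟩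
      (p * q) * b                                              ∎

  LF₁ : L (F 1) S₂.≈ Wᴿ S₂.* b
  LF₁ = transport-unicyclic Sᴿ {S.X T} {S.Y T} {b} {S.X (F 1)} {S.Y (F 1)} unicyclic-equation b-equation

  Ord-power : ∀ n → Ord n (Wᴿ ^ᴿ n)
  Ord-power zero    _ _ ()
  Ord-power (suc n) = Ord-* {1} {n} {Wᴿ} {Wᴿ ^ᴿ n} (Ord-one ≡.refl) (Ord-power n)

  -- Along `L` the difference has derivative W^(k+1) T_xy, of order at least k + 2. Uniqueness
  -- applies with `κ` zero, so only the constant term has to be checked by hand.
  truncation : ∀ k → Ord (suc (suc k)) (F 1 S₂.- LS.partialSum k)
  truncation k = first-order-unique {u} {v} {S₂.0#} {F 1 S₂.- LS.partialSum k} {remainder} 0 (suc (suc k)) ≡.refl ≡.refl ≡.refl initial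
    (S₂.trans (LS.L-remainder {F 1} k LF₁) (S₂.trans (S₂.sym (S₂.+-identityˡ remainder)) (S₂.+-congʳ {remainder} (S₂.sym (S₂.zeroˡ (F 1 S₂.- LS.partialSum k))))))
    -- Order k + 1 comes from the power of W, and one more from T_xy.
    (Ord-weaken {f = remainder} (ℕ.≤-reflexive (ℕ.+-comm 1 (suc k))) (Ord-* {suc k} {1} {Wᴿ ^ᴿ suc k} {b} (Ord-power (suc k)) (Ord-one ≡.refl)))
    where
    remainder : Series₂
    remainder = Wᴿ ^ᴿ suc k S₂.* b
    term-zero : ∀ m → LS.term (2 ℕ.+ m) 0 0 ≡ 0ℚ
    term-zero m = ≡.trans (S.const₂-* (f₁ (2 ℕ.+ m)) (Wᴿ ^ᴿ (2 ℕ.+ m)) 0 0)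
      (≡.trans (≡.cong (f₁ (2 ℕ.+ m) ℚ.*_) (Ord-power (2 ℕ.+ m) 0 0 (s≤s z≤n))) (ℚ.*-zeroʳ (f₁ (2 ℕ.+ m))))
    initial : Ord 1 (F 1 S₂.- LS.partialSum k)
    initial = Ord-one (≡.cong (λ x → F 1 0 0 ℚ.- x) (≡.trans (LS.partialSum≈ k 0 0)
      (≡.trans (BivariateSums.rangeSum-coefficient Q LS.term 2 k 0 0) (rangeSum-zero (λ n → LS.term n 0 0) 2 term-zero k))))

  -- At total degree k + 1 the substitution is literally `partialSum k`, and `truncation k` reaches
  -- exactly that degree. Degree zero is a computation.
  F₁≈f₁⟨W⟩ : F 1 ≈ f₁ ⟨ W ⟩
  F₁≈f₁⟨W⟩ = λ { zero zero → ≡.refl ; zero (suc j) → positive 0 (suc j) j ≡.refl ; (suc i) j → positive (suc i) j (i ℕ.+ j) ≡.refl }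
    where
    open import Algebra.Properties.Group (CommutativeRing.+-group Q) using (x∙y⁻¹≈ε⇒x≈y)
    positive : ∀ i j k → i ℕ.+ j ≡ suc k → F 1 i j ≡ (f₁ ⟨ W ⟩) i j
    positive i j k eq = ≡.trans
      (x∙y⁻¹≈ε⇒x≈y (F 1 i j) (LS.partialSum k i j) (truncation k i j (s≤s (ℕ.≤-reflexive eq))))
      (≡.sym (≡.trans (f₁⟨W⟩≡ i j) (≡.cong (λ n → RangeSums.rangeSum Sᴿ LS.term 0 (suc n) i j) eq)))

  module _ (i j : ℕ) where
    private
      open ≡.≡-Reasoning
      g : ℕ → ℚ
      g n = (W ^ n) i j

      g₁ : g 1 ≡ W i j
      g₁ = ≡.trans (⊛≈* W one i j) (≡.trans (S₂.*-congˡ {W} one≈ i j) (S₂.*-identityʳ W i j))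

    w-sum : ∀ k → rangeSum (λ n → w n ℚ.* g n) 0 (suc (suc k)) ≡ W i j
    w-sum k = begin
      0ℚ ℚ.* g 0 ℚ.+ (1ℚ ℚ.* g 1 ℚ.+ tail)                 ≡⟨ ≡.cong₂ ℚ._+_ {0ℚ ℚ.* g 0} {0ℚ} {1ℚ ℚ.* g 1 ℚ.+ tail} {W i j ℚ.+ 0ℚ} (ℚ.*-zeroˡ (g 0))
                                                                (≡.cong₂ ℚ._+_ {1ℚ ℚ.* g 1} {W i j} {tail} {0ℚ} (≡.trans (ℚ.*-identityˡ (g 1)) g₁) tail≡0) ⟩
      0ℚ ℚ.+ (W i j ℚ.+ 0ℚ)                                ≡⟨ ≡.trans (ℚ.+-identityˡ (W i j ℚ.+ 0ℚ)) (ℚ.+-identityʳ (W i j)) ⟩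
      W i j                                                ∎
      where
      tail = rangeSum (λ n → w n ℚ.* g n) 2 k
      tail≡0 : tail ≡ 0ℚ
      tail≡0 = rangeSum-zero (λ n → w n ℚ.* g n) 2 (λ m → ℚ.*-zeroˡ (g (2 ℕ.+ m))) k

    log-sum : rangeSum (λ n → w n ℚ.* g n) 0 (suc (i ℕ.+ j)) ≡ W i j → (f₁ ⟨ W ⟩) i j ≡ (-½ ∙ (log[1- W ] ⊕ W)) i j
    log-sum eq = begin
      (f₁ ⟨ W ⟩) i j                                    ≡⟨ ⟨⟩≡rangeSum f₁ W i j ⟩
      rangeSum (λ n → f₁ n ℚ.* g n) 0 (suc (i ℕ.+ j))   ≡⟨ rangeSum-linear -½ log[1-w] w g 0 (suc (i ℕ.+ j)) ⟩
      -½ ℚ.* (logs ℚ.+ rangeSum (λ n → w n ℚ.* g n) 0 (suc (i ℕ.+ j)))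
        ≡⟨ ≡.cong (-½ ℚ.*_) (≡.cong₂ ℚ._+_ {logs} {log[1- W ] i j} {rangeSum (λ n → w n ℚ.* g n) 0 (suc (i ℕ.+ j))} {W i j} (≡.sym (⟨⟩≡rangeSum log[1-w] W i j)) eq) ⟩
      -½ ℚ.* (log[1- W ] i j ℚ.+ W i j)                 ∎
      where
      logs = rangeSum (λ n → log[1-w] n ℚ.* g n) 0 (suc (i ℕ.+ j))

  f₁⟨W⟩≈log : f₁ ⟨ W ⟩ ≈ -½ ∙ (log[1- W ] ⊕ W)
  -- In degree zero the range ends before the term of exponent 1; the sum is still right because W
  -- has no constant term.
  f₁⟨W⟩≈log zero    zero    = log-sum 0 0 ≡.refl
  f₁⟨W⟩≈log zero    (suc j) = log-sum 0 (suc j) (w-sum 0 (suc j) j)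
  f₁⟨W⟩≈log (suc i) j       = log-sum (suc i) j (w-sum (suc i) j (i ℕ.+ j))

open import Defs
open UnicyclicSeries using (F₁≈f₁⟨W⟩; f₁⟨W⟩≈log)

proposition1p1 : (F 1 ≈ f₁ ⟨ W ⟩) × (F 1 ≈ -½ ∙ (log[1- Tx ⊛ Ty ] ⊕ Tx ⊛ Ty))
proposition1p1 = F₁≈f₁⟨W⟩ , λ i j → ≡.trans (F₁≈f₁⟨W⟩ i j) (f₁⟨W⟩≈log i j)
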